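{- For all integers $\ell \geq 1$ and $k\geq 9\ell^2 - 3\ell +1$, every $2$-connected graph $G$ with a $\Gamma_k$ minor contains $\Gamma_{\ell}^{+}$ or $\nabla_\ell$ as a minor.
   Context: All graphs are finite and simple. For $\ell\ge 0$, $\Gamma_\ell$ denotes the complete binary tree of height $\ell$: the rooted tree in which every non-leaf vertex has exactly two children, with $2^\ell$ leaves and every root-to-leaf path having exactly $\ell$ edges. $\Gamma_\ell^+$ is obtained from $\Gamma_\ell$ by adding one new vertex adjacent to all leaves of $\Gamma_\ell$. The graphs $\nabla_\ell$ ($\ell\ge1$), each with a designated root edge, are defined recursively: $\nabla_1$ is a triangle with one edge designated as root edge; $\nabla_{\ell+1}$ is obtained by taking two disjoint copies of $\nabla_\ell$ with root edges $e_1,e_2$ and a triangle with edges $e_1',e_2',e_3$, identifying $e_i$ with $e_i'$ for $i=1,2$, and declaring $e_3$ the root edge. -}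

module Defs where

import Data.Nat

open import Data.Nat using (ℕ; zero; suc; NonZero; _≤_; _+_; _*_; _∸_)
open import Data.Bool using (Bool; true; false)
open import Data.List using (List; []; _∷_; length)
open import Data.Maybe using (Maybe; just; nothing)
open import Data.Fin using (Fin)
open import Data.Unit using (⊤; tt)
open import Data.Empty using (⊥)
open import Data.Sum using (_⊎_; inj₁; inj₂)
open import Data.Product using (Σ; ∃; _×_; _,_; ∃-syntax)
open import Relation.Nullary using (¬_)
open import Relation.Binary.PropositionalEquality
  using (_≡_; _≢_; refl; cong; subst; trans) renaming (sym to ≡-sym)

record Graph (V : Set) : Set₁ where
  field
    _~_     : V → V → Set
    sym~    : ∀ {x y} → x ~ y → y ~ x
    irrefl~ : ∀ {x} → ¬ (x ~ x)
open Graph public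

data Walk {V : Set} (G : Graph V) (P : V → Set) : V → V → Set where
  here : ∀ {u} → P u → Walk G P u u
  step : ∀ {u w v} → P u → _~_ G u w → Walk G P w v → Walk G P u v

Connected : {V : Set} → Graph V → Set
Connected G = ∀ u v → Walk G (λ _ → ⊤) u v

-- 2-connected (Diestel): more than 2 vertices and G - X connected
-- for every X with |X| < 2 (X = ∅ or X = {x}).
TwoConnected : {n : ℕ} → Graph (Fin n) → Set
TwoConnected {n} G =
  (3 ≤ n) × Connected G ×
  (∀ (x u v : Fin n) → u ≢ x → v ≢ x → Walk G (λ y → y ≢ x) u v)

-- Minors via branch-set models. β v = just h means v lies in the
-- branch set of h (so branch sets are automatically pairwise disjoint).

record MinorModel {W V : Set} (H : Graph W) (G : Graph V) : Set where
  field
    β         : V → Maybe W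
    nonempty  : ∀ h → ∃[ v ] (β v ≡ just h)
    connected : ∀ h u v → β u ≡ just h → β v ≡ just h →
                Walk G (λ x → β x ≡ just h) u v
    edges     : ∀ h h' → _~_ H h h' →
                ∃[ u ] ∃[ v ] (β u ≡ just h × β v ≡ just h' × _~_ G u v)

_≼_ : {W V : Set} → Graph W → Graph V → Set
H ≼ G = MinorModel H G

-- Complete binary tree Γ_ℓ: vertices are bit strings of length ≤ ℓ,
-- root [], children of w are b ∷ w. Leaves: strings of length ℓ.

TV : ℕ → Set
TV ℓ = Σ (List Bool) (λ w → length w ≤ ℓ)

TAdj : ∀ ℓ → TV ℓ → TV ℓ → Set
TAdj ℓ (w , _) (w' , _) = (∃[ b ] (w' ≡ b ∷ w)) ⊎ (∃[ b ] (w ≡ b ∷ w'))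

private
  n≢1+n : ∀ n → n ≢ suc n
  n≢1+n zero ()
  n≢1+n (suc n) p = n≢1+n n (cong Data.Nat.pred p)

  noCycle : ∀ (w : List Bool) b → w ≢ b ∷ w
  noCycle w b p = n≢1+n (length w) (cong length p)

Γ : (ℓ : ℕ) → Graph (TV ℓ)
Γ ℓ = record { _~_ = TAdj ℓ ; sym~ = λ {x} {y} → s {x} {y} ; irrefl~ = λ {x} → i {x} }
  where
  s : ∀ {x y : TV ℓ} → TAdj ℓ x y → TAdj ℓ y x
  s (inj₁ p) = inj₂ p
  s (inj₂ p) = inj₁ p
  i : ∀ {x : TV ℓ} → ¬ TAdj ℓ x x
  i {w , _} (inj₁ (b , p)) = noCycle w b p
  i {w , _} (inj₂ (b , p)) = noCycle w b p

Γ⁺Adj : ∀ ℓ → Maybe (TV ℓ) → Maybe (TV ℓ) → Set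
Γ⁺Adj ℓ (just x) (just y) = TAdj ℓ x y
Γ⁺Adj ℓ (just (w , _)) nothing = length w ≡ ℓ
Γ⁺Adj ℓ nothing (just (w , _)) = length w ≡ ℓ
Γ⁺Adj ℓ nothing nothing = ⊥

Γ⁺ : (ℓ : ℕ) → Graph (Maybe (TV ℓ))
Γ⁺ ℓ = record { _~_ = Γ⁺Adj ℓ ; sym~ = λ {x} {y} → s {x} {y} ; irrefl~ = λ {x} → i {x} }
  where
  s : ∀ {x y} → Γ⁺Adj ℓ x y → Γ⁺Adj ℓ y x
  s {just x} {just y} p = sym~ (Γ ℓ) {x} {y} p
  s {just _} {nothing} p = p
  s {nothing} {just _} p = p
  i : ∀ {x} → ¬ Γ⁺Adj ℓ x x
  i {just x} p = irrefl~ (Γ ℓ) {x} p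

-- ∇ graphs. NV m is the vertex set of ∇_{m+1}: the two endpoints of
-- the root edge (inj₁ false, inj₁ true) plus inner vertices NI m.
-- ∇_1: triangle with apex tt.  ∇_{m+2}: new triangle r0 r1 t with root
-- edge r0 r1; copy 1 of ∇_{m+1} glued with its root edge onto r0 t,
-- copy 2 glued with its root edge onto r1 t.

NI : ℕ → Set
NI zero = ⊤
NI (suc m) = ⊤ ⊎ (NI m ⊎ NI m)

NV : ℕ → Set
NV m = Bool ⊎ NI m

c₁ c₂ : ∀ {m} → NV m → NV (suc m)
c₁ (inj₁ false) = inj₁ false
c₁ (inj₁ true)  = inj₂ (inj₁ tt)
c₁ (inj₂ i)     = inj₂ (inj₂ (inj₁ i))
c₂ (inj₁ false) = inj₁ true
c₂ (inj₁ true)  = inj₂ (inj₁ tt)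
c₂ (inj₂ i)     = inj₂ (inj₂ (inj₂ i))

private
  c₁-inj : ∀ {m} {a b : NV m} → c₁ a ≡ c₁ b → a ≡ b
  c₁-inj {a = inj₁ false} {inj₁ false} refl = refl
  c₁-inj {a = inj₁ true}  {inj₁ true}  refl = refl
  c₁-inj {a = inj₂ i}     {inj₂ .i}    refl = refl
  c₁-inj {a = inj₁ false} {inj₁ true}  ()
  c₁-inj {a = inj₁ false} {inj₂ _}     ()
  c₁-inj {a = inj₁ true}  {inj₁ false} ()
  c₁-inj {a = inj₁ true}  {inj₂ _}     ()
  c₁-inj {a = inj₂ _}     {inj₁ false} ()
  c₁-inj {a = inj₂ _}     {inj₁ true}  ()

  c₂-inj : ∀ {m} {a b : NV m} → c₂ a ≡ c₂ b → a ≡ b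
  c₂-inj {a = inj₁ false} {inj₁ false} refl = refl
  c₂-inj {a = inj₁ true}  {inj₁ true}  refl = refl
  c₂-inj {a = inj₂ i}     {inj₂ .i}    refl = refl
  c₂-inj {a = inj₁ false} {inj₁ true}  ()
  c₂-inj {a = inj₁ false} {inj₂ _}     ()
  c₂-inj {a = inj₁ true}  {inj₁ false} ()
  c₂-inj {a = inj₁ true}  {inj₂ _}     ()
  c₂-inj {a = inj₂ _}     {inj₁ false} ()
  c₂-inj {a = inj₂ _}     {inj₁ true}  ()

NAdj : ∀ m → NV m → NV m → Set
NAdj zero x y = x ≢ y
NAdj (suc m) x y =
    (x ≡ inj₁ false × y ≡ inj₁ true)
  ⊎ (x ≡ inj₁ true × y ≡ inj₁ false)
  ⊎ (∃[ a ] ∃[ b ] (NAdj m a b × c₁ a ≡ x × c₁ b ≡ y))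
  ⊎ (∃[ a ] ∃[ b ] (NAdj m a b × c₂ a ≡ x × c₂ b ≡ y))

private
  NAdj-sym : ∀ m {x y} → NAdj m x y → NAdj m y x
  NAdj-sym zero p q = p (≡-sym q)
  NAdj-sym (suc m) (inj₁ (p , q)) = inj₂ (inj₁ (q , p))
  NAdj-sym (suc m) (inj₂ (inj₁ (p , q))) = inj₁ (q , p)
  NAdj-sym (suc m) (inj₂ (inj₂ (inj₁ (a , b , e , p , q)))) =
    inj₂ (inj₂ (inj₁ (b , a , NAdj-sym m e , q , p)))
  NAdj-sym (suc m) (inj₂ (inj₂ (inj₂ (a , b , e , p , q)))) =
    inj₂ (inj₂ (inj₂ (b , a , NAdj-sym m e , q , p)))

  NAdj-irr : ∀ m {x} → ¬ NAdj m x x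
  NAdj-irr zero p = p refl
  NAdj-irr (suc m) (inj₁ (refl , ()))
  NAdj-irr (suc m) (inj₂ (inj₁ (refl , ())))
  NAdj-irr (suc m) (inj₂ (inj₂ (inj₁ (a , b , e , p , q)))) =
    NAdj-irr m (subst (NAdj m a) (≡-sym (c₁-inj (trans p (≡-sym q)))) e)
  NAdj-irr (suc m) (inj₂ (inj₂ (inj₂ (a , b , e , p , q)))) =
    NAdj-irr m (subst (NAdj m a) (≡-sym (c₂-inj (trans p (≡-sym q)))) e)

∇′ : (m : ℕ) → Graph (NV m)
∇′ m = record { _~_ = NAdj m ; sym~ = NAdj-sym m ; irrefl~ = NAdj-irr m }

∇V : ℕ → Set
∇V zero = ⊥
∇V (suc m) = NV m

∇ : (ℓ : ℕ) → {{NonZero ℓ}} → Graph (∇V ℓ)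
∇ (suc m) = ∇′ m

{-# OPTIONS --safe #-}
{-
In a 2-connected graph U with two root vertices r₀, r₁ and a large binary tree model, go down to a
subtree D avoiding the roots and split the rest of U into connected A₀ ∋ r₀ and A₁ ∋ r₁. Let S₁, S₂ be
the two child subtrees of D. If every depth-ℓ subtree of some Sᵢ is adjacent to U ∖ Sᵢ, contracting
U ∖ Sᵢ gives Γ_ℓ⁺. Otherwise some subtree Y of Sᵢ sends no edge out of Sᵢ, so no vertex of Y is a cut
vertex of Sᵢ and Y lies in a 2-connected block Bᵢ of Sᵢ, onto which Sᵢ retracts. A bipolar order of
U with S₁ and S₂ contracted then shows that B₁ and B₂ are attached to the rest of U either in series
between r₀ and r₁, or in parallel between a connected set reachable from one root and the other root.
Series attachments glue two rooted ∇_m into ∇_{m+1}; parallel attachments with a common orientation glue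
two rooted Γ_a⁺ into Γ_{a+1}⁺. As in the Ramsey argument for trees coloured with three colours, 3(ℓ − 1)
rounds, each costing ℓ + 3 levels of the tree, force one of the two graphs.
-}
module Submission where

open import Defs
open import Data.Bool using (Bool; true; false)
import Data.Bool.Properties as Bool
open import Data.Empty using (⊥; ⊥-elim)
open import Data.Fin using (Fin; zero; suc)
open import Data.Fin.Properties using (_≟_; any?)
open import Data.Fin.Subset using (Subset; ∣_∣)
import Data.Fin.Subset.Properties as Subset
open import Data.List using (List; []; _∷_; _++_; _∷ʳ_; length; reverse)
open import Data.List.Properties using
  (reverse-injective; reverse-involutive; unfold-reverse; length-reverse; ++-assoc; ++-cancelʳ; ∷ʳ-injective; length-++; ≡-dec)
open import Data.Maybe as Maybe using (Maybe; just; nothing)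
import Data.Maybe.Properties as Maybe
open import Data.Nat using (ℕ; zero; suc; NonZero; _≤_; _<_; z≤n; s≤s; _+_; _*_; _∸_)
open import Data.Nat.Properties using
  (≤-refl; ≤-trans; ≤-reflexive; ≤-irrelevant; n≤1+n; 1+n≰n; m≤m+n; m≤n+m; m+n∸n≡m; +-suc; +-comm; +-assoc; +-monoˡ-≤; suc-injective)
open import Data.Nat.Solver using (module +-*-Solver)
open import Data.Product using (Σ; ∃-syntax; _×_; _,_; proj₁; proj₂)
open import Data.Sum using (_⊎_; inj₁; inj₂)
open import Data.Unit using (⊤; tt)
open import Data.Vec using (tabulate; _[_]=_)
open import Data.Vec.Properties using (lookup∘tabulate; []=⇒lookup; lookup⇒[]=)
open import Function using (_∘_; id)
open import Relation.Binary.PropositionalEquality using (_≡_; _≢_; refl; sym; trans; cong; subst; subst₂)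
open import Relation.Nullary using (¬_; Dec; yes; no; does)
open import Relation.Nullary.Decidable using (_×-dec_; _⊎-dec_; ¬?; dec-true)

-- The obstacle is that a subtree of a 2-connected graph need not span a 2-connected set, while both
-- target graphs must be assembled around prescribed vertices. The statement proved by induction is
-- therefore rooted: for any two distinct roots in a 2-connected U there is a ∇ model whose root
-- edge joins sets containing the roots, or a Γ⁺ model whose apex set contains one root and whose
-- tree root is attached to a set containing the other. The second kind comes in two orientations,
-- and merging needs equal orientations; these two and ∇ are the three colours. Each colour has a
-- target index, all starting at ℓ - 1. A round lowers one of them, the same for both blocks, and
-- the models at the bottom come from splitting a set around a third vertex. A retraction is
-- recorded, not only a block, because edges from outside may end anywhere in S. The fibre of b
-- hangs on b alone, so such an edge can be continued to B at one vertex while the rest of B stays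
-- free for the recursion. The argument is constructive: sets carry a membership test, and searches
-- recurse on cardinalities.

record VSet (n : ℕ) : Set₁ where
  constructor vset
  field
    mem  : Fin n → Set
    mem? : ∀ v → Dec (mem v)
open VSet public

module _ {n : ℕ} where

  infix 4 _∈_ _∉_ _∈?_ _⊆_
  infixr 6 _∪_
  infixl 7 _∖_

  _∈_ _∉_ : Fin n → VSet n → Set
  v ∈ A = mem A v
  v ∉ A = ¬ (v ∈ A)

  _∈?_ : ∀ v A → Dec (v ∈ A)
  v ∈? A = mem? A v

  _⊆_ Disjoint : VSet n → VSet n → Set
  A ⊆ B = ∀ {v} → v ∈ A → v ∈ B
  Disjoint A B = ∀ {v} → v ∈ A → v ∈ B → ⊥

  _∪_ _∖_ : VSet n → VSet n → VSet n
  A ∪ B = vset (λ v → v ∈ A ⊎ v ∈ B) (λ v → v ∈? A ⊎-dec v ∈? B)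
  A ∖ B = vset (λ v → v ∈ A × v ∉ B) (λ v → v ∈? A ×-dec ¬? (v ∈? B))

  ｛_｝ : Fin n → VSet n
  ｛ u ｝ = vset (_≡ u) (_≟ u)

  ∅ full : VSet n
  ∅ = vset (λ _ → ⊥) (λ _ → no λ ())
  full = vset (λ _ → ⊤) (λ _ → yes tt)

  toSubset : VSet n → Subset n
  toSubset A = tabulate (λ v → does (v ∈? A))

  card : VSet n → ℕ
  card A = ∣ toSubset A ∣

  -- Growing components, peeling, pruning and spanning all recurse on a number above some
  -- cardinality; this strict drop is what lets that number decrease.
  card-< : ∀ A B → A ⊆ B → ∀ {x} → x ∈ B → x ∉ A → card A < card B
  card-< A B A⊆B {x} x∈B x∉A = Subset.p⊂q⇒∣p∣<∣q∣
    ( (λ {v} i → to B v (A⊆B (from A v i))) , x , to B x x∈B , (λ i → x∉A (from A x i)))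
    where
    to : ∀ C v → v ∈ C → toSubset C [ v ]= true
    to C v i = lookup⇒[]= v (toSubset C) (trans (lookup∘tabulate _ v) (dec-true (v ∈? C) i))
    from : ∀ C v → toSubset C [ v ]= true → v ∈ C
    from C v i with v ∈? C | trans (sym (lookup∘tabulate (λ w → does (w ∈? C)) v)) ([]=⇒lookup i)
    ... | yes p | _ = p

-- Walks, connected sets, adjacent sets and components.

module Connectivity {n : ℕ} (G : Graph (Fin n)) (_~?_ : ∀ u v → Dec (Graph._~_ G u v)) where

  infix 4 _⌢_
  _⌢_ : Fin n → Fin n → Set
  _⌢_ = Graph._~_ G

  ⌢-sym : ∀ {u v} → u ⌢ v → v ⌢ u
  ⌢-sym = Graph.sym~ G

  Path : VSet n → Fin n → Fin n → Set
  Path A = Walk G (_∈ A)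

  module _ {P : Fin n → Set} where

    start∈ : ∀ {u v} → Walk G P u v → P u
    start∈ (here p) = p
    start∈ (step p _ _) = p

    infixr 5 _◅◅_
    _◅◅_ : ∀ {u v w} → Walk G P u v → Walk G P v w → Walk G P u w
    here _ ◅◅ q = q
    step p e w ◅◅ q = step p e (w ◅◅ q)

    flip : ∀ {u v} → Walk G P u v → Walk G P v u
    flip w = go w (here (start∈ w))
      where
      go : ∀ {u v x} → Walk G P u v → Walk G P u x → Walk G P v x
      go (here p) acc = acc
      go (step p e w) acc = go w (step (start∈ w) (⌢-sym e) acc)

    -- The source of most adjacencies below: connectivity becomes an edge across a chosen cut. Both
    -- ends keep P, so the edge stays in the set in which the walk runs.
    exit : ∀ C {u v} → Walk G P u v → u ∈ C → v ∉ C →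
           ∃[ x ] ∃[ y ] (x ∈ C × y ∉ C × x ⌢ y × P x × P y)
    exit C (here p) i o = ⊥-elim (o i)
    exit C {u} (step {w = w} p e r) i o with w ∈? C
    ... | yes j = exit C r j o
    ... | no k  = u , w , i , k , e , p , start∈ r

  widen : ∀ {P Q : Fin n → Set} {u v} → (∀ {x} → P x → Q x) → Walk G P u v → Walk G Q u v
  widen i (here p) = here (i p)
  widen i (step p e w) = step (i p) e (widen i w)

  -- The empty set is connected in this sense, so ∅ can stand for a missing large class in
  -- `blob-classes`.
  record Conn (A : VSet n) : Set where
    constructor conn
    field path : ∀ {u v} → u ∈ A → v ∈ A → Path A u v
  open Conn public

  record Adj (A B : VSet n) : Set where
    constructor adj
    field {src tgt} : Fin n
          src∈ : src ∈ A
          tgt∈ : tgt ∈ B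
          edge : src ⌢ tgt
  open Adj public

  adj-sym : ∀ {A B} → Adj A B → Adj B A
  adj-sym (adj a b e) = adj b a (⌢-sym e)

  adj-mono : ∀ {A B A′ B′} → A ⊆ A′ → B ⊆ B′ → Adj A B → Adj A′ B′
  adj-mono i j (adj a b e) = adj (i a) (j b) e

  adj? : ∀ A B → Dec (Adj A B)
  adj? A B with any? (λ a → any? (λ b → a ∈? A ×-dec b ∈? B ×-dec a ~? b))
  ... | yes (_ , _ , a , b , e) = yes (adj a b e)
  ... | no k = no λ { (adj a b e) → k (_ , _ , a , b , e) }

  star : ∀ {A} c → (∀ {v} → v ∈ A → Path A v c) → Conn A
  star c f = conn λ u v → f u ◅◅ flip (f v)

  conn-≐ : ∀ {A B} → A ⊆ B → B ⊆ A → Conn A → Conn B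
  conn-≐ i j c = conn λ u v → widen i (path c (j u) (j v))

  conn-∪ : ∀ {A B} → Conn A → Conn B → Adj A B → Conn (A ∪ B)
  conn-∪ {A} {B} c d (adj {a} {b} a∈ b∈ e) = star a λ
    { (inj₁ i) → widen inj₁ (path c i a∈)
    ; (inj₂ i) → widen inj₂ (path d i b∈) ◅◅ step (inj₂ b∈) (⌢-sym e) (here (inj₁ a∈)) }

  conn-∪-meet : ∀ {A B} → Conn A → Conn B → ∀ {x} → x ∈ A → x ∈ B → Conn (A ∪ B)
  conn-∪-meet {A} {B} c d {x} i j = star x λ
    { (inj₁ k) → widen inj₁ (path c k i)
    ; (inj₂ k) → widen inj₂ (path d k j) }

  conn-｛｝ : ∀ u → Conn ｛ u ｝
  conn-｛｝ u = star u λ { refl → here refl }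

  conn-∅ : Conn ∅
  conn-∅ = conn λ ()

  split-adj : ∀ {U A B} → Conn U → U ⊆ (A ∪ B) → Disjoint A B →
              ∀ {a b} → a ∈ A → a ∈ U → b ∈ B → b ∈ U → Adj A B
  split-adj {U} {A} {B} c cov dis a∈ a∈U b∈ b∈U
    with exit A (path c a∈U b∈U) a∈ (λ i → dis i b∈)
  ... | x , y , x∈ , y∉ , e , _ , y∈U with cov y∈U
  ...   | inj₁ i = ⊥-elim (y∉ i)
  ...   | inj₂ i = adj x∈ i e

  -- The component of u in S ∪ {u}.
  record Component (S : VSet n) (u : Fin n) : Set₁ where
    field
      set     : VSet n
      base∈   : u ∈ set
      within  : set ⊆ (S ∪ ｛ u ｝)
      isConn  : Conn set
      closed  : ∀ {x y} → x ∈ set → y ∈ S → x ⌢ y → y ∈ set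

    ⊆S : u ∈ S → set ⊆ S
    ⊆S i j with within j
    ... | inj₁ k = k
    ... | inj₂ refl = i

    reach : ∀ {P : Fin n → Set} {x y} → (∀ {v} → P v → v ∈ S) → x ∈ set → Walk G P x y → y ∈ set
    reach i x∈ (here _) = x∈
    reach i x∈ (step _ e w) = reach i (closed x∈ (i (start∈ w)) e) w

    maximal : ∀ {A x} → Conn A → A ⊆ S → x ∈ A → x ∈ set → A ⊆ set
    maximal {A} c i x∈A x∈ j = reach i x∈ (path c x∈A j)

  component : ∀ S u → Component S u
  component S u = grow (suc (card (S ∖ ｛ u ｝))) ｛ u ｝ refl inj₂ (conn-｛｝ u) ≤-refl
    where
    grow : ∀ k C → u ∈ C → C ⊆ (S ∪ ｛ u ｝) → Conn C → card (S ∖ C) < k → Component S u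
    grow (suc k) C u∈C C⊆ c (s≤s lt) with adj? C (S ∖ C)
    ... | no ¬a = record { set = C ; base∈ = u∈C ; within = C⊆ ; isConn = c
                         ; closed = cl }
      where
      cl : ∀ {x y} → x ∈ C → y ∈ S → x ⌢ y → y ∈ C
      cl {x} {y} i j e with y ∈? C
      ... | yes k = k
      ... | no k = ⊥-elim (¬a (adj i (j , k) e))
    ... | yes (adj {a} {b} a∈ (b∈S , b∉C) e) = grow k C′ (inj₁ u∈C) C′⊆ c′
            (≤-trans (card-< (S ∖ C′) (S ∖ C) (λ { (i , o) → i , o ∘ inj₁ }) (b∈S , b∉C) (λ { (_ , o) → o (inj₂ refl) })) lt)
      where
      C′ : VSet n
      C′ = C ∪ ｛ b ｝
      C′⊆ : C′ ⊆ (S ∪ ｛ u ｝)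
      C′⊆ (inj₁ i) = C⊆ i
      C′⊆ (inj₂ refl) = inj₁ b∈S
      c′ : Conn C′
      c′ = conn-∪ c (conn-｛｝ b) (adj a∈ refl e)

-- Bipolar orders of a graph with contracted classes.

module Peeling {n : ℕ} (G : Graph (Fin n)) (_~?_ : ∀ u v → Dec (Graph._~_ G u v)) where
  open Connectivity G _~?_

  -- The contracted graph behind a bipolar order with sink T. By `share`, classes that meet
  -- coincide; by `without` and `without-target`, neither a class outside T nor T itself separates
  -- U.
  record Classes (U T : VSet n) : Set₁ where
    field
      cls     : Fin n → VSet n
      self    : ∀ v → v ∈ cls v
      share   : ∀ {u v z} → z ∈ cls u → z ∈ cls v → u ∈ cls v
      isConn  : ∀ v → Conn (cls v)
      inside  : ∀ {v} → v ∈ U → cls v ⊆ U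
      avoids  : ∀ {v} → v ∈ U → v ∉ T → Disjoint (cls v) T
      without : ∀ {v} → v ∈ U → v ∉ T → Conn (U ∖ cls v)
      target  : Conn T
      {t}     : Fin n
      t∈T     : t ∈ T
      without-target : Conn (U ∖ T)

  module _ {U T : VSet n} (K : Classes U T) where
    open Classes K

    -- A prefix A of the order and the suffix R that is left. `whole` says that outside T the suffix
    -- is a union of classes.
    record Bipartition (A R : VSet n) : Set where
      field
        A⊆U    : A ⊆ U
        R⊆U    : R ⊆ U
        cover  : U ⊆ (A ∪ R)
        apart  : Disjoint A R
        A-conn : Conn A
        R-conn : Conn R
        T⊆R    : T ⊆ R
        whole  : ∀ {v} → v ∈ R → v ∉ T → cls v ⊆ R
        {a}    : Fin n
        a∈A    : a ∈ A

    record Peelable (A R : VSet n) : Set where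
      field
        {item}   : Fin n
        item∈R   : item ∈ R
        item∉T   : item ∉ T
        touches  : Adj A (cls item)
        leaves   : Conn (R ∖ cls item)

    module _ {A R : VSet n} (B : Bipartition A R) where
      open Bipartition B

      private
        C : ∀ v → Component (R ∖ cls v) t
        C v = component (R ∖ cls v) t

      -- Among the candidates v, pass to one whose component of R ∖ cls v around T is larger.
      peel-from : ∀ k {v} → v ∈ R → v ∉ T → Adj A (cls v) → card (R ∖ Component.set (C v)) < k → Peelable A R
      peel-from (suc k) {v} v∈R v∉T tch (s≤s lt) with any? (λ w → w ∈? R ∖ cls v ×-dec ¬? (w ∈? Component.set (C v)))
      ... | no ¬w = record { item∈R = v∈R ; item∉T = v∉T ; touches = tch
            ; leaves = conn-≐ (⊆S t∈) all (Component.isConn (C v)) }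
        where
        open Component (C v)
        t∈ : t ∈ R ∖ cls v
        t∈ = T⊆R t∈T , λ i → avoids (R⊆U v∈R) v∉T i t∈T
        all : (R ∖ cls v) ⊆ set
        all {w} i with w ∈? set
        ... | yes j = j
        ... | no j = ⊥-elim (¬w (w , i , j))
      -- Let D be the component of w in `R ∖ cls v`. Since `U ∖ cls v` is connected, an edge leaves
      -- D inside it, and by closedness of D it must end in A. Its end x in D is the next candidate.
      ... | yes (w , (w∈R , w∉v) , w∉C) = step-up (exit D.set (path (without (R⊆U v∈R) v∉T) (R⊆U w∈R , w∉v) (A⊆U a∈A , a∉v)) D.base∈ a∉D)
        where
        module C₀ = Component (C v)
        module D = Component (component (R ∖ cls v) w)
        t∈ : t ∈ R ∖ cls v
        t∈ = T⊆R t∈T , λ i → avoids (R⊆U v∈R) v∉T i t∈T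
        a∉v : Bipartition.a B ∉ cls v
        a∉v i = apart a∈A (whole v∈R v∉T i)
        a∉D : Bipartition.a B ∉ D.set
        a∉D i = apart a∈A (proj₁ (D.⊆S (w∈R , w∉v) i))
        D∩C : Disjoint D.set C₀.set
        D∩C i j = w∉C (C₀.maximal D.isConn (D.⊆S (w∈R , w∉v)) i j D.base∈)
        T⊆C : T ⊆ C₀.set
        T⊆C = C₀.maximal target (λ i → T⊆R i , λ j → avoids (R⊆U v∈R) v∉T j i) t∈T C₀.base∈
        step-up : ∃[ x ] ∃[ y ] (x ∈ D.set × y ∉ D.set × x ⌢ y × x ∈ U ∖ cls v × y ∈ U ∖ cls v) → Peelable A R
        step-up (x , y , x∈D , y∉D , e , _ , y∈U , y∉v) =
          peel-from k x∈R (λ i → D∩C x∈D (T⊆C i)) (adj y∈A (self x) (⌢-sym e))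
            (≤-trans (card-< (R ∖ C′.set) (R ∖ C₀.set) (λ { (i , o) → i , o ∘ C⊆C′ }) (v∈R , λ i → proj₂ (C₀.⊆S t∈ i) (self v)) (λ { (_ , o) → o v∈C′ })) lt)
          where
          x∈R : x ∈ R
          x∈R = proj₁ (D.⊆S (w∈R , w∉v) x∈D)
          x∉T : x ∉ T
          x∉T i = D∩C x∈D (T⊆C i)
          x∉v : x ∉ cls v
          x∉v = proj₂ (D.⊆S (w∈R , w∉v) x∈D)
          y∈A : y ∈ A
          y∈A with cover y∈U
          ... | inj₁ i = i
          ... | inj₂ i = ⊥-elim (y∉D (D.closed x∈D (i , y∉v) e))
          v∩x : Disjoint (cls x) (cls v)
          v∩x i j = x∉v (share i j)
          x⊆D : cls x ⊆ D.set
          x⊆D = D.maximal (isConn x) (λ i → whole x∈R x∉T i , λ j → v∩x i j) (self x) x∈D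
          -- As `cls x` lies in D, removing it in place of `cls v` spares the old component around T
          -- and also `cls v`, which touches that component because R is connected. So the component
          -- grows strictly.
          module C′ = Component (C x)
          C⊆C′ : C₀.set ⊆ C′.set
          C⊆C′ = C′.maximal C₀.isConn (λ i → proj₁ (C₀.⊆S t∈ i) , λ j → D∩C (x⊆D j) i) C₀.base∈ C′.base∈
          meets : Adj C₀.set (cls v)
          meets with exit C₀.set (path R-conn (proj₁ t∈) v∈R) C₀.base∈ (λ i → proj₂ (C₀.⊆S t∈ i) (self v))
          ... | p , q , p∈ , q∉ , f , _ , q∈R with q ∈? cls v
          ...   | yes i = adj p∈ i f
          ...   | no i = ⊥-elim (q∉ (C₀.closed p∈ (q∈R , i) f))
          v∈C′ : v ∈ C′.set
          v∈C′ = C′.maximal (conn-∪ C₀.isConn (isConn v) meets)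
                  (λ { (inj₁ i) → proj₁ (C₀.⊆S t∈ i) , (λ j → D∩C (x⊆D j) i)
                     ; (inj₂ i) → whole v∈R v∉T i , (λ j → v∩x j i) })
                  (inj₁ C₀.base∈) C′.base∈ (inj₂ (self v))

      -- A walk in `U ∖ T` from A to q leaves A at a class outside T, which is the first candidate
      -- for `peel-from`.
      peel : ∀ {q} → q ∈ R → q ∉ T → Peelable A R
      peel q∈R q∉T with exit A (path without-target (A⊆U a∈A , λ i → apart a∈A (T⊆R i)) (R⊆U q∈R , q∉T)) a∈A (λ i → apart i q∈R)
      ... | x , y , x∈A , y∉A , e , _ , (y∈U , y∉T) with cover y∈U
      ...   | inj₁ i = ⊥-elim (y∉A i)
      ...   | inj₂ i = peel-from _ i y∉T (adj x∈A (self y) e) ≤-refl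

    -- A bipolar order cut at its first class inside Q, with L before that class and R after it;
    -- `L∩Q` expresses that it is the first.
    record Stop (A Q : VSet n) : Set₁ where
      field
        L R     : VSet n
        {item}  : Fin n
        item∈Q  : item ∈ Q
        A⊆L     : A ⊆ L
        T⊆R     : T ⊆ R
        L⊆U     : L ⊆ U
        R⊆U     : R ⊆ U
        L∩Q     : Disjoint L Q
        L∩R     : Disjoint L R
        item∩R  : Disjoint (cls item) R
        cover   : U ⊆ (L ∪ cls item ∪ R)
        L-conn  : Conn L
        R-conn  : Conn R
        L~item  : Adj L (cls item)
        item~R  : Adj (cls item) R

    module _ (Q : VSet n) (Q-closed : ∀ {z v} → z ∈ cls v → z ∈ Q → v ∈ Q) {q : Fin n} (q∈Q : q ∈ Q) (q∉T : q ∉ T) where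

      peel-until : ∀ k A R → Bipartition A R → Disjoint A Q → q ∈ R → card R < k → Stop A Q
      peel-until (suc k) A R B A∩Q q∈R (s≤s lt) with peel B q∈R q∉T
      ... | P with Peelable.item P ∈? Q
      ...   | yes v∈Q = record
              { L = A ; R = R ∖ cls item ; item∈Q = v∈Q ; A⊆L = id
              ; T⊆R = λ i → T⊆R i , λ j → avoids (R⊆U item∈R) item∉T j i
              ; L⊆U = A⊆U ; R⊆U = R⊆U ∘ proj₁ ; L∩Q = A∩Q
              ; L∩R = λ i j → apart i (proj₁ j) ; item∩R = λ i j → proj₂ j i
              ; cover = cov ; L-conn = A-conn ; R-conn = leaves ; L~item = touches
              ; item~R = split-adj R-conn cov′ (λ i j → proj₂ j i) (self item) item∈R
                           (T⊆R t∈T , λ j → avoids (R⊆U item∈R) item∉T j t∈T) (T⊆R t∈T) }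
        where
        open Peelable P
        open Bipartition B
        cov′ : R ⊆ (cls item ∪ (R ∖ cls item))
        cov′ {v} i with v ∈? cls item
        ... | yes j = inj₁ j
        ... | no j = inj₂ (i , j)
        cov : U ⊆ (A ∪ cls item ∪ (R ∖ cls item))
        cov i with cover i
        ... | inj₁ j = inj₁ j
        ... | inj₂ j = inj₂ (cov′ j)
      -- Q is a union of classes and the peeled one is outside it, so q remains in the suffix and
      -- `peel` applies again.
      ...   | no v∉Q = widen-L (peel-until k (A ∪ cls item) (R ∖ cls item) B′ dis (q∈R , λ i → v∉Q (Q-closed i q∈Q))
                         (≤-trans (card-< (R ∖ cls item) R proj₁ item∈R (λ i → proj₂ i (self item))) lt))
        where
        open Peelable P
        open Bipartition B
        dis : Disjoint (A ∪ cls item) Q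
        dis (inj₁ i) j = A∩Q i j
        dis (inj₂ i) j = v∉Q (Q-closed i j)
        widen-L : Stop (A ∪ cls item) Q → Stop A Q
        widen-L s = record { Stop s ; A⊆L = λ i → Stop.A⊆L s (inj₁ i) }
        cov : U ⊆ ((A ∪ cls item) ∪ (R ∖ cls item))
        cov {v} i with cover i | v ∈? cls item
        ... | inj₁ j | _ = inj₁ (inj₁ j)
        ... | inj₂ j | yes k = inj₁ (inj₂ k)
        ... | inj₂ j | no k = inj₂ (j , k)
        B′ : Bipartition (A ∪ cls item) (R ∖ cls item)
        B′ = record
          { A⊆U = λ { (inj₁ i) → A⊆U i ; (inj₂ i) → inside (R⊆U item∈R) i }
          ; R⊆U = R⊆U ∘ proj₁ ; cover = cov
          ; apart = λ { (inj₁ i) j → apart i (proj₁ j) ; (inj₂ i) j → proj₂ j i }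
          ; A-conn = conn-∪ A-conn (isConn item) touches ; R-conn = leaves
          ; T⊆R = λ i → T⊆R i , λ j → avoids (R⊆U item∈R) item∉T j i
          ; whole = λ i o j → whole (proj₁ i) o j , λ l → proj₂ i (share j l)
          ; a∈A = inj₁ a∈A }

  -- S₁ and S₂ are the only classes that may have more than one vertex.
  record BlobClasses (U T S₁ S₂ : VSet n) : Set₁ where
    field
      classes : Classes U T
    open Classes classes public
    field
      -- An equality of sets, not a pair of inclusions, so that all facts about the class at which
      -- peeling stops carry over to S₁ by `subst`.
      is-S₁ : ∀ {v} → v ∈ S₁ → cls v ≡ S₁
      is-S₂ : ∀ {v} → v ∈ S₂ → cls v ≡ S₂
      is-single : ∀ {v} → v ∉ S₁ → v ∉ S₂ → cls v ≡ ｛ v ｝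

    closed₁ : ∀ {z v} → z ∈ cls v → z ∈ S₁ → v ∈ S₁
    closed₁ {z} {v} i j = subst (v ∈_) (is-S₁ j) (share {v} {z} i (self z))

    closed₂ : ∀ {z v} → z ∈ cls v → z ∈ S₂ → v ∈ S₂
    closed₂ {z} {v} i j = subst (v ∈_) (is-S₂ j) (share {v} {z} i (self z))

  module _ {U T S₁ S₂ : VSet n}
    (c₁ : Conn S₁) (c₂ : Conn S₂) (S₁∩S₂ : Disjoint S₁ S₂) (S₁∩T : Disjoint S₁ T) (S₂∩T : Disjoint S₂ T)
    (S₁⊆U : S₁ ⊆ U) (S₂⊆U : S₂ ⊆ U)
    (U∖x : ∀ x → Conn (U ∖ ｛ x ｝)) (U∖S₁ : Conn (U ∖ S₁)) (U∖S₂ : Conn (U ∖ S₂))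
    (T-conn : Conn T) {t : Fin n} (t∈T : t ∈ T) (U∖T : Conn (U ∖ T)) where

    private
      data View (v : Fin n) : Set where
        in₁ : v ∈ S₁ → View v
        in₂ : v ∈ S₂ → View v
        single : v ∉ S₁ → v ∉ S₂ → View v
      view : ∀ v → View v
      view v with v ∈? S₁ | v ∈? S₂
      ... | yes i | _ = in₁ i
      ... | no i | yes j = in₂ j
      ... | no i | no j = single i j
      class : ∀ {v} → View v → VSet n
      class (in₁ _) = S₁
      class (in₂ _) = S₂
      class {v} (single _ _) = ｛ v ｝
      share′ : ∀ {u v z} (p : View u) (q : View v) → z ∈ class p → z ∈ class q → u ∈ class q
      share′ (in₁ x) (in₁ y) i j = x
      share′ (in₁ x) (in₂ y) i j = ⊥-elim (S₁∩S₂ i j)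
      share′ (in₁ x) (single p q) i refl = ⊥-elim (p i)
      share′ (in₂ x) (in₁ y) i j = ⊥-elim (S₁∩S₂ j i)
      share′ (in₂ x) (in₂ y) i j = x
      share′ (in₂ x) (single p q) i refl = ⊥-elim (q i)
      share′ (single p q) (in₁ y) refl j = j
      share′ (single p q) (in₂ y) refl j = j
      share′ (single p q) (single _ _) refl j = j

    blob-classes : BlobClasses U T S₁ S₂
    blob-classes = record
      { classes = classes ; is-S₁ = is₁ _ ; is-S₂ = is₂ _ ; is-single = is-one _ }
      where
      is₁ : ∀ v → v ∈ S₁ → class (view v) ≡ S₁
      is₁ v i with view v
      ... | in₁ _ = refl
      ... | in₂ j = ⊥-elim (S₁∩S₂ i j)
      ... | single o _ = ⊥-elim (o i)
      is₂ : ∀ v → v ∈ S₂ → class (view v) ≡ S₂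
      is₂ v i with view v
      ... | in₁ j = ⊥-elim (S₁∩S₂ j i)
      ... | in₂ _ = refl
      ... | single _ o = ⊥-elim (o i)
      is-one : ∀ v → v ∉ S₁ → v ∉ S₂ → class (view v) ≡ ｛ v ｝
      is-one v o o′ with view v
      ... | in₁ i = ⊥-elim (o i)
      ... | in₂ i = ⊥-elim (o′ i)
      ... | single _ _ = refl
      self : ∀ {v} (p : View v) → v ∈ class p
      self (in₁ x) = x
      self (in₂ x) = x
      self (single _ _) = refl
      isC : ∀ {v} (p : View v) → Conn (class p)
      isC (in₁ x) = c₁
      isC (in₂ x) = c₂
      isC (single _ _) = conn-｛｝ _
      ins : ∀ {v} (p : View v) → v ∈ U → class p ⊆ U
      ins (in₁ x) _ = S₁⊆U
      ins (in₂ x) _ = S₂⊆U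
      ins (single _ _) i refl = i
      av : ∀ {v} (p : View v) → v ∈ U → v ∉ T → Disjoint (class p) T
      av (in₁ x) _ _ = S₁∩T
      av (in₂ x) _ _ = S₂∩T
      av (single _ _) _ o refl i = o i
      wo : ∀ {v} (p : View v) → v ∈ U → v ∉ T → Conn (U ∖ class p)
      wo (in₁ x) _ _ = U∖S₁
      wo (in₂ x) _ _ = U∖S₂
      wo (single _ _) _ _ = U∖x _
      classes : Classes U T
      classes = record
        { cls = λ v → class (view v)
        ; self = λ v → self (view v)
        ; share = λ {u} {v} → share′ (view u) (view v)
        ; isConn = λ v → isC (view v)
        ; inside = λ {v} → ins (view v)
        ; avoids = λ {v} → av (view v)
        ; without = λ {v} → wo (view v)
        ; target = T-conn ; t∈T = t∈T ; without-target = U∖T }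

-- Retractions of a connected set onto a 2-connected block.

module Blocks {n : ℕ} (G : Graph (Fin n)) (_~?_ : ∀ u v → Dec (Graph._~_ G u v)) where
  open Connectivity G _~?_

  record TwoConn (U : VSet n) : Set where
    field
      whole : Conn U
      minus : ∀ x → Conn (U ∖ ｛ x ｝)

  fibre : VSet n → (Fin n → Fin n) → Fin n → VSet n
  fibre S π b = vset (λ v → v ∈ S × π v ≡ b) (λ v → v ∈? S ×-dec π v ≟ b)

  -- S is B with connected pieces hung on single vertices: `fibre S π b` is b with everything hung
  -- on it, and by `rigid` different fibres touch only along edges of B.
  record Retract (S B : VSet n) : Set where
    field
      B⊆S        : B ⊆ S
      π          : Fin n → Fin n
      π∈         : ∀ {v} → v ∈ S → π v ∈ B
      π-fix      : ∀ {v} → v ∈ B → π v ≡ v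
      fibre-conn : ∀ {b} → b ∈ B → Conn (fibre S π b)
      rigid      : ∀ {x y} → x ∈ S → y ∈ S → x ⌢ y → π x ≢ π y → π x ≡ x × π y ≡ y

  record Block (S Y : VSet n) : Set₁ where
    field
      set      : VSet n
      Y⊆set    : Y ⊆ set
      two-conn : TwoConn set
      retract  : Retract S set

  module _ {S Y : VSet n} (Y-conn : Conn Y) {y₀ : Fin n} (y₀∈Y : y₀ ∈ Y) where

    -- If z cuts B, the component of B ∖ z around Y together with z is a retract of B.
    private
     module Cut {B : VSet n} (B-conn : Conn B) (Y⊆B : Y ⊆ B) (core : ∀ {z} → z ∈ Y → Conn (B ∖ ｛ z ｝)) (r : Retract S B)
                {z : Fin n} (z∈B : z ∈ B) (z∉Y : z ∉ Y) where
      open Retract r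
      open Component (component (B ∖ ｛ z ｝) y₀) renaming (set to K)

      y₀∈B∖z : y₀ ∈ B ∖ ｛ z ｝
      y₀∈B∖z = Y⊆B y₀∈Y , λ { refl → z∉Y y₀∈Y }

      K⊆B : K ⊆ B
      K⊆B i = proj₁ (⊆S y₀∈B∖z i)

      z∉K : z ∉ K
      z∉K i = proj₂ (⊆S y₀∈B∖z i) refl

      Y⊆K : Y ⊆ K
      Y⊆K = maximal Y-conn (λ i → Y⊆B i , λ { refl → z∉Y i }) y₀∈Y base∈

      boundary : ∀ {x y} → x ∈ K → y ∈ B → y ∉ K → x ⌢ y → y ≡ z
      boundary {y = y} x∈ y∈ y∉ e with y ≟ z
      ... | yes p = p
      ... | no p = ⊥-elim (y∉ (closed x∈ (y∈ , p) e))

      B′ : VSet n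
      B′ = K ∪ ｛ z ｝

      B′⊆B : B′ ⊆ B
      B′⊆B (inj₁ i) = K⊆B i
      B′⊆B (inj₂ refl) = z∈B

      B′-conn : Conn B′
      B′-conn with exit K (path B-conn (Y⊆B y₀∈Y) z∈B) base∈ z∉K
      ... | x , y , x∈ , y∉ , e , _ , y∈B = conn-∪ isConn (conn-｛｝ z) (adj x∈ (boundary x∈ y∈B y∉ e) e)

      ρ : Fin n → Fin n
      ρ v with v ∈? K
      ... | yes _ = v
      ... | no _ = z

      ρ-in : ∀ {v} → v ∈ K → ρ v ≡ v
      ρ-in {v} i with v ∈? K
      ... | yes _ = refl
      ... | no k = ⊥-elim (k i)

      ρ-out : ∀ {v} → v ∉ K → ρ v ≡ z
      ρ-out {v} i with v ∈? K
      ... | yes k = ⊥-elim (i k)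
      ... | no _ = refl

      ρ∈ : ∀ v → ρ v ∈ B′
      ρ∈ v with v ∈? K
      ... | yes i = inj₁ i
      ... | no _ = inj₂ refl

      ρ-fix : ∀ {v} → v ∈ B′ → ρ v ≡ v
      ρ-fix (inj₁ i) = ρ-in i
      ρ-fix (inj₂ refl) = ρ-out z∉K

      ρ-rigid : ∀ {x y} → x ∈ B → y ∈ B → x ⌢ y → ρ x ≢ ρ y → ρ x ≡ x × ρ y ≡ y
      ρ-rigid {x} {y} x∈ y∈ e ne with x ∈? K | y ∈? K
      ... | yes i | yes j = refl , refl
      ... | yes i | no j = refl , sym (boundary i y∈ j e)
      ... | no i | yes j = sym (boundary j x∈ i (⌢-sym e)) , refl
      ... | no i | no j = ⊥-elim (ne refl)

      -- An edge whose ends have different images under ρ is fixed by ρ, so walks go to walks. The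
      -- collapsed part lands on z, which survives the deletion of z′ because z is outside Y.
      push : ∀ {z′ u v} → z′ ∈ Y → Walk G (_∈ (B ∖ ｛ z′ ｝)) u v → Walk G (_∈ (B′ ∖ ｛ z′ ｝)) (ρ u) (ρ v)
      push {z′} z′∈ w = go w
        where
        ok : ∀ u → u ≢ z′ → ρ u ∈ B′ ∖ ｛ z′ ｝
        ok u ne with u ∈? K
        ... | yes i = inj₁ i , ne
        ... | no _ = inj₂ refl , λ { refl → z∉Y z′∈ }
        go : ∀ {u v} → Walk G (_∈ (B ∖ ｛ z′ ｝)) u v → Walk G (_∈ (B′ ∖ ｛ z′ ｝)) (ρ u) (ρ v)
        go {u} (here (_ , p)) = here (ok u p)
        go {u} {v} (step {w = w} (i , p) e r) with ρ u ≟ ρ w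
        ... | yes q = subst (λ x → Walk G (_∈ (B′ ∖ ｛ z′ ｝)) x (ρ v)) (sym q) (go r)
        ... | no q with ρ-rigid i (proj₁ (start∈ r)) e q
        ...   | a , b = step (ok u p) (subst₂ _⌢_ (sym a) (sym b) e) (go r)

      core′ : ∀ {z′} → z′ ∈ Y → Conn (B′ ∖ ｛ z′ ｝)
      core′ {z′} i = conn λ { {u} {v} (u∈ , p) (v∈ , q) →
        subst₂ (Walk G (_∈ (B′ ∖ ｛ z′ ｝))) (ρ-fix u∈) (ρ-fix v∈) (push i (path (core i) (B′⊆B u∈ , p) (B′⊆B v∈ , q))) }

      -- K is closed in `B ∖ ｛ z ｝`, so a walk from outside must pass z before it enters K.
      to-z : ∀ {b y} → b ∉ K → y ∈ K → Walk G (_∈ B) b y → Walk G (_∈ (B ∖ K)) b z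
      to-z o i (here p) = ⊥-elim (o i)
      to-z {b} o i (step {w = w} p e r) with b ≟ z | w ∈? K
      ... | yes refl | _ = here (p , o)
      ... | no q | yes j = ⊥-elim (o (closed j (p , q) (⌢-sym e)))
      ... | no q | no j = step (p , o) e (to-z j i r)

      π′ : Fin n → Fin n
      π′ v = ρ (π v)

      fibre-inner : ∀ {b} → b ∈ K → Conn (fibre S π′ b)
      fibre-inner {b} i = conn-≐ (λ { (v∈ , refl) → v∈ , ρ-in i }) to (fibre-conn (K⊆B i))
        where
        to : fibre S π′ b ⊆ fibre S π b
        to {v} (v∈ , p) with π v ∈? K
        ... | yes _ = v∈ , p
        ... | no _ = ⊥-elim (z∉K (subst (_∈ K) (sym p) i))

      fibre-outer : Conn (fibre S π′ z)
      fibre-outer = star z λ { {v} (v∈ , p) → go v∈ (λ i → z∉K (subst (_∈ K) (trans (sym (ρ-in i)) p) i)) }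
        where
        go : ∀ {v} → v ∈ S → π v ∉ K → Walk G (_∈ fibre S π′ z) v z
        go {v} v∈ o = widen (λ { (x∈ , q) → x∈ , trans (cong ρ q) (ρ-out o) })
                         (path (fibre-conn (π∈ v∈)) (v∈ , refl) (B⊆S (π∈ v∈) , π-fix (π∈ v∈)))
                  ◅◅ widen (λ { (x∈ , q) → B⊆S x∈ , trans (cong ρ (π-fix x∈)) (ρ-out q) })
                         (to-z o base∈ (path B-conn (π∈ v∈) (Y⊆B y₀∈Y)))

      retract′ : Retract S B′
      retract′ = record
        { B⊆S = B⊆S ∘ B′⊆B ; π = π′ ; π∈ = λ {v} _ → ρ∈ (π v)
        ; π-fix = λ i → trans (cong ρ (π-fix (B′⊆B i))) (ρ-fix i)
        ; fibre-conn = λ { (inj₁ i) → fibre-inner i ; (inj₂ refl) → fibre-outer }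
        ; rigid = rig }
        where
        rig : ∀ {x y} → x ∈ S → y ∈ S → x ⌢ y → π′ x ≢ π′ y → π′ x ≡ x × π′ y ≡ y
        rig {x} {y} x∈ y∈ e ne with rigid x∈ y∈ e (λ q → ne (cong ρ q))
        ... | a , b with ρ-rigid (subst (_∈ B) a (π∈ x∈)) (subst (_∈ B) b (π∈ y∈)) e (λ q → ne (trans (cong ρ a) (trans q (sym (cong ρ b)))))
        ...   | c , d = trans (cong ρ a) c , trans (cong ρ b) d

    -- The invariant that no vertex of Y cuts B is kept throughout. Hence only cut vertices outside
    -- Y have to be removed, and each one shrinks B to the part around Y.
    prune : ∀ k {B} → Conn B → Y ⊆ B → (∀ {z} → z ∈ Y → Conn (B ∖ ｛ z ｝)) → Retract S B → card B < k → Block S Y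
    prune (suc k) {B} B-conn Y⊆B core r (s≤s lt)
      with any? (λ z → any? (λ w → (z ∈? B ×-dec ¬? (z ∈? Y)) ×-dec w ∈? (B ∖ ｛ z ｝) ×-dec ¬? (w ∈? Component.set (component (B ∖ ｛ z ｝) y₀))))
    ... | yes (z , w , (z∈B , z∉Y) , (w∈B , w≢z) , w∉K) =
          prune k B′-conn (λ i → inj₁ (Y⊆K i)) core′ retract′
            (≤-trans (card-< B′ B B′⊆B w∈B λ { (inj₁ i) → w∉K i ; (inj₂ i) → w≢z i }) lt)
      where open Cut B-conn Y⊆B core r z∈B z∉Y
    ... | no ¬cut = record { set = B ; Y⊆set = Y⊆B ; two-conn = record { whole = B-conn ; minus = minus } ; retract = r }
      where
      minus : ∀ x → Conn (B ∖ ｛ x ｝)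
      minus x with x ∈? Y | x ∈? B
      ... | yes i | _ = core i
      ... | no _ | no j = conn-≐ (λ i → i , λ { refl → j i }) proj₁ B-conn
      ... | no i | yes j = conn-≐ (⊆S y₀∈B∖z) all isConn
        where
        open Cut B-conn Y⊆B core r j i
        open Component (component (B ∖ ｛ x ｝) y₀) renaming (set to K′)
        all : (B ∖ ｛ x ｝) ⊆ K′
        all {w} (w∈ , ne) with w ∈? K′
        ... | yes k′ = k′
        ... | no k′ = ⊥-elim (¬cut (x , w , (j , i) , (w∈ , ne) , k′))

    block : Conn S → Y ⊆ S → (∀ {z} → z ∈ Y → Conn (S ∖ ｛ z ｝)) → Block S Y
    block c i core = prune _ c i core identity ≤-refl
      where
      identity : Retract S S
      identity = record
        { B⊆S = id ; π = id ; π∈ = id ; π-fix = λ _ → refl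
        ; fibre-conn = λ { {b} i → conn-≐ (λ { refl → i , refl }) proj₂ (conn-｛｝ b) }
        ; rigid = λ _ _ _ _ → refl , refl }

-- Series and parallel attachments of two blocks.

module Configurations {n : ℕ} (G : Graph (Fin n)) (_~?_ : ∀ u v → Dec (Graph._~_ G u v)) where
  open Connectivity G _~?_

  -- A single contact vertex lets X be united with the root set containing p of a model inside B:
  -- all other sets of the model then avoid X, see `meets-disjoint`.
  record Meets (X B : VSet n) (p : Fin n) : Set where
    constructor meets
    field
      ∈X   : p ∈ X
      ∈B   : p ∈ B
      only : ∀ {w} → w ∈ X → w ∈ B → w ≡ p

  -- r₀ ∈ X₀ — B₁ — N — B₂ — X₁ ∋ r₁, closed up by an edge between X₀ and X₁.
  record Series (U B₁ B₂ : VSet n) (r₀ r₁ : Fin n) : Set₁ where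
    field
      X₀ N X₁ : VSet n
      X₀⊆U : X₀ ⊆ U
      N⊆U  : N ⊆ U
      X₁⊆U : X₁ ⊆ U
      X₀-conn : Conn X₀
      N-conn  : Conn N
      X₁-conn : Conn X₁
      X₀∩N  : Disjoint X₀ N
      X₀∩X₁ : Disjoint X₀ X₁
      N∩X₁  : Disjoint N X₁
      X₀~X₁ : Adj X₀ X₁
      r₀∈X₀ : r₀ ∈ X₀
      r₁∈X₁ : r₁ ∈ X₁
      {u v s t} : Fin n
      X₀-B₁ : Meets X₀ B₁ u
      N-B₁  : Meets N B₁ v
      N-B₂  : Meets N B₂ s
      X₁-B₂ : Meets X₁ B₂ t
      X₀∩B₂ : Disjoint X₀ B₂
      X₁∩B₁ : Disjoint X₁ B₁

  -- B₁ and B₂ both join N to X, with r₁ ∈ X, and N is attached to Y ∋ r₀.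
  record Parallel (U B₁ B₂ : VSet n) (r₀ r₁ : Fin n) : Set₁ where
    field
      Y N X : VSet n
      Y⊆U : Y ⊆ U
      N⊆U : N ⊆ U
      X⊆U : X ⊆ U
      Y-conn : Conn Y
      N-conn : Conn N
      X-conn : Conn X
      Y∩N : Disjoint Y N
      Y∩X : Disjoint Y X
      N∩X : Disjoint N X
      N~Y : Adj N Y
      r₀∈Y : r₀ ∈ Y
      r₁∈X : r₁ ∈ X
      {p₁ q₁ p₂ q₂} : Fin n
      N-B₁ : Meets N B₁ p₁
      X-B₁ : Meets X B₁ q₁
      N-B₂ : Meets N B₂ p₂
      X-B₂ : Meets X B₂ q₂
      Y∩B₁ : Disjoint Y B₁
      Y∩B₂ : Disjoint Y B₂

  swap-parallel : ∀ {U B₁ B₂ r₀ r₁} → Parallel U B₂ B₁ r₀ r₁ → Parallel U B₁ B₂ r₀ r₁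
  swap-parallel p = record
    { Y = Y ; N = N ; X = X ; Y⊆U = Y⊆U ; N⊆U = N⊆U ; X⊆U = X⊆U ; Y-conn = Y-conn ; N-conn = N-conn ; X-conn = X-conn
    ; Y∩N = Y∩N ; Y∩X = Y∩X ; N∩X = N∩X ; N~Y = N~Y ; r₀∈Y = r₀∈Y ; r₁∈X = r₁∈X
    ; N-B₁ = N-B₂ ; X-B₁ = X-B₂ ; N-B₂ = N-B₁ ; X-B₂ = X-B₁ ; Y∩B₁ = Y∩B₂ ; Y∩B₂ = Y∩B₁ }
    where open Parallel p

  data Configuration (U B₁ B₂ : VSet n) (r₀ r₁ : Fin n) : Set₁ where
    series₁₂  : Series U B₁ B₂ r₀ r₁ → Configuration U B₁ B₂ r₀ r₁
    series₂₁  : Series U B₂ B₁ r₀ r₁ → Configuration U B₁ B₂ r₀ r₁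
    parallel₀ : Parallel U B₁ B₂ r₀ r₁ → Configuration U B₁ B₂ r₀ r₁
    parallel₁ : Parallel U B₁ B₂ r₁ r₀ → Configuration U B₁ B₂ r₀ r₁

  -- A walk trimmed to a segment that touches P₁ and P₂ only at its two ends.
  record Link (D P₁ P₂ : VSet n) : Set₁ where
    field
      W : VSet n
      W⊆D : W ⊆ D
      W-conn : Conn W
      {x₁ x₂} : Fin n
      x₁∈W : x₁ ∈ W
      x₂∈W : x₂ ∈ W
      x₁∈P₁ : x₁ ∈ P₁
      x₂∈P₂ : x₂ ∈ P₂
      only₁ : ∀ {w} → w ∈ W → w ∈ P₁ → w ≡ x₁
      only₂ : ∀ {w} → w ∈ W → w ∈ P₂ → w ≡ x₂

  module _ {D P₁ P₂ : VSet n} (dis : Disjoint P₁ P₂) where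
    private
      record Tail (u : Fin n) : Set₁ where
        field
          W : VSet n
          W⊆D : W ⊆ D
          W-conn : Conn W
          {x₂} : Fin n
          u∈W : u ∈ W
          x₂∈W : x₂ ∈ W
          x₂∈P₂ : x₂ ∈ P₂
          avoid₁ : Disjoint W P₁
          only₂ : ∀ {w} → w ∈ W → w ∈ P₂ → w ≡ x₂

      stop : ∀ {u} → u ∈ D → u ∈ P₂ → Tail u
      stop {u} u∈D u∈ = record { W = ｛ u ｝ ; W⊆D = λ { refl → u∈D } ; W-conn = conn-｛｝ u ; u∈W = refl ; x₂∈W = refl
        ; x₂∈P₂ = u∈ ; avoid₁ = λ { refl j → dis j u∈ } ; only₂ = λ { refl _ → refl } }

      -- The walk is processed from its far end: each visit to P₂ restarts the segment, and the
      -- first visit to P₁ met in this way completes it.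
      go : ∀ {u v} → Walk G (_∈ D) u v → v ∈ P₂ → Link D P₁ P₂ ⊎ Tail u
      go (here u∈D) v∈ = inj₂ (stop u∈D v∈)
      go {u} (step u∈D e r) v∈ with go r v∈
      ... | inj₁ l = inj₁ l
      ... | inj₂ T with u ∈? P₂ | u ∈? P₁
      ...   | yes i | _ = inj₂ (stop u∈D i)
      ...   | no o | yes i = inj₁ (record
                { W = ｛ u ｝ ∪ W ; W⊆D = λ { (inj₁ refl) → u∈D ; (inj₂ j) → W⊆D j }
                ; W-conn = conn-∪ (conn-｛｝ u) W-conn (adj refl u∈W e)
                ; x₁∈W = inj₁ refl ; x₂∈W = inj₂ x₂∈W ; x₁∈P₁ = i ; x₂∈P₂ = x₂∈P₂
                ; only₁ = λ { (inj₁ refl) _ → refl ; (inj₂ j) k → ⊥-elim (avoid₁ j k) }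
                ; only₂ = λ { (inj₁ refl) k → ⊥-elim (o k) ; (inj₂ j) k → only₂ j k } })
        where open Tail T
      ...   | no o | no o′ = inj₂ (record
                { W = ｛ u ｝ ∪ W ; W⊆D = λ { (inj₁ refl) → u∈D ; (inj₂ j) → W⊆D j }
                ; W-conn = conn-∪ (conn-｛｝ u) W-conn (adj refl u∈W e)
                ; u∈W = inj₁ refl ; x₂∈W = inj₂ x₂∈W ; x₂∈P₂ = x₂∈P₂
                ; avoid₁ = λ { (inj₁ refl) k → o′ k ; (inj₂ j) k → avoid₁ j k }
                ; only₂ = λ { (inj₁ refl) k → ⊥-elim (o k) ; (inj₂ j) k → only₂ j k } })
        where open Tail T

    link : ∀ {u v} → Walk G (_∈ D) u v → u ∈ P₁ → v ∈ P₂ → Link D P₁ P₂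
    link w u∈ v∈ with go w v∈
    ... | inj₁ l = l
    ... | inj₂ T = ⊥-elim (Tail.avoid₁ T (Tail.u∈W T) u∈)

  swap-link : ∀ {D P₁ P₂} → Link D P₁ P₂ → Link D P₂ P₁
  swap-link l = record { W = W ; W⊆D = W⊆D ; W-conn = W-conn ; x₁∈W = x₂∈W ; x₂∈W = x₁∈W ; x₁∈P₁ = x₂∈P₂ ; x₂∈P₂ = x₁∈P₁ ; only₁ = only₂ ; only₂ = only₁ }
    where open Link l

  -- Both B₁ and B₂ join C₀ ⊇ A₀ to C₁ ⊇ A₁; the components of their attachments in
  -- C₀ ∖ A₀ and C₁ ∖ A₁ decide between the configurations.
  record Balanced (U D A₀ A₁ B₁ B₂ C₀ C₁ : VSet n) (r₀ r₁ p₁ p₂ q₁ q₂ : Fin n) : Set where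
    field
      cover : U ⊆ (A₀ ∪ A₁ ∪ D)
      D-conn : Conn D
      D⊆U : D ⊆ U
      B₁⊆D : B₁ ⊆ D
      B₂⊆D : B₂ ⊆ D
      B₁∩B₂ : Disjoint B₁ B₂
      A₀⊆C₀ : A₀ ⊆ C₀
      A₁⊆C₁ : A₁ ⊆ C₁
      C₀⊆U : C₀ ⊆ U
      C₁⊆U : C₁ ⊆ U
      C₀-conn : Conn C₀
      C₁-conn : Conn C₁
      A₀-conn : Conn A₀
      A₁-conn : Conn A₁
      A₀∩D : Disjoint A₀ D
      A₁∩D : Disjoint A₁ D
      C₀∩C₁ : Disjoint C₀ C₁
      A₀~A₁ : Adj A₀ A₁
      r₀∈A₀ : r₀ ∈ A₀
      r₁∈A₁ : r₁ ∈ A₁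
      C₀-B₁ : Meets C₀ B₁ p₁
      C₀-B₂ : Meets C₀ B₂ p₂
      C₁-B₁ : Meets C₁ B₁ q₁
      C₁-B₂ : Meets C₁ B₂ q₂

  swap-blocks : ∀ {U D A₀ A₁ B₁ B₂ C₀ C₁ r₀ r₁ p₁ p₂ q₁ q₂} →
    Balanced U D A₀ A₁ B₁ B₂ C₀ C₁ r₀ r₁ p₁ p₂ q₁ q₂ → Balanced U D A₀ A₁ B₂ B₁ C₀ C₁ r₀ r₁ p₂ p₁ q₂ q₁
  swap-blocks b = record { Balanced b ; B₁⊆D = B₂⊆D ; B₂⊆D = B₁⊆D ; B₁∩B₂ = λ i j → B₁∩B₂ j i
    ; C₀-B₁ = C₀-B₂ ; C₀-B₂ = C₀-B₁ ; C₁-B₁ = C₁-B₂ ; C₁-B₂ = C₁-B₁ }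
    where open Balanced b

  swap-ends : ∀ {U D A₀ A₁ B₁ B₂ C₀ C₁ r₀ r₁ p₁ p₂ q₁ q₂} →
    Balanced U D A₀ A₁ B₁ B₂ C₀ C₁ r₀ r₁ p₁ p₂ q₁ q₂ → Balanced U D A₁ A₀ B₁ B₂ C₁ C₀ r₁ r₀ q₁ q₂ p₁ p₂
  swap-ends b = record
    { cover = λ i → turn (cover i)
    ; D-conn = D-conn ; D⊆U = D⊆U ; B₁⊆D = B₁⊆D ; B₂⊆D = B₂⊆D ; B₁∩B₂ = B₁∩B₂
    ; A₀⊆C₀ = A₁⊆C₁ ; A₁⊆C₁ = A₀⊆C₀ ; C₀⊆U = C₁⊆U ; C₁⊆U = C₀⊆U ; C₀-conn = C₁-conn ; C₁-conn = C₀-conn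
    ; A₀-conn = A₁-conn ; A₁-conn = A₀-conn ; A₀∩D = A₁∩D ; A₁∩D = A₀∩D ; C₀∩C₁ = λ i j → C₀∩C₁ j i
    ; A₀~A₁ = adj-sym A₀~A₁ ; r₀∈A₀ = r₁∈A₁ ; r₁∈A₁ = r₀∈A₀
    ; C₀-B₁ = C₁-B₁ ; C₀-B₂ = C₁-B₂ ; C₁-B₁ = C₀-B₁ ; C₁-B₂ = C₀-B₂ }
    where
    open Balanced b
    turn : ∀ {P Q R : Set} → P ⊎ Q ⊎ R → Q ⊎ P ⊎ R
    turn (inj₁ i) = inj₂ (inj₁ i)
    turn (inj₂ (inj₁ i)) = inj₁ i
    turn (inj₂ (inj₂ i)) = inj₂ (inj₂ i)

  branch : VSet n → VSet n → Fin n → VSet n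
  branch C A p = Component.set (component (C ∖ A) p)

  module BalancedFacts {U D A₀ A₁ B₁ B₂ C₀ C₁ : VSet n} {r₀ r₁ p₁ p₂ q₁ q₂ : Fin n}
                (b : Balanced U D A₀ A₁ B₁ B₂ C₀ C₁ r₀ r₁ p₁ p₂ q₁ q₂) where
    open Balanced b

    p₁∈C₀∖A₀ : p₁ ∈ C₀ ∖ A₀
    p₁∈C₀∖A₀ = Meets.∈X C₀-B₁ , λ i → A₀∩D i (B₁⊆D (Meets.∈B C₀-B₁))

    K₁ : VSet n
    K₁ = branch C₀ A₀ p₁

    open Component (component (C₀ ∖ A₀) p₁) public using () renaming (isConn to K₁-conn; base∈ to p₁∈K₁)

    private
      module K = Component (component (C₀ ∖ A₀) p₁)

    K₁⊆C₀ : K₁ ⊆ C₀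
    K₁⊆C₀ i = proj₁ (K.⊆S p₁∈C₀∖A₀ i)

    K₁⊆D : K₁ ⊆ D
    K₁⊆D i with cover (C₀⊆U (K₁⊆C₀ i))
    ... | inj₁ j = ⊥-elim (proj₂ (K.⊆S p₁∈C₀∖A₀ i) j)
    ... | inj₂ (inj₁ j) = ⊥-elim (C₀∩C₁ (K₁⊆C₀ i) (A₁⊆C₁ j))
    ... | inj₂ (inj₂ j) = j

    A₀~K₁ : Adj A₀ K₁
    A₀~K₁ with exit K₁ (path C₀-conn (proj₁ p₁∈C₀∖A₀) (A₀⊆C₀ r₀∈A₀)) K.base∈ (λ i → proj₂ (K.⊆S p₁∈C₀∖A₀ i) r₀∈A₀)
    ... | x , y , x∈ , y∉ , e , _ , y∈ with y ∈? A₀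
    ...   | yes i = adj i x∈ (⌢-sym e)
    ...   | no i = ⊥-elim (y∉ (K.closed x∈ (y∈ , i) e))

    K₁-B₁ : Meets K₁ B₁ p₁
    K₁-B₁ = meets p₁∈K₁ (Meets.∈B C₀-B₁) (λ i → Meets.only C₀-B₁ (K₁⊆C₀ i))

    K₁∩B₂ : p₂ ∉ K₁ → Disjoint K₁ B₂
    K₁∩B₂ o i j = o (subst (_∈ K₁) (Meets.only C₀-B₂ (K₁⊆C₀ i) j) i)

    K₁∩K₂ : p₂ ∉ K₁ → Disjoint K₁ (branch C₀ A₀ p₂)
    K₁∩K₂ o i j = o (K.maximal L.isConn (λ k → L.⊆S (Meets.∈X C₀-B₂ , λ l → A₀∩D l (B₂⊆D (Meets.∈B C₀-B₂))) k) j i L.base∈)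
      where module L = Component (component (C₀ ∖ A₀) p₂)

  module _ {U D A₀ A₁ B₁ B₂ C₀ C₁ : VSet n} {r₀ r₁ p₁ p₂ q₁ q₂ : Fin n}
           (b : Balanced U D A₀ A₁ B₁ B₂ C₀ C₁ r₀ r₁ p₁ p₂ q₁ q₂) where
    open Balanced b
    private
      module K = BalancedFacts b
      module K′ = BalancedFacts (swap-blocks b)
      module E = BalancedFacts (swap-ends b)
      module E′ = BalancedFacts (swap-blocks (swap-ends b))

    -- P₁ and P₂ are two strands inside D leading from A₀ to A₁, one through each block. The K parts
    -- are the attachments on the side of A₀, the E parts those on the side of A₁.
    K₁ K₂ E₁ E₂ P₁ P₂ : VSet n
    K₁ = branch C₀ A₀ p₁
    K₂ = branch C₀ A₀ p₂
    E₁ = branch C₁ A₁ q₁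
    E₂ = branch C₁ A₁ q₂
    P₁ = K₁ ∪ B₁ ∪ E₁
    P₂ = K₂ ∪ B₂ ∪ E₂

    -- If one component on the side of A₀ serves both blocks, it can be the set N, while all of C₁
    -- joins the other contacts to r₁.
    parallel-meet : p₂ ∈ K₁ → Parallel U B₁ B₂ r₀ r₁
    parallel-meet i = record
      { Y = A₀ ; N = K₁ ; X = C₁ ; Y⊆U = C₀⊆U ∘ A₀⊆C₀ ; N⊆U = C₀⊆U ∘ K.K₁⊆C₀ ; X⊆U = C₁⊆U
      ; Y-conn = A₀-conn ; N-conn = K.K₁-conn ; X-conn = C₁-conn
      ; Y∩N = λ i j → A₀∩D i (K.K₁⊆D j) ; Y∩X = C₀∩C₁ ∘ A₀⊆C₀ ; N∩X = C₀∩C₁ ∘ K.K₁⊆C₀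
      ; N~Y = adj-sym K.A₀~K₁ ; r₀∈Y = r₀∈A₀ ; r₁∈X = A₁⊆C₁ r₁∈A₁
      ; N-B₁ = K.K₁-B₁ ; X-B₁ = C₁-B₁
      ; N-B₂ = meets i (Meets.∈B C₀-B₂) (λ i → Meets.only C₀-B₂ (K.K₁⊆C₀ i)) ; X-B₂ = C₁-B₂
      ; Y∩B₁ = λ i j → A₀∩D i (B₁⊆D j) ; Y∩B₂ = λ i j → A₀∩D i (B₂⊆D j) }

    record Separate : Set where
      field
        p₂∉K₁ : p₂ ∉ K₁
        p₁∉K₂ : p₁ ∉ K₂
        q₂∉E₁ : q₂ ∉ E₁
        q₁∉E₂ : q₁ ∉ E₂

    module _ (s : Separate) where
      open Separate s

      P₁⊆D : P₁ ⊆ D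
      P₁⊆D (inj₁ i) = K.K₁⊆D i
      P₁⊆D (inj₂ (inj₁ i)) = B₁⊆D i
      P₁⊆D (inj₂ (inj₂ i)) = E.K₁⊆D i

      P₁∩P₂ : Disjoint P₁ P₂
      P₁∩P₂ (inj₁ i) (inj₁ j) = K.K₁∩K₂ p₂∉K₁ i j
      P₁∩P₂ (inj₁ i) (inj₂ (inj₁ j)) = K.K₁∩B₂ p₂∉K₁ i j
      P₁∩P₂ (inj₁ i) (inj₂ (inj₂ j)) = C₀∩C₁ (K.K₁⊆C₀ i) (E′.K₁⊆C₀ j)
      P₁∩P₂ (inj₂ (inj₁ i)) (inj₁ j) = K′.K₁∩B₂ p₁∉K₂ j i
      P₁∩P₂ (inj₂ (inj₁ i)) (inj₂ (inj₁ j)) = B₁∩B₂ i j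
      P₁∩P₂ (inj₂ (inj₁ i)) (inj₂ (inj₂ j)) = E′.K₁∩B₂ q₁∉E₂ j i
      P₁∩P₂ (inj₂ (inj₂ i)) (inj₁ j) = C₀∩C₁ (K′.K₁⊆C₀ j) (E.K₁⊆C₀ i)
      P₁∩P₂ (inj₂ (inj₂ i)) (inj₂ (inj₁ j)) = E.K₁∩B₂ q₂∉E₁ i j
      P₁∩P₂ (inj₂ (inj₂ i)) (inj₂ (inj₂ j)) = E.K₁∩K₂ q₂∉E₁ i j

      -- How an arrival x on the first strand, outside K₁, reaches B₁ at a single vertex without
      -- touching K₁: by x itself if x is in B₁, otherwise through E₁.
      record Nub (x : Fin n) : Set₁ where
        field
          set : VSet n
          set-conn : Conn set
          x∈ : x ∈ set
          ⊆P : set ⊆ P₁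
          ∩K : Disjoint set K₁
          {v} : Fin n
          at : Meets set B₁ v

      nub : ∀ {x} → x ∈ P₁ → x ∉ K₁ → Nub x
      nub (inj₁ i) o = ⊥-elim (o i)
      nub {x} (inj₂ (inj₁ i)) o = record { set = ｛ x ｝ ; set-conn = conn-｛｝ x ; x∈ = refl
        ; ⊆P = λ { refl → inj₂ (inj₁ i) } ; ∩K = λ { refl → o } ; at = meets refl i (λ { refl _ → refl }) }
      nub (inj₂ (inj₂ i)) o = record { set = E₁ ; set-conn = E.K₁-conn ; x∈ = i ; ⊆P = λ j → inj₂ (inj₂ j)
        ; ∩K = λ j k → C₀∩C₁ (K.K₁⊆C₀ k) (E.K₁⊆C₀ j) ; at = E.K₁-B₁ }

  module _ {U D A₀ A₁ B₁ B₂ C₀ C₁ : VSet n} {r₀ r₁ p₁ p₂ q₁ q₂ : Fin n}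
           (b : Balanced U D A₀ A₁ B₁ B₂ C₀ C₁ r₀ r₁ p₁ p₂ q₁ q₂) (s : Separate b) where
    open Balanced b
    open Separate s
    private
      module K = BalancedFacts b
      module K′ = BalancedFacts (swap-blocks b)
      module E = BalancedFacts (swap-ends b)
      module E′ = BalancedFacts (swap-blocks (swap-ends b))

    flip-separate : Separate (swap-ends (swap-blocks b))
    flip-separate = record { p₂∉K₁ = q₁∉E₂ ; p₁∉K₂ = q₂∉E₁ ; q₂∉E₁ = p₁∉K₂ ; q₁∉E₂ = p₂∉K₁ }

    swap-separate : Separate (swap-blocks b)
    swap-separate = record { p₂∉K₁ = p₁∉K₂ ; p₁∉K₂ = p₂∉K₁ ; q₂∉E₁ = q₁∉E₂ ; q₁∉E₂ = q₂∉E₁ }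

    private
      turn : ∀ {P Q R : Set} → P ⊎ Q ⊎ R → R ⊎ Q ⊎ P
      turn (inj₁ i) = inj₂ (inj₂ i)
      turn (inj₂ (inj₁ i)) = inj₂ (inj₁ i)
      turn (inj₂ (inj₂ i)) = inj₁ i

    -- The link crosses over between the strands, giving the order A₀, K₁, B₁, link, B₂, E₂, A₁. For
    -- this it has to leave the first strand beyond K₁ and enter the second one before E₂; the nubs
    -- carry its ends to the blocks.
    series-link : (l : Link D (P₁ b) (P₂ b)) → Link.x₁ l ∉ K₁ b → Link.x₂ l ∉ E₂ b → Series U B₁ B₂ r₀ r₁
    series-link l o₁ o₂ = record
      { X₀ = A₀ ∪ K₁ b ; N = N₁.set ∪ W ∪ N₂.set ; X₁ = A₁ ∪ E₂ b
      ; X₀⊆U = λ { (inj₁ i) → C₀⊆U (A₀⊆C₀ i) ; (inj₂ i) → D⊆U (K.K₁⊆D i) }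
      ; N⊆U = D⊆U ∘ N⊆D
      ; X₁⊆U = λ { (inj₁ i) → C₁⊆U (A₁⊆C₁ i) ; (inj₂ i) → D⊆U (E′.K₁⊆D i) }
      ; X₀-conn = conn-∪ A₀-conn K.K₁-conn K.A₀~K₁
      ; N-conn = conn-∪-meet N₁.set-conn (conn-∪-meet W-conn N₂.set-conn x₂∈W N₂.x∈) N₁.x∈ (inj₁ x₁∈W)
      ; X₁-conn = conn-∪ A₁-conn E′.K₁-conn E′.A₀~K₁
      ; X₀∩N = λ { (inj₁ i) j → A₀∩D i (N⊆D j)
                 ; (inj₂ i) (inj₁ j) → N₁.∩K j i
                 ; (inj₂ i) (inj₂ (inj₁ j)) → o₁ (subst (_∈ K₁ b) (only₁ j (inj₁ i)) i)
                 ; (inj₂ i) (inj₂ (inj₂ j)) → P₁∩P₂ b s (inj₁ i) (N₂⊆P₂ j) }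
      ; X₀∩X₁ = λ i j → C₀∩C₁ (X₀⊆ i) (X₁⊆ j)
      ; N∩X₁ = λ { i (inj₁ j) → A₁∩D j (N⊆D i)
                 ; (inj₁ i) (inj₂ j) → P₁∩P₂ b s (N₁.⊆P i) (inj₂ (inj₂ j))
                 ; (inj₂ (inj₁ i)) (inj₂ j) → o₂ (subst (_∈ E₂ b) (only₂ i (inj₂ (inj₂ j))) j)
                 ; (inj₂ (inj₂ i)) (inj₂ j) → N₂.∩K i j }
      ; X₀~X₁ = adj-mono inj₁ inj₁ A₀~A₁ ; r₀∈X₀ = inj₁ r₀∈A₀ ; r₁∈X₁ = inj₁ r₁∈A₁
      ; X₀-B₁ = meets (inj₂ K.p₁∈K₁) (Meets.∈B C₀-B₁) (λ i → Meets.only C₀-B₁ (X₀⊆ i))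
      ; N-B₁ = meets (inj₁ (Meets.∈X N₁.at)) (Meets.∈B N₁.at)
          λ { (inj₁ i) j → Meets.only N₁.at i j
            ; (inj₂ (inj₁ i)) j → trans (only₁ i (inj₂ (inj₁ j))) (Meets.only N₁.at N₁.x∈ (subst (_∈ B₁) (only₁ i (inj₂ (inj₁ j))) j))
            ; (inj₂ (inj₂ i)) j → ⊥-elim (P₁∩P₂ b s (inj₂ (inj₁ j)) (N₂⊆P₂ i)) }
      ; N-B₂ = meets (inj₂ (inj₂ (Meets.∈X N₂.at))) (Meets.∈B N₂.at)
          λ { (inj₁ i) j → ⊥-elim (P₁∩P₂ b s (N₁.⊆P i) (inj₂ (inj₁ j)))
            ; (inj₂ (inj₁ i)) j → trans (only₂ i (inj₂ (inj₁ j))) (Meets.only N₂.at N₂.x∈ (subst (_∈ B₂) (only₂ i (inj₂ (inj₁ j))) j))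
            ; (inj₂ (inj₂ i)) j → Meets.only N₂.at i j }
      ; X₁-B₂ = meets (inj₂ E′.p₁∈K₁) (Meets.∈B C₁-B₂) (λ i → Meets.only C₁-B₂ (X₁⊆ i))
      ; X₀∩B₂ = λ { (inj₁ i) j → A₀∩D i (B₂⊆D j) ; (inj₂ i) j → K.K₁∩B₂ p₂∉K₁ i j }
      ; X₁∩B₁ = λ { (inj₁ i) j → A₁∩D i (B₁⊆D j) ; (inj₂ i) j → E′.K₁∩B₂ q₁∉E₂ i j } }
      where
      open Link l
      module N₁ = Nub (nub b s x₁∈P₁ o₁)
      module N₂ = Nub (nub (swap-ends (swap-blocks b)) flip-separate (turn x₂∈P₂) o₂)
      N₂⊆P₂ : N₂.set ⊆ P₂ b
      N₂⊆P₂ i = turn (N₂.⊆P i)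
      N⊆D : (N₁.set ∪ W ∪ N₂.set) ⊆ D
      N⊆D (inj₁ i) = P₁⊆D b s (N₁.⊆P i)
      N⊆D (inj₂ (inj₁ i)) = W⊆D i
      N⊆D (inj₂ (inj₂ i)) = P₁⊆D (swap-ends (swap-blocks b)) flip-separate (N₂.⊆P i)
      X₀⊆ : (A₀ ∪ K₁ b) ⊆ C₀
      X₀⊆ (inj₁ i) = A₀⊆C₀ i
      X₀⊆ (inj₂ i) = K.K₁⊆C₀ i
      X₁⊆ : (A₁ ∪ E₂ b) ⊆ C₁
      X₁⊆ (inj₁ i) = A₁⊆C₁ i
      X₁⊆ (inj₂ i) = E′.K₁⊆C₀ i

    -- The link fuses K₁ and K₂ into one connected set N. It meets the strands only at its ends,
    -- which lie in K₁ and K₂, so it avoids E₁ and E₂.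
    parallel-link : (l : Link D (P₁ b) (P₂ b)) → Link.x₁ l ∈ K₁ b → Link.x₂ l ∈ K₂ b → Parallel U B₁ B₂ r₀ r₁
    parallel-link l i₁ i₂ = record
      { Y = A₀ ; N = K₁ b ∪ W ∪ K₂ b ; X = (A₁ ∪ E₁ b) ∪ E₂ b
      ; Y⊆U = C₀⊆U ∘ A₀⊆C₀ ; N⊆U = D⊆U ∘ N⊆D ; X⊆U = C₁⊆U ∘ X⊆C₁
      ; Y-conn = A₀-conn
      ; N-conn = conn-∪-meet K.K₁-conn (conn-∪-meet W-conn K′.K₁-conn x₂∈W i₂) i₁ (inj₁ x₁∈W)
      ; X-conn = conn-∪ (conn-∪ A₁-conn E.K₁-conn E.A₀~K₁) E′.K₁-conn (adj-mono inj₁ id E′.A₀~K₁)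
      ; Y∩N = λ i j → A₀∩D i (N⊆D j)
      ; Y∩X = λ i j → C₀∩C₁ (A₀⊆C₀ i) (X⊆C₁ j)
      ; N∩X = N∩X
      ; N~Y = adj-mono inj₁ id (adj-sym K.A₀~K₁)
      ; r₀∈Y = r₀∈A₀ ; r₁∈X = inj₁ (inj₁ r₁∈A₁)
      ; N-B₁ = meets (inj₁ K.p₁∈K₁) (Meets.∈B C₀-B₁)
          λ { (inj₁ i) j → Meets.only K.K₁-B₁ i j
            ; (inj₂ (inj₁ i)) j → trans (only₁ i (inj₂ (inj₁ j))) (Meets.only K.K₁-B₁ i₁ (subst (_∈ B₁) (only₁ i (inj₂ (inj₁ j))) j))
            ; (inj₂ (inj₂ i)) j → ⊥-elim (K′.K₁∩B₂ p₁∉K₂ i j) }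
      ; X-B₁ = meets (inj₁ (inj₂ E.p₁∈K₁)) (Meets.∈B C₁-B₁) (λ i → Meets.only C₁-B₁ (X⊆C₁ i))
      ; N-B₂ = meets (inj₂ (inj₂ K′.p₁∈K₁)) (Meets.∈B C₀-B₂)
          λ { (inj₁ i) j → ⊥-elim (K.K₁∩B₂ p₂∉K₁ i j)
            ; (inj₂ (inj₁ i)) j → trans (only₂ i (inj₂ (inj₁ j))) (Meets.only K′.K₁-B₁ i₂ (subst (_∈ B₂) (only₂ i (inj₂ (inj₁ j))) j))
            ; (inj₂ (inj₂ i)) j → Meets.only K′.K₁-B₁ i j }
      ; X-B₂ = meets (inj₂ E′.p₁∈K₁) (Meets.∈B C₁-B₂) (λ i → Meets.only C₁-B₂ (X⊆C₁ i))
      ; Y∩B₁ = λ i j → A₀∩D i (B₁⊆D j) ; Y∩B₂ = λ i j → A₀∩D i (B₂⊆D j) }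
      where
      open Link l
      N⊆D : (K₁ b ∪ W ∪ K₂ b) ⊆ D
      N⊆D (inj₁ i) = K.K₁⊆D i
      N⊆D (inj₂ (inj₁ i)) = W⊆D i
      N⊆D (inj₂ (inj₂ i)) = K′.K₁⊆D i
      X⊆C₁ : ((A₁ ∪ E₁ b) ∪ E₂ b) ⊆ C₁
      X⊆C₁ (inj₁ (inj₁ i)) = A₁⊆C₁ i
      X⊆C₁ (inj₁ (inj₂ i)) = E.K₁⊆C₀ i
      X⊆C₁ (inj₂ i) = E′.K₁⊆C₀ i
      N∩X : Disjoint (K₁ b ∪ W ∪ K₂ b) ((A₁ ∪ E₁ b) ∪ E₂ b)
      N∩X (inj₁ i) j = C₀∩C₁ (K.K₁⊆C₀ i) (X⊆C₁ j)
      N∩X (inj₂ (inj₂ i)) j = C₀∩C₁ (K′.K₁⊆C₀ i) (X⊆C₁ j)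
      N∩X (inj₂ (inj₁ i)) (inj₁ (inj₁ j)) = A₁∩D j (W⊆D i)
      N∩X (inj₂ (inj₁ i)) (inj₁ (inj₂ j)) = C₀∩C₁ (K.K₁⊆C₀ i₁) (E.K₁⊆C₀ (subst (_∈ E₁ b) (only₁ i (inj₂ (inj₂ j))) j))
      N∩X (inj₂ (inj₁ i)) (inj₂ j) = C₀∩C₁ (K′.K₁⊆C₀ i₂) (E′.K₁⊆C₀ (subst (_∈ E₂ b) (only₂ i (inj₂ (inj₂ j))) j))

  module _ {U D A₀ A₁ B₁ B₂ C₀ C₁ : VSet n} {r₀ r₁ p₁ p₂ q₁ q₂ : Fin n}
           (b : Balanced U D A₀ A₁ B₁ B₂ C₀ C₁ r₀ r₁ p₁ p₂ q₁ q₂) where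
    open Balanced b

    private
      turn-link : Link D (P₁ b) (P₂ b) → Link D (P₁ (swap-ends b)) (P₂ (swap-ends b))
      turn-link l = record { W = W ; W⊆D = W⊆D ; W-conn = W-conn ; x₁∈W = x₁∈W ; x₂∈W = x₂∈W
        ; x₁∈P₁ = turn x₁∈P₁ ; x₂∈P₂ = turn x₂∈P₂
        ; only₁ = λ i j → only₁ i (turn j) ; only₂ = λ i j → only₂ i (turn j) }
        where
        open Link l
        turn : ∀ {P Q R : Set} → P ⊎ Q ⊎ R → R ⊎ Q ⊎ P
        turn (inj₁ i) = inj₂ (inj₂ i)
        turn (inj₂ (inj₁ i)) = inj₂ (inj₁ i)
        turn (inj₂ (inj₂ i)) = inj₁ i

    balanced-configuration : Configuration U B₁ B₂ r₀ r₁
    balanced-configuration with p₂ ∈? K₁ b | q₂ ∈? E₁ b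
    ... | yes i | _ = parallel₀ (parallel-meet b i)
    ... | no _ | yes i = parallel₁ (parallel-meet (swap-ends b) i)
    ... | no p₂∉K₁ | no q₂∉E₁ = decide (link (P₁∩P₂ b s) (path D-conn (K.K₁⊆D K.p₁∈K₁) (K′.K₁⊆D K′.p₁∈K₁)) (inj₁ K.p₁∈K₁) (inj₁ K′.p₁∈K₁))
      where
      module K = BalancedFacts b
      module K′ = BalancedFacts (swap-blocks b)
      module E = BalancedFacts (swap-ends b)
      s : Separate b
      s = record { p₂∉K₁ = p₂∉K₁ ; p₁∉K₂ = K.K₁∩K₂ p₂∉K₁ K.p₁∈K₁ ; q₂∉E₁ = q₂∉E₁ ; q₁∉E₂ = E.K₁∩K₂ q₂∉E₁ E.p₁∈K₁ }
      s-ends : Separate (swap-ends b)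
      s-ends = record { p₂∉K₁ = q₂∉E₁ ; p₁∉K₂ = Separate.q₁∉E₂ s ; q₂∉E₁ = p₂∉K₁ ; q₁∉E₂ = Separate.p₁∉K₂ s }
      -- Each end of the link lies in the K, B or E part of its strand. Both in K gives a parallel
      -- pair, both in E the reversed one, and any other combination a series in one of the two
      -- orders. The last two clauses would put an end on both sides.
      decide : Link D (P₁ b) (P₂ b) → Configuration U B₁ B₂ r₀ r₁
      decide l with Link.x₁ l ∈? K₁ b | Link.x₂ l ∈? K₂ b | Link.x₁ l ∈? E₁ b | Link.x₂ l ∈? E₂ b
      ... | yes i | yes j | _ | _ = parallel₀ (parallel-link b s l i j)
      ... | no i | _ | _ | no j = series₁₂ (series-link b s l i j)
      ... | no _ | _ | yes i | yes j = parallel₁ (parallel-link (swap-ends b) s-ends (turn-link l) i j)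
      ... | _ | no j | no i | _ = series₂₁ (series-link (swap-blocks b) (swap-separate b s) (swap-link l) j i)
      ... | yes i | no _ | yes j | _ = ⊥-elim (C₀∩C₁ (K.K₁⊆C₀ i) (E.K₁⊆C₀ j))
      ... | no _ | yes j | no _ | yes k = ⊥-elim (C₀∩C₁ (K′.K₁⊆C₀ j) (BalancedFacts.K₁⊆C₀ (swap-blocks (swap-ends b)) k))

-- From a bipolar order to the attachment of the two blocks.

module Frames {n : ℕ} (G : Graph (Fin n)) (_~?_ : ∀ u v → Dec (Graph._~_ G u v)) where
  open Connectivity G _~?_
  open Peeling G _~?_
  open Blocks G _~?_
  open Configurations G _~?_

  record Ports {S B : VSet n} (r : Retract S B) (P Q : VSet n) : Set where
    open Retract r
    field
      {p q} : Fin n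
      p∈B   : p ∈ B
      q∈B   : q ∈ B
      p≢q   : p ≢ q
      p-exit : Adj P (fibre S π p)
      q-exit : Adj (fibre S π q) Q

  -- Leaving S through two different fibres: otherwise the single exit fibre would contain a cut vertex.
  module _ (U : VSet n) {S B P Q : VSet n} (r : Retract S B) (U∖x : ∀ x → Conn (U ∖ ｛ x ｝)) (S⊆U : S ⊆ U) (P⊆U : P ⊆ U)
           (cover : U ⊆ (P ∪ S ∪ Q)) (P∩S : Disjoint P S)
           (other : ∀ p → ∃[ b ] (b ∈ B × b ≢ p)) where
    open Retract r

    ports : Adj P S → Adj S Q → Ports r P Q
    ports (adj {a} {s} a∈ s∈ e) (adj {s′} {c} s′∈ c∈ e′) with π s ≟ π s′
    ... | no ne = record { p∈B = π∈ s∈ ; q∈B = π∈ s′∈ ; p≢q = ne ; p-exit = adj a∈ (s∈ , refl) e ; q-exit = adj (s′∈ , refl) c∈ e′ }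
    ... | yes eq with other (π s)
    ...   | b , b∈ , b≢ with exit F (path (U∖x (π s)) (S⊆U (B⊆S b∈) , b≢) (P⊆U a∈ , λ { refl → P∩S a∈ (B⊆S (π∈ s∈)) }))
                                  (B⊆S b∈ , λ { (_ , i) → b≢ (trans (sym (π-fix b∈)) i) }) (λ i → P∩S a∈ (proj₁ i))
      where
      F : VSet n
      F = S ∖ fibre S π (π s)
    ...     | x , y , (x∈S , x∉) , y∉F , f , _ , (y∈U , y≢) with cover y∈U
    ...       | inj₁ i = record { p∈B = π∈ x∈S ; q∈B = π∈ s∈ ; p≢q = λ i → x∉ (x∈S , i)
                      ; p-exit = adj i (x∈S , refl) (⌢-sym f) ; q-exit = adj (s′∈ , sym eq) c∈ e′ }
    ...       | inj₂ (inj₂ i) = record { p∈B = π∈ s∈ ; q∈B = π∈ x∈S ; p≢q = λ i → x∉ (x∈S , sym i)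
                      ; p-exit = adj a∈ (s∈ , refl) e ; q-exit = adj (x∈S , refl) i f }
    ...       | inj₂ (inj₁ y∈S) with π y ≟ π s
    ...         | no ne = ⊥-elim (y∉F (y∈S , λ i → ne (proj₂ i)))
    -- An edge of S into the exit fibre from another fibre ends, by rigidity, at the vertex `π s`
    -- itself, which the walk avoids.
    ...         | yes i = ⊥-elim (y≢ (trans (sym (proj₂ (rigid x∈S y∈S f (λ j → x∉ (x∈S , trans j i))))) i))

  -- F prolonged through E until it touches Base, without using vertices of `E ∩ Base` for the
  -- prolongation.
  record Tentacle (F E Base : VSet n) : Set₁ where
    field
      set : VSet n
      F⊆set : F ⊆ set
      set⊆ : set ⊆ (F ∪ (E ∖ Base))
      set-conn : Conn set
      set~Base : Adj set Base

  tentacle : ∀ {F E Base} → Conn F → Conn E → Base ⊆ E → ∀ {b} → b ∈ Base → Adj F E → Tentacle F E Base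
  tentacle {F} {E} {Base} F-conn E-conn Base⊆E {b} b∈ (adj {tgt = y} x∈ y∈ e) with y ∈? Base
  ... | yes i = record { set = F ; F⊆set = id ; set⊆ = inj₁ ; set-conn = F-conn ; set~Base = adj x∈ i e }
  ... | no o with exit J.set (path E-conn y∈ (Base⊆E b∈)) J.base∈ (λ i → proj₂ (J.⊆S (y∈ , o) i) b∈)
    where module J = Component (component (E ∖ Base) y)
  ...   | p , q , p∈ , q∉ , f , _ , q∈E = record
          { set = F ∪ J.set ; F⊆set = inj₁ ; set⊆ = λ { (inj₁ i) → inj₁ i ; (inj₂ i) → inj₂ (J.⊆S (y∈ , o) i) }
          ; set-conn = conn-∪ F-conn J.isConn (adj x∈ J.base∈ e) ; set~Base = to-base }
    where
    module J = Component (component (E ∖ Base) y)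
    to-base : Adj (F ∪ J.set) Base
    to-base with q ∈? Base
    ... | yes i = adj (inj₂ p∈) i f
    ... | no i = ⊥-elim (q∉ (J.closed p∈ (q∈E , i) f))

  record Frame (U D A₀ A₁ S₁ S₂ B₁ B₂ : VSet n) (r₀ r₁ : Fin n) : Set where
    field
      cover : U ⊆ (A₀ ∪ A₁ ∪ D)
      U∖x : ∀ x → Conn (U ∖ ｛ x ｝)
      U∖S₁ : Conn (U ∖ S₁)
      U∖S₂ : Conn (U ∖ S₂)
      U∖A₀ : Conn (U ∖ A₀)
      U∖A₁ : Conn (U ∖ A₁)
      D-conn : Conn D
      A₀-conn : Conn A₀
      A₁-conn : Conn A₁
      S₁-conn : Conn S₁
      S₂-conn : Conn S₂
      D⊆U : D ⊆ U
      A₀⊆U : A₀ ⊆ U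
      A₁⊆U : A₁ ⊆ U
      S₁⊆D : S₁ ⊆ D
      S₂⊆D : S₂ ⊆ D
      A₀∩D : Disjoint A₀ D
      A₁∩D : Disjoint A₁ D
      A₀∩A₁ : Disjoint A₀ A₁
      S₁∩S₂ : Disjoint S₁ S₂
      A₀~A₁ : Adj A₀ A₁
      r₀∈A₀ : r₀ ∈ A₀
      r₁∈A₁ : r₁ ∈ A₁
      retract₁ : Retract S₁ B₁
      retract₂ : Retract S₂ B₂
      other₁ : ∀ p → ∃[ b ] (b ∈ B₁ × b ≢ p)
      other₂ : ∀ p → ∃[ b ] (b ∈ B₂ × b ≢ p)

    B₁⊆S₁ : B₁ ⊆ S₁
    B₁⊆S₁ = Retract.B⊆S retract₁
    B₂⊆S₂ : B₂ ⊆ S₂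
    B₂⊆S₂ = Retract.B⊆S retract₂

  swap-frame : ∀ {U D A₀ A₁ S₁ S₂ B₁ B₂ r₀ r₁} → Frame U D A₀ A₁ S₁ S₂ B₁ B₂ r₀ r₁ → Frame U D A₀ A₁ S₂ S₁ B₂ B₁ r₀ r₁
  swap-frame f = record { Frame f ; U∖S₁ = U∖S₂ ; U∖S₂ = U∖S₁ ; S₁-conn = S₂-conn ; S₂-conn = S₁-conn
    ; S₁⊆D = S₂⊆D ; S₂⊆D = S₁⊆D ; S₁∩S₂ = λ i j → S₁∩S₂ j i
    ; retract₁ = retract₂ ; retract₂ = retract₁ ; other₁ = other₂ ; other₂ = other₁ }
    where open Frame f

  module _ {U D A₀ A₁ S₁ S₂ B₁ B₂ : VSet n} {r₀ r₁ : Fin n} (f : Frame U D A₀ A₁ S₁ S₂ B₁ B₂ r₀ r₁) where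
    open Frame f

    -- U = L ⊔ S₁ ⊔ R with S₂ ⊆ R.
    record Stage : Set₁ where
      field
        L R : VSet n
        A₀⊆L : A₀ ⊆ L
        A₁⊆R : A₁ ⊆ R
        L⊆U : L ⊆ U
        R⊆U : R ⊆ U
        L∩S₁ : Disjoint L S₁
        L∩S₂ : Disjoint L S₂
        L∩R : Disjoint L R
        S₁∩R : Disjoint S₁ R
        stage-cover : U ⊆ (L ∪ S₁ ∪ R)
        L-conn : Conn L
        R-conn : Conn R
        L~S₁ : Adj L S₁
        S₁~R : Adj S₁ R

      S₂⊆R : S₂ ⊆ R
      S₂⊆R i with stage-cover (D⊆U (S₂⊆D i))
      ... | inj₁ j = ⊥-elim (L∩S₂ j i)
      ... | inj₂ (inj₁ j) = ⊥-elim (S₁∩S₂ j i)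
      ... | inj₂ (inj₂ j) = j

    abstract
      blobs : BlobClasses U A₁ S₁ S₂
      blobs = blob-classes S₁-conn S₂-conn S₁∩S₂ (λ i j → A₁∩D j (S₁⊆D i)) (λ i j → A₁∩D j (S₂⊆D i))
                (λ i → D⊆U (S₁⊆D i)) (λ i → D⊆U (S₂⊆D i)) U∖x U∖S₁ U∖S₂ A₁-conn r₁∈A₁ U∖A₁

    -- Both child subtrees are vertices of the contracted graph. Whichever is reached first has the
    -- other still ahead; `configuration` swaps the names if that one is S₂.
    first-stop : Stop (BlobClasses.classes blobs) A₀ (S₁ ∪ S₂)
    first-stop = peel-until classes (S₁ ∪ S₂)
        (λ { i (inj₁ j) → inj₁ (closed₁ i j) ; i (inj₂ j) → inj₂ (closed₂ i j) })
        {proj₁ (other₁ r₀)} (inj₁ b∈S₁) (λ i → A₁∩D i (S₁⊆D b∈S₁)) _ A₀ (U ∖ A₀) start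
        (λ { i (inj₁ j) → A₀∩D i (S₁⊆D j) ; i (inj₂ j) → A₀∩D i (S₂⊆D j) })
        (D⊆U (S₁⊆D b∈S₁) , λ i → A₀∩D i (S₁⊆D b∈S₁)) ≤-refl
      where
      open BlobClasses blobs
      b∈S₁ : proj₁ (other₁ r₀) ∈ S₁
      b∈S₁ = B₁⊆S₁ (proj₁ (proj₂ (other₁ r₀)))
      split : U ⊆ (A₀ ∪ (U ∖ A₀))
      split {v} i with v ∈? A₀
      ... | yes j = inj₁ j
      ... | no j = inj₂ (i , j)
      whole : ∀ {v} → v ∈ U ∖ A₀ → v ∉ A₁ → cls v ⊆ (U ∖ A₀)
      whole {v} (i , o) _ {w} j = inside i j , avoid
        where
        avoid : w ∉ A₀
        avoid k with v ∈? S₁ | v ∈? S₂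
        ... | yes l | _ = A₀∩D k (S₁⊆D (subst (w ∈_) (is-S₁ l) j))
        ... | no _ | yes l = A₀∩D k (S₂⊆D (subst (w ∈_) (is-S₂ l) j))
        ... | no l | no m with subst (w ∈_) (is-single l m) j
        ...   | refl = o k
      start : Bipartition classes A₀ (U ∖ A₀)
      start = record { A⊆U = A₀⊆U ; R⊆U = proj₁ ; cover = split ; apart = λ i j → proj₂ j i ; A-conn = A₀-conn ; R-conn = U∖A₀
        ; T⊆R = λ i → A₁⊆U i , λ j → A₀∩A₁ j i ; whole = whole ; a∈A = r₀∈A₀ }

    stage-of : ∀ {K : Classes U A₁} {Q} (s : Stop K A₀ Q) → S₁ ⊆ Q → S₂ ⊆ Q → Classes.cls K (Stop.item s) ≡ S₁ → Stage
    stage-of s S₁⊆Q S₂⊆Q eq = record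
      { L = L ; R = R ; A₀⊆L = A⊆L ; A₁⊆R = T⊆R ; L⊆U = L⊆U ; R⊆U = R⊆U
      ; L∩S₁ = λ i j → L∩Q i (S₁⊆Q j) ; L∩S₂ = λ i j → L∩Q i (S₂⊆Q j) ; L∩R = L∩R
      ; S₁∩R = subst (λ C → Disjoint C R) eq item∩R ; stage-cover = subst (λ C → U ⊆ (L ∪ C ∪ R)) eq (Stop.cover s)
      ; L-conn = L-conn ; R-conn = R-conn ; L~S₁ = subst (Adj L) eq L~item ; S₁~R = subst (λ C → Adj C R) eq item~R }
      where open Stop s hiding (cover)

    module _ (st : Stage) where
      open Stage st

      private
        b₂∈S₂ : proj₁ (other₂ r₀) ∈ S₂
        b₂∈S₂ = B₂⊆S₂ (proj₁ (proj₂ (other₂ r₀)))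

      second-stop : Stop (BlobClasses.classes blobs) (L ∪ S₁) S₂
      second-stop = peel-until classes S₂ closed₂ b₂∈S₂ (λ i → A₁∩D i (S₂⊆D b₂∈S₂)) _ (L ∪ S₁) R start
          (λ { (inj₁ i) j → L∩S₂ i j ; (inj₂ i) j → S₁∩S₂ i j }) (S₂⊆R b₂∈S₂) ≤-refl
        where
        open BlobClasses blobs
        whole : ∀ {v} → v ∈ R → v ∉ A₁ → cls v ⊆ R
        whole {v} i _ {w} j with v ∈? S₁ | v ∈? S₂
        ... | yes l | _ = ⊥-elim (S₁∩R l i)
        ... | no _ | yes l = S₂⊆R (subst (w ∈_) (is-S₂ l) j)
        ... | no l | no m with subst (w ∈_) (is-single l m) j
        ...   | refl = i
        split : U ⊆ ((L ∪ S₁) ∪ R)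
        split i with stage-cover i
        ... | inj₁ j = inj₁ (inj₁ j)
        ... | inj₂ (inj₁ j) = inj₁ (inj₂ j)
        ... | inj₂ (inj₂ j) = inj₂ j
        start : Bipartition classes (L ∪ S₁) R
        start = record { A⊆U = λ { (inj₁ i) → L⊆U i ; (inj₂ i) → D⊆U (S₁⊆D i) } ; R⊆U = R⊆U ; cover = split
          ; apart = λ { (inj₁ i) j → L∩R i j ; (inj₂ i) j → S₁∩R i j } ; A-conn = conn-∪ L-conn S₁-conn L~S₁ ; R-conn = R-conn
          ; T⊆R = A₁⊆R ; whole = whole ; a∈A = inj₁ (A₀⊆L r₀∈A₀) }

      -- U = L ⊔ S₁ ⊔ Mid ⊔ S₂ ⊔ Z.
      record Stage₂ : Set₁ where
        field
          L′ Z : VSet n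
          L⊆L′ : L ⊆ L′
          S₁⊆L′ : S₁ ⊆ L′
          A₁⊆Z : A₁ ⊆ Z
          L′⊆U : L′ ⊆ U
          Z⊆U : Z ⊆ U
          L′∩S₂ : Disjoint L′ S₂
          L′∩Z : Disjoint L′ Z
          S₂∩Z : Disjoint S₂ Z
          cover₂ : U ⊆ (L′ ∪ S₂ ∪ Z)
          L′-conn : Conn L′
          Z-conn : Conn Z
          L′~S₂ : Adj L′ S₂
          S₂~Z : Adj S₂ Z

      stage₂ : Stage₂
      stage₂ = record
        { L′ = S.L ; Z = S.R ; L⊆L′ = λ i → S.A⊆L (inj₁ i) ; S₁⊆L′ = λ i → S.A⊆L (inj₂ i) ; A₁⊆Z = S.T⊆R ; L′⊆U = S.L⊆U ; Z⊆U = S.R⊆U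
        ; L′∩S₂ = S.L∩Q ; L′∩Z = S.L∩R ; S₂∩Z = subst (λ C → Disjoint C S.R) eq S.item∩R
        ; cover₂ = subst (λ C → U ⊆ (S.L ∪ C ∪ S.R)) eq S.cover
        ; L′-conn = S.L-conn ; Z-conn = S.R-conn ; L′~S₂ = subst (Adj S.L) eq S.L~item ; S₂~Z = subst (λ C → Adj C S.R) eq S.item~R }
        where
        module S = Stop second-stop
        eq : BlobClasses.cls blobs S.item ≡ S₂
        eq = BlobClasses.is-S₂ blobs S.item∈Q

      module _ (st₂ : Stage₂) where
        open Stage₂ st₂

        private
          module π₁ = Retract retract₁
          module π₂ = Retract retract₂

          fib₁ fib₂ : Fin n → VSet n
          fib₁ = fibre S₁ π₁.π
          fib₂ = fibre S₂ π₂.π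

          Mid : VSet n
          Mid = L′ ∖ (L ∪ S₁)

          Z⊆R : Z ⊆ R
          Z⊆R i with stage-cover (Z⊆U i)
          ... | inj₁ j = ⊥-elim (L′∩Z (L⊆L′ j) i)
          ... | inj₂ (inj₁ j) = ⊥-elim (L′∩Z (S₁⊆L′ j) i)
          ... | inj₂ (inj₂ j) = j

          self₁ : ∀ {p} → p ∈ B₁ → p ∈ fib₁ p
          self₁ i = π₁.B⊆S i , π₁.π-fix i

          self₂ : ∀ {p} → p ∈ B₂ → p ∈ fib₂ p
          self₂ i = π₂.B⊆S i , π₂.π-fix i

          rest⊆ : (R ∖ (S₂ ∪ Z)) ⊆ Mid
          rest⊆ (i , o) with cover₂ (R⊆U i)
          ... | inj₁ j = j , λ { (inj₁ k) → L∩R k i ; (inj₂ k) → S₁∩R k i }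
          ... | inj₂ j = ⊥-elim (o j)

          ports₁ : Ports retract₁ L R
          ports₁ = ports U retract₁ U∖x (λ i → D⊆U (S₁⊆D i)) L⊆U stage-cover L∩S₁ other₁ L~S₁ S₁~R

          ports₂ : Ports retract₂ L′ Z
          ports₂ = ports U retract₂ U∖x (λ i → D⊆U (S₂⊆D i)) L′⊆U cover₂ L′∩S₂ other₂ L′~S₂ S₂~Z

          open Ports ports₁ renaming (p to p₁; q to q₁; p∈B to p₁∈B₁; q∈B to q₁∈B₁; p≢q to p₁≢q₁; p-exit to L~p₁; q-exit to q₁~R)
          open Ports ports₂ renaming (p to p₂; q to q₂; p∈B to p₂∈B₂; q∈B to q₂∈B₂; p≢q to p₂≢q₂; p-exit to L′~p₂; q-exit to q₂~Z)

          -- T₁ runs forward from the exit of the first block and T₂ backward from the entrance of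
          -- the second. Apart from their starting fibres both stay in `Mid`, the part of the order
          -- between S₁ and S₂.
          T₁ : Tentacle (fib₁ q₁) R (S₂ ∪ Z)
          T₁ = tentacle (π₁.fibre-conn q₁∈B₁) R-conn (λ { (inj₁ i) → S₂⊆R i ; (inj₂ i) → Z⊆R i }) (inj₂ (A₁⊆Z r₁∈A₁)) q₁~R

          T₂ : Tentacle (fib₂ p₂) L′ (L ∪ S₁)
          T₂ = tentacle (π₂.fibre-conn p₂∈B₂) L′-conn (λ { (inj₁ i) → L⊆L′ i ; (inj₂ i) → S₁⊆L′ i }) (inj₁ (A₀⊆L r₀∈A₀)) (adj-sym L′~p₂)

          module T₁ = Tentacle T₁
          module T₂ = Tentacle T₂

          T₁⊆ : T₁.set ⊆ (fib₁ q₁ ∪ Mid)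
          T₁⊆ i with T₁.set⊆ i
          ... | inj₁ j = inj₁ j
          ... | inj₂ j = inj₂ (rest⊆ j)

          X₀ X₁ : VSet n
          X₀ = L ∪ fib₁ p₁
          X₁ = Z ∪ fib₂ q₂

          X₀-conn : Conn X₀
          X₀-conn = conn-∪ L-conn (π₁.fibre-conn p₁∈B₁) L~p₁

          X₁-conn : Conn X₁
          X₁-conn = conn-∪ Z-conn (π₂.fibre-conn q₂∈B₂) (adj-sym q₂~Z)

          X₀⊆L′ : X₀ ⊆ L′
          X₀⊆L′ (inj₁ i) = L⊆L′ i
          X₀⊆L′ (inj₂ i) = S₁⊆L′ (proj₁ i)

          X₁∩L′ : Disjoint X₁ L′
          X₁∩L′ (inj₁ i) j = L′∩Z j i
          X₁∩L′ (inj₂ i) j = L′∩S₂ j (proj₁ i)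

          X₀-B₁ : Meets X₀ B₁ p₁
          X₀-B₁ = meets (inj₂ (self₁ p₁∈B₁)) p₁∈B₁
            λ { (inj₁ i) j → ⊥-elim (L∩S₁ i (π₁.B⊆S j)) ; (inj₂ i) j → trans (sym (π₁.π-fix j)) (proj₂ i) }

          X₁-B₂ : Meets X₁ B₂ q₂
          X₁-B₂ = meets (inj₂ (self₂ q₂∈B₂)) q₂∈B₂
            λ { (inj₁ i) j → ⊥-elim (S₂∩Z (π₂.B⊆S j) i) ; (inj₂ i) j → trans (sym (π₂.π-fix j)) (proj₂ i) }

          X₀∩B₂ : Disjoint X₀ B₂
          X₀∩B₂ i j = L′∩S₂ (X₀⊆L′ i) (π₂.B⊆S j)

          X₁∩B₁ : Disjoint X₁ B₁
          X₁∩B₁ i j = X₁∩L′ i (S₁⊆L′ (π₁.B⊆S j))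

          -- The common end of all series cases: N joins a vertex of B₁ other than its entrance p₁
          -- to a vertex of B₂ other than its exit q₂.
          to-series : ∀ {N v s} → Conn N → N ⊆ (Mid ∪ fib₁ v ∪ fib₂ s) → v ∈ B₁ → v ∈ N → v ≢ p₁ → s ∈ B₂ → s ∈ N → s ≢ q₂ → Series U B₁ B₂ r₀ r₁
          to-series {N} {v} {s} N-conn N⊆ v∈B₁ v∈N v≢ s∈B₂ s∈N s≢ = record
            { X₀ = X₀ ; N = N ; X₁ = X₁
            ; X₀⊆U = L′⊆U ∘ X₀⊆L′ ; N⊆U = λ i → N⊆U (N⊆ i)
            ; X₁⊆U = λ { (inj₁ i) → Z⊆U i ; (inj₂ i) → D⊆U (S₂⊆D (proj₁ i)) }
            ; X₀-conn = X₀-conn ; N-conn = N-conn ; X₁-conn = X₁-conn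
            ; X₀∩N = λ i j → X₀∩N i (N⊆ j)
            ; X₀∩X₁ = λ i j → X₁∩L′ j (X₀⊆L′ i)
            ; N∩X₁ = λ i j → N∩X₁ (N⊆ i) j
            ; X₀~X₁ = adj-mono (λ i → inj₁ (A₀⊆L i)) (λ i → inj₁ (A₁⊆Z i)) A₀~A₁
            ; r₀∈X₀ = inj₁ (A₀⊆L r₀∈A₀) ; r₁∈X₁ = inj₁ (A₁⊆Z r₁∈A₁)
            ; X₀-B₁ = X₀-B₁
            ; N-B₁ = meets v∈N v∈B₁ (λ i j → only₁ (N⊆ i) j)
            ; N-B₂ = meets s∈N s∈B₂ (λ i j → only₂ (N⊆ i) j)
            ; X₁-B₂ = X₁-B₂ ; X₀∩B₂ = X₀∩B₂ ; X₁∩B₁ = X₁∩B₁ }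
            where
            N⊆U : (Mid ∪ fib₁ v ∪ fib₂ s) ⊆ U
            N⊆U (inj₁ i) = L′⊆U (proj₁ i)
            N⊆U (inj₂ (inj₁ i)) = D⊆U (S₁⊆D (proj₁ i))
            N⊆U (inj₂ (inj₂ i)) = D⊆U (S₂⊆D (proj₁ i))
            X₀∩N : Disjoint X₀ (Mid ∪ fib₁ v ∪ fib₂ s)
            X₀∩N (inj₁ i) (inj₁ j) = proj₂ j (inj₁ i)
            X₀∩N (inj₁ i) (inj₂ (inj₁ j)) = L∩S₁ i (proj₁ j)
            X₀∩N (inj₂ i) (inj₁ j) = proj₂ j (inj₂ (proj₁ i))
            X₀∩N (inj₂ i) (inj₂ (inj₁ j)) = v≢ (trans (sym (proj₂ j)) (proj₂ i))
            X₀∩N i (inj₂ (inj₂ j)) = L′∩S₂ (X₀⊆L′ i) (proj₁ j)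
            N∩X₁ : Disjoint (Mid ∪ fib₁ v ∪ fib₂ s) X₁
            N∩X₁ (inj₁ i) j = X₁∩L′ j (proj₁ i)
            N∩X₁ (inj₂ (inj₁ i)) j = X₁∩L′ j (S₁⊆L′ (proj₁ i))
            N∩X₁ (inj₂ (inj₂ i)) (inj₁ j) = S₂∩Z (proj₁ i) j
            N∩X₁ (inj₂ (inj₂ i)) (inj₂ j) = s≢ (trans (sym (proj₂ i)) (proj₂ j))
            only₁ : ∀ {w} → w ∈ (Mid ∪ fib₁ v ∪ fib₂ s) → w ∈ B₁ → w ≡ v
            only₁ (inj₁ i) j = ⊥-elim (proj₂ i (inj₂ (π₁.B⊆S j)))
            only₁ (inj₂ (inj₁ i)) j = trans (sym (π₁.π-fix j)) (proj₂ i)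
            only₁ (inj₂ (inj₂ i)) j = ⊥-elim (S₁∩S₂ (π₁.B⊆S j) (proj₁ i))
            only₂ : ∀ {w} → w ∈ (Mid ∪ fib₁ v ∪ fib₂ s) → w ∈ B₂ → w ≡ s
            only₂ (inj₁ i) j = ⊥-elim (L′∩S₂ (proj₁ i) (π₂.B⊆S j))
            only₂ (inj₂ (inj₁ i)) j = ⊥-elim (S₁∩S₂ (proj₁ i) (π₂.B⊆S j))
            only₂ (inj₂ (inj₂ i)) j = trans (sym (π₂.π-fix j)) (proj₂ i)

          series-meet : ∀ {x} → x ∈ T₁.set → x ∈ T₂.set → Series U B₁ B₂ r₀ r₁
          series-meet i j = to-series (conn-∪-meet T₁.set-conn T₂.set-conn i j) N⊆
              q₁∈B₁ (inj₁ (T₁.F⊆set (self₁ q₁∈B₁))) (λ e → p₁≢q₁ (sym e)) p₂∈B₂ (inj₂ (T₂.F⊆set (self₂ p₂∈B₂))) p₂≢q₂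
            where
            N⊆ : (T₁.set ∪ T₂.set) ⊆ (Mid ∪ fib₁ q₁ ∪ fib₂ p₂)
            N⊆ (inj₁ i) with T₁⊆ i
            ... | inj₁ j = inj₂ (inj₁ j)
            ... | inj₂ j = inj₁ j
            N⊆ (inj₂ i) with T₂.set⊆ i
            ... | inj₁ j = inj₂ (inj₂ j)
            ... | inj₂ j = inj₁ j

          -- If T₂ runs back into a fibre of S₁ other than that of p₁, this fibre gives B₁ an exit
          -- leading to B₂.
          series-left : ∀ {x} → x ∈ B₁ → x ≢ p₁ → Adj T₂.set (fib₁ x) → Series U B₁ B₂ r₀ r₁
          series-left {x} x∈ x≢ a = to-series (conn-∪ T₂.set-conn (π₁.fibre-conn x∈) a) N⊆ x∈ (inj₂ (self₁ x∈)) x≢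
              p₂∈B₂ (inj₁ (T₂.F⊆set (self₂ p₂∈B₂))) p₂≢q₂
            where
            N⊆ : (T₂.set ∪ fib₁ x) ⊆ (Mid ∪ fib₁ x ∪ fib₂ p₂)
            N⊆ (inj₂ i) = inj₂ (inj₁ i)
            N⊆ (inj₁ i) with T₂.set⊆ i
            ... | inj₁ j = inj₂ (inj₂ j)
            ... | inj₂ j = inj₁ j

          series-right : ∀ {x} → x ∈ B₂ → x ≢ q₂ → Adj T₁.set (fib₂ x) → Series U B₁ B₂ r₀ r₁
          series-right {x} x∈ x≢ a = to-series (conn-∪ T₁.set-conn (π₂.fibre-conn x∈) a) N⊆
              q₁∈B₁ (inj₁ (T₁.F⊆set (self₁ q₁∈B₁))) (λ e → p₁≢q₁ (sym e)) x∈ (inj₂ (self₂ x∈)) x≢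
            where
            N⊆ : (T₁.set ∪ fib₂ x) ⊆ (Mid ∪ fib₁ q₁ ∪ fib₂ x)
            N⊆ (inj₂ i) = inj₂ (inj₂ i)
            N⊆ (inj₁ i) with T₁⊆ i
            ... | inj₁ j = inj₂ (inj₁ j)
            ... | inj₂ j = inj₁ j

          left : Series U B₁ B₂ r₀ r₁ ⊎ Adj X₀ T₂.set
          left with T₂.set~Base
          ... | adj a (inj₁ i) e = inj₂ (adj (inj₁ i) a (⌢-sym e))
          ... | adj {tgt = y} a (inj₂ i) e with π₁.π y ≟ p₁
          ...   | yes q = inj₂ (adj (inj₂ (i , q)) a (⌢-sym e))
          ...   | no q = inj₁ (series-left (π₁.π∈ i) q (adj a (i , refl) e))

          right : Series U B₁ B₂ r₀ r₁ ⊎ Adj X₁ T₁.set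
          right with T₁.set~Base
          ... | adj a (inj₂ i) e = inj₂ (adj (inj₁ i) a (⌢-sym e))
          ... | adj {tgt = y} a (inj₁ i) e with π₂.π y ≟ q₂
          ...   | yes q = inj₂ (adj (inj₂ (i , q)) a (⌢-sym e))
          ...   | no q = inj₁ (series-right (π₂.π∈ i) q (adj a (i , refl) e))

          -- What remains when no series arises: T₂ leads back to the side of r₀ and T₁ forward to
          -- the side of r₁, so each block has one contact on either side.
          balanced : Disjoint T₁.set T₂.set → Adj X₀ T₂.set → Adj X₁ T₁.set →
                     Balanced U D A₀ A₁ B₁ B₂ (X₀ ∪ T₂.set) (X₁ ∪ T₁.set) r₀ r₁ p₁ p₂ q₁ q₂
          balanced dis a₀ a₁ = record
            { cover = cover ; D-conn = D-conn ; D⊆U = D⊆U ; B₁⊆D = S₁⊆D ∘ B₁⊆S₁ ; B₂⊆D = S₂⊆D ∘ B₂⊆S₂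
            ; B₁∩B₂ = λ i j → S₁∩S₂ (B₁⊆S₁ i) (B₂⊆S₂ j)
            ; A₀⊆C₀ = λ i → inj₁ (inj₁ (A₀⊆L i)) ; A₁⊆C₁ = λ i → inj₁ (inj₁ (A₁⊆Z i))
            ; C₀⊆U = C₀⊆U ; C₁⊆U = C₁⊆U
            ; C₀-conn = conn-∪ X₀-conn T₂.set-conn a₀ ; C₁-conn = conn-∪ X₁-conn T₁.set-conn a₁
            ; A₀-conn = A₀-conn ; A₁-conn = A₁-conn ; A₀∩D = A₀∩D ; A₁∩D = A₁∩D ; C₀∩C₁ = C₀∩C₁
            ; A₀~A₁ = A₀~A₁ ; r₀∈A₀ = r₀∈A₀ ; r₁∈A₁ = r₁∈A₁
            ; C₀-B₁ = meets (inj₁ (Meets.∈X X₀-B₁)) p₁∈B₁ (λ { (inj₁ i) j → Meets.only X₀-B₁ i j ; (inj₂ i) j → ⊥-elim (T₂∩B₁ i j) })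
            ; C₀-B₂ = meets (inj₂ (T₂.F⊆set (self₂ p₂∈B₂))) p₂∈B₂ (λ { (inj₁ i) j → ⊥-elim (X₀∩B₂ i j) ; (inj₂ i) j → T₂-only i j })
            ; C₁-B₁ = meets (inj₂ (T₁.F⊆set (self₁ q₁∈B₁))) q₁∈B₁ (λ { (inj₁ i) j → ⊥-elim (X₁∩B₁ i j) ; (inj₂ i) j → T₁-only i j })
            ; C₁-B₂ = meets (inj₁ (Meets.∈X X₁-B₂)) q₂∈B₂ (λ { (inj₁ i) j → Meets.only X₁-B₂ i j ; (inj₂ i) j → ⊥-elim (T₁∩B₂ i j) }) }
            where
            T₂∩B₁ : Disjoint T₂.set B₁
            T₂∩B₁ i j with T₂.set⊆ i
            ... | inj₁ k = S₁∩S₂ (π₁.B⊆S j) (proj₁ k)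
            ... | inj₂ k = proj₂ k (inj₂ (π₁.B⊆S j))
            T₁∩B₂ : Disjoint T₁.set B₂
            T₁∩B₂ i j with T₁⊆ i
            ... | inj₁ k = S₁∩S₂ (proj₁ k) (π₂.B⊆S j)
            ... | inj₂ k = L′∩S₂ (proj₁ k) (π₂.B⊆S j)
            T₂-only : ∀ {w} → w ∈ T₂.set → w ∈ B₂ → w ≡ p₂
            T₂-only i j with T₂.set⊆ i
            ... | inj₁ k = trans (sym (π₂.π-fix j)) (proj₂ k)
            ... | inj₂ k = ⊥-elim (L′∩S₂ (proj₁ k) (π₂.B⊆S j))
            T₁-only : ∀ {w} → w ∈ T₁.set → w ∈ B₁ → w ≡ q₁
            T₁-only i j with T₁⊆ i
            ... | inj₁ k = trans (sym (π₁.π-fix j)) (proj₂ k)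
            ... | inj₂ k = ⊥-elim (proj₂ k (inj₂ (π₁.B⊆S j)))
            C₀⊆U : (X₀ ∪ T₂.set) ⊆ U
            C₀⊆U (inj₁ i) = L′⊆U (X₀⊆L′ i)
            C₀⊆U (inj₂ i) with T₂.set⊆ i
            ... | inj₁ k = D⊆U (S₂⊆D (proj₁ k))
            ... | inj₂ k = L′⊆U (proj₁ k)
            C₁⊆U : (X₁ ∪ T₁.set) ⊆ U
            C₁⊆U (inj₁ (inj₁ i)) = Z⊆U i
            C₁⊆U (inj₁ (inj₂ i)) = D⊆U (S₂⊆D (proj₁ i))
            C₁⊆U (inj₂ i) with T₁⊆ i
            ... | inj₁ k = D⊆U (S₁⊆D (proj₁ k))
            ... | inj₂ k = L′⊆U (proj₁ k)
            C₀∩C₁ : Disjoint (X₀ ∪ T₂.set) (X₁ ∪ T₁.set)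
            C₀∩C₁ (inj₁ i) (inj₁ j) = X₁∩L′ j (X₀⊆L′ i)
            C₀∩C₁ (inj₁ i) (inj₂ j) with T₁⊆ j
            C₀∩C₁ (inj₁ (inj₁ i)) (inj₂ j) | inj₁ k = L∩S₁ i (proj₁ k)
            C₀∩C₁ (inj₁ (inj₂ i)) (inj₂ j) | inj₁ k = p₁≢q₁ (trans (sym (proj₂ i)) (proj₂ k))
            C₀∩C₁ (inj₁ (inj₁ i)) (inj₂ j) | inj₂ k = proj₂ k (inj₁ i)
            C₀∩C₁ (inj₁ (inj₂ i)) (inj₂ j) | inj₂ k = proj₂ k (inj₂ (proj₁ i))
            C₀∩C₁ (inj₂ i) (inj₁ j) with T₂.set⊆ i
            C₀∩C₁ (inj₂ i) (inj₁ (inj₁ j)) | inj₁ k = S₂∩Z (proj₁ k) j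
            C₀∩C₁ (inj₂ i) (inj₁ (inj₂ j)) | inj₁ k = p₂≢q₂ (trans (sym (proj₂ k)) (proj₂ j))
            C₀∩C₁ (inj₂ i) (inj₁ j) | inj₂ k = X₁∩L′ j (proj₁ k)
            C₀∩C₁ (inj₂ i) (inj₂ j) = dis j i

        staged-configuration : Configuration U B₁ B₂ r₀ r₁
        staged-configuration with any? (λ x → x ∈? T₁.set ×-dec x ∈? T₂.set) | left | right
        ... | yes (_ , i , j) | _ | _ = series₁₂ (series-meet i j)
        ... | no _ | inj₁ s | _ = series₁₂ s
        ... | no _ | inj₂ _ | inj₁ s = series₁₂ s
        ... | no o | inj₂ a₀ | inj₂ a₁ = balanced-configuration (balanced (λ i j → o (_ , i , j)) a₀ a₁)

  swap-configuration : ∀ {U B₁ B₂ r₀ r₁} → Configuration U B₂ B₁ r₀ r₁ → Configuration U B₁ B₂ r₀ r₁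
  swap-configuration (series₁₂ s) = series₂₁ s
  swap-configuration (series₂₁ s) = series₁₂ s
  swap-configuration (parallel₀ p) = parallel₀ (swap-parallel p)
  swap-configuration (parallel₁ p) = parallel₁ (swap-parallel p)

  configuration : ∀ {U D A₀ A₁ S₁ S₂ B₁ B₂ r₀ r₁} → Frame U D A₀ A₁ S₁ S₂ B₁ B₂ r₀ r₁ → Configuration U B₁ B₂ r₀ r₁
  configuration f with first-stop f
  ... | s with Stop.item∈Q s
  ...   | inj₁ i = staged-configuration f st (stage₂ f st)
    where st = stage-of f s inj₁ inj₂ (BlobClasses.is-S₁ (blobs f) i)
  ...   | inj₂ i = swap-configuration (staged-configuration (swap-frame f) st (stage₂ (swap-frame f) st))
    where st = stage-of (swap-frame f) s inj₂ inj₁ (BlobClasses.is-S₂ (blobs f) i)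

-- Tree models, their pendant subtrees and subtrees contracted to leaves.

module Trees {n : ℕ} (G : Graph (Fin n)) (_~?_ : ∀ u v → Dec (Graph._~_ G u v)) where
  open Connectivity G _~?_
  open Blocks G _~?_

  -- Tree P h S M: a model of Γ_h whose branch sets partition S, with root branch set M
  -- and with every leaf branch set satisfying P.
  data Tree (P : VSet n → Set) : ℕ → VSet n → VSet n → Set₁ where
    leaf : ∀ {S u} → Conn S → u ∈ S → P S → Tree P zero S S
    node : ∀ {h S M S₁ M₁ S₂ M₂ u} → Conn M → u ∈ M → Tree P h S₁ M₁ → Tree P h S₂ M₂ →
           Adj M M₁ → Adj M M₂ → Disjoint M S₁ → Disjoint M S₂ → Disjoint S₁ S₂ →
           S ⊆ (M ∪ S₁ ∪ S₂) → (M ∪ S₁ ∪ S₂) ⊆ S → Tree P (suc h) S M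

  PlainTree : ℕ → VSet n → VSet n → Set₁
  PlainTree = Tree (λ _ → ⊤)

  module _ {P : VSet n → Set} where

    root⊆ : ∀ {h S M} → Tree P h S M → M ⊆ S
    root⊆ (leaf _ _ _) i = i
    root⊆ (node _ _ _ _ _ _ _ _ _ _ s) i = s (inj₁ i)

    root-point : ∀ {h S M} → Tree P h S M → ∃[ u ] u ∈ M
    root-point (leaf _ i _) = _ , i
    root-point (node _ i _ _ _ _ _ _ _ _ _) = _ , i

    tree-conn : ∀ {h S M} → Tree P h S M → Conn S
    tree-conn (leaf c _ _) = c
    tree-conn {S = S} {M} (node {S₁ = S₁} {S₂ = S₂} c i t₁ t₂ a₁ a₂ _ _ _ s s′) =
      conn-≐ {(M ∪ S₁) ∪ S₂} (λ { (inj₁ (inj₁ j)) → s′ (inj₁ j) ; (inj₁ (inj₂ j)) → s′ (inj₂ (inj₁ j)) ; (inj₂ j) → s′ (inj₂ (inj₂ j)) })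
        (λ j → assoc (s j))
        (conn-∪ (conn-∪ c (tree-conn t₁) (adj-mono id (root⊆ t₁) a₁)) (tree-conn t₂) (adj-mono inj₁ (root⊆ t₂) a₂))
      where
      assoc : ∀ {A B C : Set} → A ⊎ B ⊎ C → (A ⊎ B) ⊎ C
      assoc (inj₁ x) = inj₁ (inj₁ x)
      assoc (inj₂ (inj₁ x)) = inj₁ (inj₂ x)
      assoc (inj₂ (inj₂ x)) = inj₂ x

    third-vertex : ∀ {h S M} → Tree P (suc h) S M → ∀ r r′ → ∃[ v ] (v ∈ S × v ≢ r × v ≢ r′)
    third-vertex {S = S} (node {S₁ = S₁} {S₂ = S₂} {u = a} _ a∈ t₁ t₂ _ _ d₁ d₂ d₃ _ s) r r′ = pick (b ≟ r) (b ≟ r′)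
      where
      b = proj₁ (root-point t₁)
      c = proj₁ (root-point t₂)
      b∈ = root⊆ t₁ (proj₂ (root-point t₁))
      c∈ = root⊆ t₂ (proj₂ (root-point t₂))
      a≢b : a ≢ b
      a≢b e = d₁ a∈ (subst (_∈ S₁) (sym e) b∈)
      a≢c : a ≢ c
      a≢c e = d₂ a∈ (subst (_∈ S₂) (sym e) c∈)
      b≢c : b ≢ c
      b≢c e = d₃ b∈ (subst (_∈ S₂) (sym e) c∈)
      pick : Dec (b ≡ r) → Dec (b ≡ r′) → ∃[ v ] (v ∈ S × v ≢ r × v ≢ r′)
      pick (no o) (no o′) = b , s (inj₂ (inj₁ b∈)) , o , o′
      pick (yes e) _ with a ≟ r′
      ... | no o = a , s (inj₁ a∈) , (λ q → a≢b (trans q (sym e))) , o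
      ... | yes e′ = c , s (inj₂ (inj₂ c∈)) , (λ q → b≢c (trans e (sym q))) , (λ q → a≢c (trans e′ (sym q)))
      pick (no _) (yes e) with a ≟ r
      ... | no o = a , s (inj₁ a∈) , o , (λ q → a≢b (trans q (sym e)))
      ... | yes e′ = c , s (inj₂ (inj₂ c∈)) , (λ q → a≢c (trans e′ (sym q))) , (λ q → b≢c (trans e (sym q)))

  -- v joins the branch set of its neighbour s. The root set can only grow, and `M ⊆ M′` preserves
  -- the edge to a parent.
  insert : ∀ {h S M} → PlainTree h S M → ∀ {s v} → s ∈ S → v ∉ S → s ⌢ v → Σ (VSet n) λ M′ → PlainTree h (S ∪ ｛ v ｝) M′ × M ⊆ M′
  insert (leaf c i _) {v = v} s∈ _ e = _ , leaf (conn-∪ c (conn-｛｝ v) (adj s∈ refl e)) (inj₁ i) tt , inj₁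
  insert {S = S} {M} (node {S₁ = S₁} {S₂ = S₂} c i t₁ t₂ a₁ a₂ d₁ d₂ d₃ s s′) {v = v} s∈ v∉ e with s s∈
  ... | inj₁ j = M ∪ ｛ v ｝ , node (conn-∪ c (conn-｛｝ v) (adj j refl e)) (inj₁ i) t₁ t₂ (adj-mono inj₁ id a₁) (adj-mono inj₁ id a₂)
        (λ { (inj₁ x) y → d₁ x y ; (inj₂ refl) y → v∉ (s′ (inj₂ (inj₁ y))) })
        (λ { (inj₁ x) y → d₂ x y ; (inj₂ refl) y → v∉ (s′ (inj₂ (inj₂ y))) }) d₃ cov back , inj₁
    where
    cov : (S ∪ ｛ v ｝) ⊆ ((M ∪ ｛ v ｝) ∪ S₁ ∪ S₂)
    cov (inj₂ x) = inj₁ (inj₂ x)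
    cov (inj₁ x) with s x
    ... | inj₁ y = inj₁ (inj₁ y)
    ... | inj₂ y = inj₂ y
    back : ((M ∪ ｛ v ｝) ∪ S₁ ∪ S₂) ⊆ (S ∪ ｛ v ｝)
    back (inj₁ (inj₁ x)) = inj₁ (s′ (inj₁ x))
    back (inj₁ (inj₂ x)) = inj₂ x
    back (inj₂ x) = inj₁ (s′ (inj₂ x))
  ... | inj₂ (inj₁ j) with insert t₁ j (λ x → v∉ (s′ (inj₂ (inj₁ x)))) e
  ...   | M₁′ , t₁′ , m = M , node c i t₁′ t₂ (adj-mono id m a₁) a₂
        (λ { x (inj₁ y) → d₁ x y ; x (inj₂ refl) → v∉ (s′ (inj₁ x)) }) d₂
        (λ { (inj₁ x) y → d₃ x y ; (inj₂ refl) y → v∉ (s′ (inj₂ (inj₂ y))) }) cov back , id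
    where
    cov : (S ∪ ｛ v ｝) ⊆ (M ∪ (S₁ ∪ ｛ v ｝) ∪ S₂)
    cov (inj₂ x) = inj₂ (inj₁ (inj₂ x))
    cov (inj₁ x) with s x
    ... | inj₁ y = inj₁ y
    ... | inj₂ (inj₁ y) = inj₂ (inj₁ (inj₁ y))
    ... | inj₂ (inj₂ y) = inj₂ (inj₂ y)
    back : (M ∪ (S₁ ∪ ｛ v ｝) ∪ S₂) ⊆ (S ∪ ｛ v ｝)
    back (inj₁ x) = inj₁ (s′ (inj₁ x))
    back (inj₂ (inj₁ (inj₁ x))) = inj₁ (s′ (inj₂ (inj₁ x)))
    back (inj₂ (inj₁ (inj₂ x))) = inj₂ x
    back (inj₂ (inj₂ x)) = inj₁ (s′ (inj₂ (inj₂ x)))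
  insert {S = S} {M} (node {S₁ = S₁} {S₂ = S₂} c i t₁ t₂ a₁ a₂ d₁ d₂ d₃ s s′) {v = v} s∈ v∉ e | inj₂ (inj₂ j)
    with insert t₂ j (λ x → v∉ (s′ (inj₂ (inj₂ x)))) e
  ...   | M₂′ , t₂′ , m = M , node c i t₁ t₂′ a₁ (adj-mono id m a₂) d₁
        (λ { x (inj₁ y) → d₂ x y ; x (inj₂ refl) → v∉ (s′ (inj₁ x)) })
        (λ { x (inj₁ y) → d₃ x y ; x (inj₂ refl) → v∉ (s′ (inj₂ (inj₁ x))) }) cov back , id
    where
    cov : (S ∪ ｛ v ｝) ⊆ (M ∪ S₁ ∪ (S₂ ∪ ｛ v ｝))
    cov (inj₂ x) = inj₂ (inj₂ (inj₂ x))
    cov (inj₁ x) with s x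
    ... | inj₁ y = inj₁ y
    ... | inj₂ (inj₁ y) = inj₂ (inj₁ y)
    ... | inj₂ (inj₂ y) = inj₂ (inj₂ (inj₁ y))
    back : (M ∪ S₁ ∪ (S₂ ∪ ｛ v ｝)) ⊆ (S ∪ ｛ v ｝)
    back (inj₁ x) = inj₁ (s′ (inj₁ x))
    back (inj₂ (inj₁ x)) = inj₁ (s′ (inj₂ (inj₁ x)))
    back (inj₂ (inj₂ (inj₁ x))) = inj₁ (s′ (inj₂ (inj₂ x)))
    back (inj₂ (inj₂ (inj₂ x))) = inj₂ x

  respan : ∀ {h S M B} → PlainTree h S M → S ⊆ B → B ⊆ S → Σ (VSet n) (PlainTree h B)
  respan {B = B} (leaf c i _) p q = B , leaf (conn-≐ p q c) (p i) tt
  respan (node c i t₁ t₂ a₁ a₂ d₁ d₂ d₃ s s′) p q = _ , node c i t₁ t₂ a₁ a₂ d₁ d₂ d₃ (s ∘ q) (p ∘ s′)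

  span : ∀ {h S M B} → PlainTree h S M → S ⊆ B → Conn B → Σ (VSet n) (PlainTree h B)
  span {B = B} t S⊆B B-conn = go _ t S⊆B ≤-refl
    where
    go : ∀ k {h S M} → PlainTree h S M → S ⊆ B → card (B ∖ S) < k → Σ (VSet n) (PlainTree h B)
    go (suc k) {S = S} t S⊆B (s≤s lt) with adj? S (B ∖ S)
    ... | no ¬a = respan t S⊆B all
      where
      all : B ⊆ S
      all {v} v∈ with v ∈? S
      ... | yes i = i
      ... | no o with exit S (path B-conn (S⊆B (root⊆ t (proj₂ (root-point t)))) v∈) (root⊆ t (proj₂ (root-point t))) o
      ...   | _ , _ , x∈ , y∉ , e , _ , y∈ = ⊥-elim (¬a (adj x∈ (y∈ , y∉) e))
    ... | yes (adj {s} {v} s∈ (v∈B , v∉S) e) with insert t s∈ v∉S e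
    ...   | _ , t′ , _ = go k t′ (λ { (inj₁ i) → S⊆B i ; (inj₂ refl) → v∈B })
              (≤-trans (card-< (B ∖ (S ∪ ｛ v ｝)) (B ∖ S) (λ { (i , o) → i , o ∘ inj₁ }) (v∈B , v∉S) (λ { (_ , o) → o (inj₂ refl) })) lt)

  -- `M~rest` makes the property hereditary: removing only a child leaves the old rest, M and the
  -- sibling subtree, joined into one connected set by this edge.
  record Pendant (B D M : VSet n) : Set where
    field
      D⊆B      : D ⊆ B
      rest-conn : Conn (B ∖ D)
      M~rest    : Adj M (B ∖ D)

  module _ {h : ℕ} {S M S₁ M₁ S₂ M₂ : VSet n} (c : Conn M) (t₁ : PlainTree h S₁ M₁) (t₂ : PlainTree h S₂ M₂)
           (a₁ : Adj M M₁) (a₂ : Adj M M₂) (d₁ : Disjoint M S₁) (d₃ : Disjoint S₁ S₂)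
           (s : S ⊆ (M ∪ S₁ ∪ S₂)) (s′ : (M ∪ S₁ ∪ S₂) ⊆ S) where

    child-of-span : Pendant S S₁ M₁
    child-of-span = record
      { D⊆B = λ i → s′ (inj₂ (inj₁ i))
      ; rest-conn = conn-≐ {M ∪ S₂} (λ { (inj₁ i) → s′ (inj₁ i) , d₁ i ; (inj₂ i) → s′ (inj₂ (inj₂ i)) , λ j → d₃ j i }) cov
                      (conn-∪ c (tree-conn t₂) (adj-mono id (root⊆ t₂) a₂))
      ; M~rest = adj-sym (adj-mono (λ i → s′ (inj₁ i) , d₁ i) id a₁) }
      where
      cov : (S ∖ S₁) ⊆ (M ∪ S₂)
      cov (i , o) with s i
      ... | inj₁ j = inj₁ j
      ... | inj₂ (inj₁ j) = ⊥-elim (o j)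
      ... | inj₂ (inj₂ j) = inj₂ j

    child-of-pendant : ∀ {B} → Pendant B S M → Pendant B S₁ M₁
    child-of-pendant {B} p = record
      { D⊆B = λ i → D⊆B (s′ (inj₂ (inj₁ i)))
      ; rest-conn = conn-≐ {(B ∖ S) ∪ (M ∪ S₂)}
          (λ { (inj₁ (i , o)) → i , (λ j → o (s′ (inj₂ (inj₁ j))))
             ; (inj₂ (inj₁ i)) → D⊆B (s′ (inj₁ i)) , d₁ i
             ; (inj₂ (inj₂ i)) → D⊆B (s′ (inj₂ (inj₂ i))) , λ j → d₃ j i }) cov
          (conn-∪ rest-conn (conn-∪ c (tree-conn t₂) (adj-mono id (root⊆ t₂) a₂)) (adj-mono id inj₁ (adj-sym M~rest)))
      ; M~rest = adj-sym (adj-mono (λ i → D⊆B (s′ (inj₁ i)) , d₁ i) id a₁) }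
      where
      open Pendant p
      cov : (B ∖ S₁) ⊆ ((B ∖ S) ∪ (M ∪ S₂))
      cov {v} (i , o) with v ∈? S
      ... | no o′ = inj₁ (i , o′)
      ... | yes j with s j
      ...   | inj₁ k = inj₂ (inj₁ k)
      ...   | inj₂ (inj₁ k) = ⊥-elim (o k)
      ...   | inj₂ (inj₂ k) = inj₂ (inj₂ k)

  mirror-cover : ∀ {A B C : Set} → A ⊎ B ⊎ C → A ⊎ C ⊎ B
  mirror-cover (inj₁ x) = inj₁ x
  mirror-cover (inj₂ (inj₁ x)) = inj₂ (inj₂ x)
  mirror-cover (inj₂ (inj₂ x)) = inj₂ (inj₁ x)

  record Child (h : ℕ) (Q : VSet n → VSet n → Set) : Set₁ where
    constructor child
    field
      {D M} : VSet n
      tree  : PlainTree h D M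
      good  : Q D M

  child-avoiding : ∀ {h S M} → PlainTree (suc h) S M → ∀ r → Child h (λ D M′ → Pendant S D M′ × r ∉ D)
  child-avoiding (node {S₁ = S₁} c i t₁ t₂ a₁ a₂ d₁ d₂ d₃ s s′) r with r ∈? S₁
  ... | no o = child t₁ (child-of-span c t₁ t₂ a₁ a₂ d₁ d₃ s s′ , o)
  ... | yes j = child t₂ (child-of-span c t₂ t₁ a₂ a₁ d₂ (λ x y → d₃ y x) (λ x → mirror-cover (s x)) (λ x → s′ (mirror-cover x)) , d₃ j)

  -- Sibling subtrees are disjoint, so one of them misses a given vertex; two levels deal with two
  -- vertices.
  grandchild-avoiding : ∀ {h B M} → PlainTree (suc (suc h)) B M → ∀ r r′ → Child h (λ D M′ → Pendant B D M′ × r ∉ D × r′ ∉ D)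
  grandchild-avoiding {h} {B} t r r′ with child-avoiding t r
  ... | child t′ (p , o) = down t′ p o
    where
    down : ∀ {S M} → PlainTree (suc h) S M → Pendant B S M → r ∉ S → Child h (λ D M′ → Pendant B D M′ × r ∉ D × r′ ∉ D)
    down (node {S₁ = S₁} c i t₁ t₂ a₁ a₂ d₁ d₂ d₃ s s′) p o with r′ ∈? S₁
    ... | no o′ = child t₁ (child-of-pendant c t₁ t₂ a₁ a₂ d₁ d₃ s s′ p , (λ x → o (s′ (inj₂ (inj₁ x)))) , o′)
    ... | yes j = child t₂ (child-of-pendant c t₂ t₁ a₂ a₁ d₂ (λ x y → d₃ y x) (λ x → mirror-cover (s x)) (λ x → s′ (mirror-cover x)) p
                           , (λ x → o (s′ (inj₂ (inj₂ x)))) , d₃ j)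

  module _ (B O : VSet n) where

    Inner : ℕ → Set₁
    Inner h = Child h (λ D M → Pendant B D M × ¬ Adj D O)

    -- Each subtree at depth j is contracted to a leaf adjacent to O. For j zero this swallows the
    -- whole subtree into the root set, hence M′ in place of M.
    LeavesTo : ℕ → VSet n → VSet n → Set₁
    LeavesTo j S M = Σ (VSet n) λ M′ → Tree (λ L → Adj L O) j S M′ × M ⊆ M′

    descend : ∀ j {h S M} → PlainTree (j + h) S M → Pendant B S M → LeavesTo j S M ⊎ Inner h
    descend zero {S = S} t p with adj? S O
    ... | yes a = inj₁ (S , leaf (tree-conn t) (root⊆ t (proj₂ (root-point t))) a , root⊆ t)
    ... | no o = inj₂ (child t (p , o))
    descend (suc j) (node c i t₁ t₂ a₁ a₂ d₁ d₂ d₃ s s′) p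
      with descend j t₁ (child-of-pendant c t₁ t₂ a₁ a₂ d₁ d₃ s s′ p)
         | descend j t₂ (child-of-pendant c t₂ t₁ a₂ a₁ d₂ (λ x y → d₃ y x) (λ x → mirror-cover (s x)) (λ x → s′ (mirror-cover x)) p)
    ... | inj₂ e | _ = inj₂ e
    ... | inj₁ _ | inj₂ e = inj₂ e
    ... | inj₁ (_ , u₁ , m₁) | inj₁ (_ , u₂ , m₂) = inj₁ (_ , node c i u₁ u₂ (adj-mono id m₁ a₁) (adj-mono id m₂ a₂) d₁ d₂ d₃ s s′ , id)

    -- B is not a pendant subtree of itself, so the first of the `suc j` levels is split off before
    -- `descend` applies to the children.
    escape : ∀ j {h M} → PlainTree (suc j + h) B M → LeavesTo (suc j) B M ⊎ Inner h
    escape j (node c i t₁ t₂ a₁ a₂ d₁ d₂ d₃ s s′)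
      with descend j t₁ (child-of-span c t₁ t₂ a₁ a₂ d₁ d₃ s s′)
         | descend j t₂ (child-of-span c t₂ t₁ a₂ a₁ d₂ (λ x y → d₃ y x) (λ x → mirror-cover (s x)) (λ x → s′ (mirror-cover x)))
    ... | inj₂ e | _ = inj₂ e
    ... | inj₁ _ | inj₂ e = inj₂ e
    ... | inj₁ (_ , u₁ , m₁) | inj₁ (_ , u₂ , m₂) = inj₁ (_ , node c i u₁ u₂ (adj-mono id m₁ a₁) (adj-mono id m₂ a₂) d₁ d₂ d₃ s s′ , id)

  -- Take the component K of u in S without z. If K meets the connected set `S ∖ Y`, then u reaches
  -- q there. Otherwise K lies in Y; as U without z is connected, an edge leads out of K, and it
  -- must leave S, which Y forbids.
  inner-not-cut : ∀ {U S Y M} → (∀ x → Conn (U ∖ ｛ x ｝)) → S ⊆ U → ∀ {o} → o ∈ U ∖ S →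
                  Pendant S Y M → ¬ Adj Y (U ∖ S) → ∀ {z} → z ∈ Y → Conn (S ∖ ｛ z ｝)
  inner-not-cut {U} {S} {Y} U∖x S⊆U {o} (o∈U , o∉S) p ¬adj {z} z∈Y = star q to-q
    where
    open Pendant p
    q = tgt M~rest
    q∈ : q ∈ S ∖ Y
    q∈ = tgt∈ M~rest
    shrink : (S ∖ Y) ⊆ (S ∖ ｛ z ｝)
    shrink (i , j) = i , λ { refl → j z∈Y }
    to-q : ∀ {u} → u ∈ S ∖ ｛ z ｝ → Walk G (_∈ (S ∖ ｛ z ｝)) u q
    to-q {u} u∈ with any? (λ x → x ∈? Component.set (component (S ∖ ｛ z ｝) u) ×-dec x ∈? (S ∖ Y))
    ... | yes (x , x∈K , x∈) = widen (K.⊆S u∈) (path K.isConn K.base∈ x∈K) ◅◅ widen shrink (path rest-conn x∈ q∈)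
      where module K = Component (component (S ∖ ｛ z ｝) u)
    ... | no none with exit K.set (path (U∖x z) (S⊆U (proj₁ u∈) , proj₂ u∈) (o∈U , λ { refl → o∉S (D⊆B z∈Y) })) K.base∈ (λ i → o∉S (proj₁ (K.⊆S u∈ i)))
      where module K = Component (component (S ∖ ｛ z ｝) u)
    ...   | x , y , x∈ , y∉ , e , _ , (y∈U , y≢z) = ⊥-elim (¬adj (adj x∈Y (y∈U , y∉S) e))
      where
      module K = Component (component (S ∖ ｛ z ｝) u)
      y∉S : y ∉ S
      y∉S i = y∉ (K.closed x∈ (i , y≢z) e)
      x∈Y : x ∈ Y
      x∈Y with x ∈? Y
      ... | yes i = i
      ... | no i = ⊥-elim (none (x , x∈ , proj₁ (K.⊆S u∈ x∈) , i))

-- Rooted models and how they are extended and glued.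

module RootedModels {n : ℕ} (G : Graph (Fin n)) (_~?_ : ∀ u v → Dec (Graph._~_ G u v)) where
  open Connectivity G _~?_
  open Peeling G _~?_
  open Blocks G _~?_
  open Configurations G _~?_
  open Trees G _~?_

  -- The branch sets of ∇_{m+1} other than the root sets X₀ and X₁ lie in U; the root edge is not required.
  data Nabla : ℕ → VSet n → VSet n → VSet n → Set₁ where
    triangle : ∀ {U X₀ X₁ T t} → Conn T → t ∈ T → T ⊆ U → Adj X₀ T → Adj X₁ T → Nabla zero U X₀ X₁
    glue : ∀ {m U X₀ X₁ T t U₁ U₂} → Conn T → t ∈ T → T ⊆ U → Adj X₀ T → Adj X₁ T →
           U₁ ⊆ U → U₂ ⊆ U → Disjoint T U₁ → Disjoint T U₂ → Disjoint U₁ U₂ →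
           Nabla m U₁ X₀ T → Nabla m U₂ X₁ T → Nabla (suc m) U X₀ X₁

  nabla-mono : ∀ {m U U′ X₀ X₀′ X₁ X₁′} → U ⊆ U′ → X₀ ⊆ X₀′ → X₁ ⊆ X₁′ → Nabla m U X₀ X₁ → Nabla m U′ X₀′ X₁′
  nabla-mono i j k (triangle {t = t} c t∈ s a b) = triangle {t = t} c t∈ (i ∘ s) (adj-mono j id a) (adj-mono k id b)
  nabla-mono i j k (glue {t = t} {U₁ = U₁} {U₂ = U₂} c t∈ s a b u₁ u₂ d₁ d₂ d₃ x y) =
    glue {t = t} {U₁ = U₁} {U₂ = U₂} c t∈ (i ∘ s) (adj-mono j id a) (adj-mono k id b) (i ∘ u₁) (i ∘ u₂) d₁ d₂ d₃ (nabla-mono id j id x) (nabla-mono id k id y)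

  nabla-mirror : ∀ {m U X₀ X₁} → Nabla m U X₀ X₁ → Nabla m U X₁ X₀
  nabla-mirror (triangle c t∈ s a b) = triangle c t∈ s b a
  nabla-mirror (glue c t∈ s a b u₁ u₂ d₁ d₂ d₃ x y) = glue c t∈ s b a u₂ u₁ d₂ d₁ (λ i j → d₃ j i) y x

  leaf-mono : ∀ {P Q : VSet n → Set} {h S M} → (∀ {L} → P L → Q L) → Tree P h S M → Tree Q h S M
  leaf-mono f (leaf c i p) = leaf c i (f p)
  leaf-mono f (node c i t₁ t₂ a₁ a₂ d₁ d₂ d₃ s s′) = node c i (leaf-mono f t₁) (leaf-mono f t₂) a₁ a₂ d₁ d₂ d₃ s s′

  record RootedNabla (m : ℕ) (U : VSet n) (r₀ r₁ : Fin n) : Set₁ where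
    field
      X₀ X₁ I : VSet n
      X₀⊆U : X₀ ⊆ U
      X₁⊆U : X₁ ⊆ U
      I⊆U  : I ⊆ U
      X₀-conn : Conn X₀
      X₁-conn : Conn X₁
      r₀∈X₀ : r₀ ∈ X₀
      r₁∈X₁ : r₁ ∈ X₁
      X₀∩X₁ : Disjoint X₀ X₁
      X₀∩I : Disjoint X₀ I
      X₁∩I : Disjoint X₁ I
      X₀~X₁ : Adj X₀ X₁
      nabla : Nabla m I X₀ X₁

  -- A model of Γ_a⁺ with apex set X ∋ r₁ whose root set is attached to Y ∋ r₀.
  record RootedTree (a : ℕ) (U : VSet n) (r₀ r₁ : Fin n) : Set₁ where
    field
      Y X S M : VSet n
      Y⊆U : Y ⊆ U
      X⊆U : X ⊆ U
      S⊆U : S ⊆ U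
      Y-conn : Conn Y
      X-conn : Conn X
      r₀∈Y : r₀ ∈ Y
      r₁∈X : r₁ ∈ X
      Y∩X : Disjoint Y X
      Y∩S : Disjoint Y S
      X∩S : Disjoint X S
      tree : Tree (λ L → Adj L X) a S M
      M~Y : Adj M Y

  nabla-swap : ∀ {m U r₀ r₁} → RootedNabla m U r₀ r₁ → RootedNabla m U r₁ r₀
  nabla-swap R = record { X₀ = X₁ ; X₁ = X₀ ; I = I ; X₀⊆U = X₁⊆U ; X₁⊆U = X₀⊆U ; I⊆U = I⊆U ; X₀-conn = X₁-conn ; X₁-conn = X₀-conn
    ; r₀∈X₀ = r₁∈X₁ ; r₁∈X₁ = r₀∈X₀ ; X₀∩X₁ = λ i j → X₀∩X₁ j i ; X₀∩I = X₁∩I ; X₁∩I = X₀∩I ; X₀~X₁ = adj-sym X₀~X₁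
    ; nabla = nabla-mirror nabla }
    where open RootedNabla R

  meets-disjoint : ∀ {X B p C} → Meets X B p → C ⊆ B → p ∉ C → Disjoint X C
  meets-disjoint {C = C} m s o i j = o (subst (_∈ C) (Meets.only m i (s j)) j)

  -- Disjoint arms from the roots of U to two vertices of B. Adding them to the sets that contain p
  -- and q turns a rooted model in B into one in U.
  record Attached (U B : VSet n) (r₀ r₁ p q : Fin n) : Set₁ where
    field
      Z₀ Z₁ : VSet n
      B⊆U : B ⊆ U
      Z₀⊆U : Z₀ ⊆ U
      Z₁⊆U : Z₁ ⊆ U
      Z₀-conn : Conn Z₀
      Z₁-conn : Conn Z₁
      r₀∈Z₀ : r₀ ∈ Z₀
      r₁∈Z₁ : r₁ ∈ Z₁
      Z₀∩Z₁ : Disjoint Z₀ Z₁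
      Z₀-B : Meets Z₀ B p
      Z₁-B : Meets Z₁ B q

  module _ {U B : VSet n} {r₀ r₁ p q : Fin n} (A : Attached U B r₀ r₁ p q) where
    open Attached A

    extend-nabla : ∀ {m} → RootedNabla m B p q → RootedNabla m U r₀ r₁
    extend-nabla R = record
      { X₀ = Z₀ ∪ X₀ ; X₁ = Z₁ ∪ X₁ ; I = I
      ; X₀⊆U = λ { (inj₁ i) → Z₀⊆U i ; (inj₂ i) → B⊆U (X₀⊆U i) } ; X₁⊆U = λ { (inj₁ i) → Z₁⊆U i ; (inj₂ i) → B⊆U (X₁⊆U i) } ; I⊆U = B⊆U ∘ I⊆U
      ; X₀-conn = conn-∪-meet Z₀-conn X₀-conn (Meets.∈X Z₀-B) r₀∈X₀ ; X₁-conn = conn-∪-meet Z₁-conn X₁-conn (Meets.∈X Z₁-B) r₁∈X₁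
      ; r₀∈X₀ = inj₁ r₀∈Z₀ ; r₁∈X₁ = inj₁ r₁∈Z₁
      ; X₀∩X₁ = λ { (inj₁ i) (inj₁ j) → Z₀∩Z₁ i j ; (inj₁ i) (inj₂ j) → meets-disjoint {C = X₁} Z₀-B X₁⊆U (X₀∩X₁ r₀∈X₀) i j
                  ; (inj₂ i) (inj₁ j) → meets-disjoint {C = X₀} Z₁-B X₀⊆U (λ k → X₀∩X₁ k r₁∈X₁) j i ; (inj₂ i) (inj₂ j) → X₀∩X₁ i j }
      ; X₀∩I = λ { (inj₁ i) j → meets-disjoint {C = I} Z₀-B I⊆U (X₀∩I r₀∈X₀) i j ; (inj₂ i) j → X₀∩I i j }
      ; X₁∩I = λ { (inj₁ i) j → meets-disjoint {C = I} Z₁-B I⊆U (X₁∩I r₁∈X₁) i j ; (inj₂ i) j → X₁∩I i j }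
      ; X₀~X₁ = adj-mono inj₂ inj₂ X₀~X₁ ; nabla = nabla-mono id inj₂ inj₂ nabla }
      where open RootedNabla R

    extend-tree : ∀ {a} → RootedTree a B p q → RootedTree a U r₀ r₁
    extend-tree R = record
      { Y = Z₀ ∪ Y ; X = Z₁ ∪ X ; S = S ; M = M
      ; Y⊆U = λ { (inj₁ i) → Z₀⊆U i ; (inj₂ i) → B⊆U (Y⊆U i) } ; X⊆U = λ { (inj₁ i) → Z₁⊆U i ; (inj₂ i) → B⊆U (X⊆U i) } ; S⊆U = B⊆U ∘ S⊆U
      ; Y-conn = conn-∪-meet Z₀-conn Y-conn (Meets.∈X Z₀-B) r₀∈Y ; X-conn = conn-∪-meet Z₁-conn X-conn (Meets.∈X Z₁-B) r₁∈X
      ; r₀∈Y = inj₁ r₀∈Z₀ ; r₁∈X = inj₁ r₁∈Z₁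
      ; Y∩X = λ { (inj₁ i) (inj₁ j) → Z₀∩Z₁ i j ; (inj₁ i) (inj₂ j) → meets-disjoint {C = X} Z₀-B X⊆U (Y∩X r₀∈Y) i j
                ; (inj₂ i) (inj₁ j) → meets-disjoint {C = Y} Z₁-B Y⊆U (λ k → Y∩X k r₁∈X) j i ; (inj₂ i) (inj₂ j) → Y∩X i j }
      ; Y∩S = λ { (inj₁ i) j → meets-disjoint {C = S} Z₀-B S⊆U (Y∩S r₀∈Y) i j ; (inj₂ i) j → Y∩S i j }
      ; X∩S = λ { (inj₁ i) j → meets-disjoint {C = S} Z₁-B S⊆U (X∩S r₁∈X) i j ; (inj₂ i) j → X∩S i j }
      ; tree = leaf-mono (adj-mono id inj₂) tree ; M~Y = adj-mono id inj₂ M~Y }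
      where open RootedTree R

  module _ {U B₁ B₂ : VSet n} {r₀ r₁ : Fin n} (B₁⊆U : B₁ ⊆ U) (B₂⊆U : B₂ ⊆ U) (B₁∩B₂ : Disjoint B₁ B₂) where

    module _ (B₁-conn : Conn B₁) (B₂-conn : Conn B₂) (σ : Series U B₁ B₂ r₀ r₁) where
      open Series σ

      -- The second block serves only as a connected part of the arm to r₁. `series-attach₂` uses
      -- the first block in the same way.
      series-attach₁ : Attached U B₁ r₀ r₁ u v
      series-attach₁ = record
        { Z₀ = X₀ ; Z₁ = (N ∪ B₂) ∪ X₁ ; B⊆U = B₁⊆U ; Z₀⊆U = X₀⊆U
        ; Z₁⊆U = λ { (inj₁ (inj₁ i)) → N⊆U i ; (inj₁ (inj₂ i)) → B₂⊆U i ; (inj₂ i) → X₁⊆U i }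
        ; Z₀-conn = X₀-conn
        ; Z₁-conn = conn-∪-meet (conn-∪-meet N-conn B₂-conn (Meets.∈X N-B₂) (Meets.∈B N-B₂)) X₁-conn (inj₂ (Meets.∈B X₁-B₂)) (Meets.∈X X₁-B₂)
        ; r₀∈Z₀ = r₀∈X₀ ; r₁∈Z₁ = inj₂ r₁∈X₁
        ; Z₀∩Z₁ = λ { i (inj₁ (inj₁ j)) → X₀∩N i j ; i (inj₁ (inj₂ j)) → X₀∩B₂ i j ; i (inj₂ j) → X₀∩X₁ i j }
        ; Z₀-B = X₀-B₁
        ; Z₁-B = meets (inj₁ (inj₁ (Meets.∈X N-B₁))) (Meets.∈B N-B₁)
            λ { (inj₁ (inj₁ i)) j → Meets.only N-B₁ i j ; (inj₁ (inj₂ i)) j → ⊥-elim (B₁∩B₂ j i) ; (inj₂ i) j → ⊥-elim (X₁∩B₁ i j) } }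

      series-attach₂ : Attached U B₂ r₀ r₁ s t
      series-attach₂ = record
        { Z₀ = (X₀ ∪ B₁) ∪ N ; Z₁ = X₁ ; B⊆U = B₂⊆U
        ; Z₀⊆U = λ { (inj₁ (inj₁ i)) → X₀⊆U i ; (inj₁ (inj₂ i)) → B₁⊆U i ; (inj₂ i) → N⊆U i } ; Z₁⊆U = X₁⊆U
        ; Z₀-conn = conn-∪-meet (conn-∪-meet X₀-conn B₁-conn (Meets.∈X X₀-B₁) (Meets.∈B X₀-B₁)) N-conn (inj₂ (Meets.∈B N-B₁)) (Meets.∈X N-B₁)
        ; Z₁-conn = X₁-conn ; r₀∈Z₀ = inj₁ (inj₁ r₀∈X₀) ; r₁∈Z₁ = r₁∈X₁
        ; Z₀∩Z₁ = λ { (inj₁ (inj₁ i)) j → X₀∩X₁ i j ; (inj₁ (inj₂ i)) j → X₁∩B₁ j i ; (inj₂ i) j → N∩X₁ i j }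
        ; Z₀-B = meets (inj₂ (Meets.∈X N-B₂)) (Meets.∈B N-B₂)
            λ { (inj₁ (inj₁ i)) j → ⊥-elim (X₀∩B₂ i j) ; (inj₁ (inj₂ i)) j → ⊥-elim (B₁∩B₂ i j) ; (inj₂ i) j → Meets.only N-B₂ i j }
        ; Z₁-B = X₁-B₂ }

      -- The new apex T unites N with the inner root set of either model. Their root edges become
      -- the two sides at T, and the edge between X₀ and X₁ is the new root edge.
      series-nabla : ∀ {m} → RootedNabla m B₁ u v → RootedNabla m B₂ s t → RootedNabla (suc m) U r₀ r₁
      series-nabla {m} R₁ R₂ = record
        { X₀ = X₀ ∪ P.X₀ ; X₁ = X₁ ∪ Q.X₁ ; I = (T ∪ P.I) ∪ Q.I
        ; X₀⊆U = λ { (inj₁ i) → X₀⊆U i ; (inj₂ i) → B₁⊆U (P.X₀⊆U i) } ; X₁⊆U = λ { (inj₁ i) → X₁⊆U i ; (inj₂ i) → B₂⊆U (Q.X₁⊆U i) }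
        ; I⊆U = λ { (inj₁ (inj₁ (inj₁ i))) → N⊆U i ; (inj₁ (inj₁ (inj₂ (inj₁ i)))) → B₁⊆U (P.X₁⊆U i) ; (inj₁ (inj₁ (inj₂ (inj₂ i)))) → B₂⊆U (Q.X₀⊆U i)
                  ; (inj₁ (inj₂ i)) → B₁⊆U (P.I⊆U i) ; (inj₂ i) → B₂⊆U (Q.I⊆U i) }
        ; X₀-conn = conn-∪-meet X₀-conn P.X₀-conn (Meets.∈X X₀-B₁) P.r₀∈X₀
        ; X₁-conn = conn-∪-meet X₁-conn Q.X₁-conn (Meets.∈X X₁-B₂) Q.r₁∈X₁
        ; r₀∈X₀ = inj₁ r₀∈X₀ ; r₁∈X₁ = inj₁ r₁∈X₁
        ; X₀∩X₁ = λ { (inj₁ i) (inj₁ j) → X₀∩X₁ i j ; (inj₁ i) (inj₂ j) → X₀∩B₂ i (Q.X₁⊆U j)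
                    ; (inj₂ i) (inj₁ j) → X₁∩B₁ j (P.X₀⊆U i) ; (inj₂ i) (inj₂ j) → B₁∩B₂ (P.X₀⊆U i) (Q.X₁⊆U j) }
        ; X₀∩I = X₀∩I ; X₁∩I = X₁∩I
        ; X₀~X₁ = adj-mono inj₁ inj₁ X₀~X₁
        ; nabla = glue {t = v} {U₁ = P.I} {U₂ = Q.I} T-conn (inj₁ (Meets.∈X N-B₁)) (λ i → inj₁ (inj₁ i))
            (adj-mono inj₂ (λ i → inj₂ (inj₁ i)) P.X₀~X₁) (adj-mono inj₂ (λ i → inj₂ (inj₂ i)) (adj-sym Q.X₀~X₁))
            (λ i → inj₁ (inj₂ i)) inj₂ T∩P T∩Q (λ i j → B₁∩B₂ (P.I⊆U i) (Q.I⊆U j))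
            (nabla-mono id inj₂ (λ i → inj₂ (inj₁ i)) P.nabla)
            (nabla-mono id inj₂ (λ i → inj₂ (inj₂ i)) (nabla-mirror Q.nabla)) }
        where
        module P = RootedNabla R₁
        module Q = RootedNabla R₂
        T : VSet n
        T = N ∪ P.X₁ ∪ Q.X₀
        T-conn : Conn T
        T-conn = conn-≐ {(N ∪ P.X₁) ∪ Q.X₀} (λ { (inj₁ (inj₁ i)) → inj₁ i ; (inj₁ (inj₂ i)) → inj₂ (inj₁ i) ; (inj₂ i) → inj₂ (inj₂ i) })
                   (λ { (inj₁ i) → inj₁ (inj₁ i) ; (inj₂ (inj₁ i)) → inj₁ (inj₂ i) ; (inj₂ (inj₂ i)) → inj₂ i })
                   (conn-∪-meet (conn-∪-meet N-conn P.X₁-conn (Meets.∈X N-B₁) P.r₁∈X₁) Q.X₀-conn (inj₁ (Meets.∈X N-B₂)) Q.r₀∈X₀)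
        T∩P : Disjoint T P.I
        T∩P (inj₁ i) j = meets-disjoint {C = P.I} N-B₁ P.I⊆U (P.X₁∩I P.r₁∈X₁) i j
        T∩P (inj₂ (inj₁ i)) j = P.X₁∩I i j
        T∩P (inj₂ (inj₂ i)) j = B₁∩B₂ (P.I⊆U j) (Q.X₀⊆U i)
        T∩Q : Disjoint T Q.I
        T∩Q (inj₁ i) j = meets-disjoint {C = Q.I} N-B₂ Q.I⊆U (Q.X₀∩I Q.r₀∈X₀) i j
        T∩Q (inj₂ (inj₁ i)) j = B₁∩B₂ (P.X₁⊆U i) (Q.I⊆U j)
        T∩Q (inj₂ (inj₂ i)) j = Q.X₀∩I i j
        X₀∩I : Disjoint (X₀ ∪ P.X₀) ((T ∪ P.I) ∪ Q.I)
        X₀∩I (inj₁ i) (inj₁ (inj₁ (inj₁ j))) = X₀∩N i j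
        X₀∩I (inj₁ i) (inj₁ (inj₁ (inj₂ (inj₁ j)))) = meets-disjoint {C = P.X₁} X₀-B₁ P.X₁⊆U (P.X₀∩X₁ P.r₀∈X₀) i j
        X₀∩I (inj₁ i) (inj₁ (inj₁ (inj₂ (inj₂ j)))) = X₀∩B₂ i (Q.X₀⊆U j)
        X₀∩I (inj₁ i) (inj₁ (inj₂ j)) = meets-disjoint {C = P.I} X₀-B₁ P.I⊆U (P.X₀∩I P.r₀∈X₀) i j
        X₀∩I (inj₁ i) (inj₂ j) = X₀∩B₂ i (Q.I⊆U j)
        X₀∩I (inj₂ i) (inj₁ (inj₁ (inj₁ j))) = meets-disjoint {C = P.X₀} N-B₁ P.X₀⊆U (λ k → P.X₀∩X₁ k P.r₁∈X₁) j i
        X₀∩I (inj₂ i) (inj₁ (inj₁ (inj₂ (inj₁ j)))) = P.X₀∩X₁ i j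
        X₀∩I (inj₂ i) (inj₁ (inj₁ (inj₂ (inj₂ j)))) = B₁∩B₂ (P.X₀⊆U i) (Q.X₀⊆U j)
        X₀∩I (inj₂ i) (inj₁ (inj₂ j)) = P.X₀∩I i j
        X₀∩I (inj₂ i) (inj₂ j) = B₁∩B₂ (P.X₀⊆U i) (Q.I⊆U j)
        X₁∩I : Disjoint (X₁ ∪ Q.X₁) ((T ∪ P.I) ∪ Q.I)
        X₁∩I (inj₁ i) (inj₁ (inj₁ (inj₁ j))) = N∩X₁ j i
        X₁∩I (inj₁ i) (inj₁ (inj₁ (inj₂ (inj₁ j)))) = X₁∩B₁ i (P.X₁⊆U j)
        X₁∩I (inj₁ i) (inj₁ (inj₁ (inj₂ (inj₂ j)))) = meets-disjoint {C = Q.X₀} X₁-B₂ Q.X₀⊆U (λ k → Q.X₀∩X₁ k Q.r₁∈X₁) i j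
        X₁∩I (inj₁ i) (inj₁ (inj₂ j)) = X₁∩B₁ i (P.I⊆U j)
        X₁∩I (inj₁ i) (inj₂ j) = meets-disjoint {C = Q.I} X₁-B₂ Q.I⊆U (Q.X₁∩I Q.r₁∈X₁) i j
        X₁∩I (inj₂ i) (inj₁ (inj₁ (inj₁ j))) = meets-disjoint {C = Q.X₁} N-B₂ Q.X₁⊆U (Q.X₀∩X₁ Q.r₀∈X₀) j i
        X₁∩I (inj₂ i) (inj₁ (inj₁ (inj₂ (inj₁ j)))) = B₁∩B₂ (P.X₁⊆U j) (Q.X₁⊆U i)
        X₁∩I (inj₂ i) (inj₁ (inj₁ (inj₂ (inj₂ j)))) = Q.X₀∩X₁ j i
        X₁∩I (inj₂ i) (inj₁ (inj₂ j)) = B₁∩B₂ (P.I⊆U j) (Q.X₁⊆U i)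
        X₁∩I (inj₂ i) (inj₂ j) = Q.X₁∩I i j

    module _ (p : Parallel U B₁ B₂ r₀ r₁) where
      open Parallel p

      private
        Z : VSet n
        Z = N ∪ Y
        Z-conn : Conn Z
        Z-conn = conn-∪ N-conn Y-conn N~Y
        Z∩X : Disjoint Z X
        Z∩X (inj₁ i) j = N∩X i j
        Z∩X (inj₂ i) j = Y∩X i j
        Z⊆U : Z ⊆ U
        Z⊆U (inj₁ i) = N⊆U i
        Z⊆U (inj₂ i) = Y⊆U i

      parallel-attach₁ : Attached U B₁ r₀ r₁ p₁ q₁
      parallel-attach₁ = record
        { Z₀ = Z ; Z₁ = X ; B⊆U = B₁⊆U ; Z₀⊆U = Z⊆U ; Z₁⊆U = X⊆U ; Z₀-conn = Z-conn ; Z₁-conn = X-conn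
        ; r₀∈Z₀ = inj₂ r₀∈Y ; r₁∈Z₁ = r₁∈X ; Z₀∩Z₁ = Z∩X
        ; Z₀-B = meets (inj₁ (Meets.∈X N-B₁)) (Meets.∈B N-B₁) λ { (inj₁ i) j → Meets.only N-B₁ i j ; (inj₂ i) j → ⊥-elim (Y∩B₁ i j) }
        ; Z₁-B = X-B₁ }

      parallel-attach₂ : Attached U B₂ r₀ r₁ p₂ q₂
      parallel-attach₂ = record
        { Z₀ = Z ; Z₁ = X ; B⊆U = B₂⊆U ; Z₀⊆U = Z⊆U ; Z₁⊆U = X⊆U ; Z₀-conn = Z-conn ; Z₁-conn = X-conn
        ; r₀∈Z₀ = inj₂ r₀∈Y ; r₁∈Z₁ = r₁∈X ; Z₀∩Z₁ = Z∩X
        ; Z₀-B = meets (inj₁ (Meets.∈X N-B₂)) (Meets.∈B N-B₂) λ { (inj₁ i) j → Meets.only N-B₂ i j ; (inj₂ i) j → ⊥-elim (Y∩B₂ i j) }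
        ; Z₁-B = X-B₂ }

      -- N absorbs the Y sets of both models and becomes the new tree root, so their `M~Y` edges
      -- become the edges to the two children. The apex sets merge through X, and `N~Y` attaches the
      -- new root to r₀'s side.
      parallel-tree : ∀ {a} → RootedTree a B₁ p₁ q₁ → RootedTree a B₂ p₂ q₂ → RootedTree (suc a) U r₀ r₁
      parallel-tree {a} R₁ R₂ = record
        { Y = Y ; X = (X ∪ P.X) ∪ Q.X ; S = M ∪ P.S ∪ Q.S ; M = M
        ; Y⊆U = Y⊆U ; X⊆U = λ { (inj₁ (inj₁ i)) → X⊆U i ; (inj₁ (inj₂ i)) → B₁⊆U (P.X⊆U i) ; (inj₂ i) → B₂⊆U (Q.X⊆U i) }
        ; S⊆U = λ { (inj₁ (inj₁ (inj₁ i))) → N⊆U i ; (inj₁ (inj₁ (inj₂ i))) → B₁⊆U (P.Y⊆U i) ; (inj₁ (inj₂ i)) → B₂⊆U (Q.Y⊆U i)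
                  ; (inj₂ (inj₁ i)) → B₁⊆U (P.S⊆U i) ; (inj₂ (inj₂ i)) → B₂⊆U (Q.S⊆U i) }
        ; Y-conn = Y-conn
        ; X-conn = conn-∪-meet (conn-∪-meet X-conn P.X-conn (Meets.∈X X-B₁) P.r₁∈X) Q.X-conn (inj₁ (Meets.∈X X-B₂)) Q.r₁∈X
        ; r₀∈Y = r₀∈Y ; r₁∈X = inj₁ (inj₁ r₁∈X)
        ; Y∩X = λ { i (inj₁ (inj₁ j)) → Y∩X i j ; i (inj₁ (inj₂ j)) → Y∩B₁ i (P.X⊆U j) ; i (inj₂ j) → Y∩B₂ i (Q.X⊆U j) }
        ; Y∩S = λ { i (inj₁ (inj₁ (inj₁ j))) → Y∩N i j ; i (inj₁ (inj₁ (inj₂ j))) → Y∩B₁ i (P.Y⊆U j) ; i (inj₁ (inj₂ j)) → Y∩B₂ i (Q.Y⊆U j)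
                  ; i (inj₂ (inj₁ j)) → Y∩B₁ i (P.S⊆U j) ; i (inj₂ (inj₂ j)) → Y∩B₂ i (Q.S⊆U j) }
        ; X∩S = λ { i (inj₁ j) → M∩X j i ; i (inj₂ (inj₁ j)) → X∩PS i j ; i (inj₂ (inj₂ j)) → X∩QS i j }
        ; tree = node M-conn (inj₁ (inj₁ (Meets.∈X N-B₁)))
            (leaf-mono (adj-mono id (λ i → inj₁ (inj₂ i))) P.tree) (leaf-mono (adj-mono id inj₂) Q.tree)
            (adj-mono (λ i → inj₁ (inj₂ i)) id (adj-sym P.M~Y)) (adj-mono inj₂ id (adj-sym Q.M~Y))
            M∩PS M∩QS (λ i j → B₁∩B₂ (P.S⊆U i) (Q.S⊆U j)) id id
        ; M~Y = adj-mono (λ i → inj₁ (inj₁ i)) id N~Y }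
        where
        module P = RootedTree R₁
        module Q = RootedTree R₂
        M : VSet n
        M = (N ∪ P.Y) ∪ Q.Y
        M-conn : Conn M
        M-conn = conn-∪-meet (conn-∪-meet N-conn P.Y-conn (Meets.∈X N-B₁) P.r₀∈Y) Q.Y-conn (inj₁ (Meets.∈X N-B₂)) Q.r₀∈Y
        M∩PS : Disjoint M P.S
        M∩PS (inj₁ (inj₁ i)) j = meets-disjoint {C = P.S} N-B₁ P.S⊆U (P.Y∩S P.r₀∈Y) i j
        M∩PS (inj₁ (inj₂ i)) j = P.Y∩S i j
        M∩PS (inj₂ i) j = B₁∩B₂ (P.S⊆U j) (Q.Y⊆U i)
        M∩QS : Disjoint M Q.S
        M∩QS (inj₁ (inj₁ i)) j = meets-disjoint {C = Q.S} N-B₂ Q.S⊆U (Q.Y∩S Q.r₀∈Y) i j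
        M∩QS (inj₁ (inj₂ i)) j = B₁∩B₂ (P.Y⊆U i) (Q.S⊆U j)
        M∩QS (inj₂ i) j = Q.Y∩S i j
        X∩PS : Disjoint ((X ∪ P.X) ∪ Q.X) P.S
        X∩PS (inj₁ (inj₁ i)) j = meets-disjoint {C = P.S} X-B₁ P.S⊆U (P.X∩S P.r₁∈X) i j
        X∩PS (inj₁ (inj₂ i)) j = P.X∩S i j
        X∩PS (inj₂ i) j = B₁∩B₂ (P.S⊆U j) (Q.X⊆U i)
        X∩QS : Disjoint ((X ∪ P.X) ∪ Q.X) Q.S
        X∩QS (inj₁ (inj₁ i)) j = meets-disjoint {C = Q.S} X-B₂ Q.S⊆U (Q.X∩S Q.r₁∈X) i j
        X∩QS (inj₁ (inj₂ i)) j = B₁∩B₂ (P.X⊆U i) (Q.S⊆U j)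
        X∩QS (inj₂ i) j = Q.X∩S i j
        M∩X : Disjoint M ((X ∪ P.X) ∪ Q.X)
        M∩X (inj₁ (inj₁ i)) (inj₁ (inj₁ j)) = N∩X i j
        M∩X (inj₁ (inj₁ i)) (inj₁ (inj₂ j)) = meets-disjoint {C = P.X} N-B₁ P.X⊆U (P.Y∩X P.r₀∈Y) i j
        M∩X (inj₁ (inj₁ i)) (inj₂ j) = meets-disjoint {C = Q.X} N-B₂ Q.X⊆U (Q.Y∩X Q.r₀∈Y) i j
        M∩X (inj₁ (inj₂ i)) (inj₁ (inj₁ j)) = meets-disjoint {C = P.Y} X-B₁ P.Y⊆U (λ k → P.Y∩X k P.r₁∈X) j i
        M∩X (inj₁ (inj₂ i)) (inj₁ (inj₂ j)) = P.Y∩X i j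
        M∩X (inj₁ (inj₂ i)) (inj₂ j) = B₁∩B₂ (P.Y⊆U i) (Q.X⊆U j)
        M∩X (inj₂ i) (inj₁ (inj₁ j)) = meets-disjoint {C = Q.Y} X-B₂ Q.Y⊆U (λ k → Q.Y∩X k Q.r₁∈X) j i
        M∩X (inj₂ i) (inj₁ (inj₂ j)) = B₁∩B₂ (P.X⊆U j) (Q.Y⊆U i)
        M∩X (inj₂ i) (inj₂ j) = Q.Y∩X i j

  record Through (U : VSet n) (r₀ r₁ v : Fin n) : Set₁ where
    field
      L R : VSet n
      L⊆U : L ⊆ U
      R⊆U : R ⊆ U
      L-conn : Conn L
      R-conn : Conn R
      r₀∈L : r₀ ∈ L
      r₁∈R : r₁ ∈ R
      v∉L : v ∉ L
      v∉R : v ∉ R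
      v∈U : v ∈ U
      L∩R : Disjoint L R
      L~v : Adj L ｛ v ｝
      v~R : Adj ｛ v ｝ R
      L~R : Adj L R

  -- A bipolar order from r₀ to r₁ with singleton classes, cut at v. The two sides are also adjacent
  -- to each other because v does not separate U.
  through : ∀ {U} → TwoConn U → ∀ {r₀ r₁ v} → r₀ ∈ U → r₁ ∈ U → v ∈ U → r₀ ≢ r₁ → v ≢ r₀ → v ≢ r₁ → Through U r₀ r₁ v
  through {U} two {r₀} {r₁} {v} r₀∈ r₁∈ v∈ r₀≢r₁ v≢r₀ v≢r₁ = build stop (Stop.item∈Q stop)
    where
    open TwoConn two
    U∖∅ : Conn (U ∖ ∅)
    U∖∅ = conn-≐ (λ i → i , λ ()) proj₁ whole
    abstract
      blobs : BlobClasses U ｛ r₁ ｝ ∅ ∅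
      blobs = blob-classes conn-∅ conn-∅ (λ ()) (λ ()) (λ ()) (λ ()) (λ ()) minus U∖∅ U∖∅ (conn-｛｝ r₁) refl (minus r₁)
    open BlobClasses blobs
    one : ∀ w → cls w ≡ ｛ w ｝
    one w = is-single {w} (λ ()) (λ ())
    split : U ⊆ (｛ r₀ ｝ ∪ (U ∖ ｛ r₀ ｝))
    split {w} i with w ≟ r₀
    ... | yes e = inj₁ e
    ... | no o = inj₂ (i , o)
    start : Bipartition classes ｛ r₀ ｝ (U ∖ ｛ r₀ ｝)
    start = record { A⊆U = λ { refl → r₀∈ } ; R⊆U = proj₁ ; cover = split ; apart = λ i j → proj₂ j i
      ; A-conn = conn-｛｝ r₀ ; R-conn = minus r₀ ; T⊆R = λ { refl → r₁∈ , λ e → r₀≢r₁ (sym e) }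
      ; whole = λ {w} i _ {x} j → subst (_∈ (U ∖ ｛ r₀ ｝)) (sym (subst (x ∈_) (one w) j)) i ; a∈A = refl }
    stop : Stop classes ｛ r₀ ｝ ｛ v ｝
    stop = peel-until classes ｛ v ｝ (λ { {z} {w} i refl → sym (subst (v ∈_) (one w) i) }) refl (λ e → v≢r₁ e) _ ｛ r₀ ｝ (U ∖ ｛ r₀ ｝) start
             (λ { refl e → v≢r₀ (sym e) }) (v∈ , v≢r₀) ≤-refl
    build : (s : Stop classes ｛ r₀ ｝ ｛ v ｝) → Stop.item s ≡ v → Through U r₀ r₁ v
    build s e = record
      { L = L ; R = R ; L⊆U = L⊆U ; R⊆U = R⊆U ; L-conn = L-conn ; R-conn = R-conn
      ; r₀∈L = A⊆L refl ; r₁∈R = T⊆R refl ; v∉L = λ i → L∩Q i refl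
      ; v∉R = λ i → subst (λ C → Disjoint C R) eq item∩R refl i ; v∈U = v∈ ; L∩R = L∩R
      ; L~v = subst (Adj L) eq L~item ; v~R = subst (λ C → Adj C R) eq item~R
      ; L~R = split-adj (minus v) cov L∩R (A⊆L refl) (r₀∈ , λ q → v≢r₀ (sym q)) (T⊆R refl) (r₁∈ , λ q → v≢r₁ (sym q)) }
      where
      open Stop s
      eq : cls item ≡ ｛ v ｝
      eq = trans (one item) (cong ｛_｝ e)
      cov : (U ∖ ｛ v ｝) ⊆ (L ∪ R)
      cov {w} (i , o) with subst (λ C → U ⊆ (L ∪ C ∪ R)) eq cover i
      ... | inj₁ j = inj₁ j
      ... | inj₂ (inj₁ j) = ⊥-elim (o j)
      ... | inj₂ (inj₂ j) = inj₂ j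

  through-nabla : ∀ {U r₀ r₁ v} → Through U r₀ r₁ v → RootedNabla zero U r₀ r₁
  through-nabla {v = v} T = record
    { X₀ = L ; X₁ = R ; I = ｛ v ｝ ; X₀⊆U = L⊆U ; X₁⊆U = R⊆U ; I⊆U = λ { refl → v∈U } ; X₀-conn = L-conn ; X₁-conn = R-conn
    ; r₀∈X₀ = r₀∈L ; r₁∈X₁ = r₁∈R ; X₀∩X₁ = L∩R ; X₀∩I = λ { i refl → v∉L i } ; X₁∩I = λ { i refl → v∉R i } ; X₀~X₁ = L~R
    ; nabla = triangle (conn-｛｝ v) refl id L~v (adj-sym v~R) }
    where open Through T

  through-tree : ∀ {U r₀ r₁ v} → Through U r₀ r₁ v → RootedTree zero U r₀ r₁
  through-tree {v = v} T = record
    { Y = L ; X = R ; S = ｛ v ｝ ; M = ｛ v ｝ ; Y⊆U = L⊆U ; X⊆U = R⊆U ; S⊆U = λ { refl → v∈U } ; Y-conn = L-conn ; X-conn = R-conn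
    ; r₀∈Y = r₀∈L ; r₁∈X = r₁∈R ; Y∩X = L∩R ; Y∩S = λ { i refl → v∉L i } ; X∩S = λ { i refl → v∉R i }
    ; tree = leaf (conn-｛｝ v) refl v~R ; M~Y = adj-sym L~v }
    where open Through T

-- One round and the induction on rounds, with `suc j` in the role of ℓ.

module Recursion {n : ℕ} (G : Graph (Fin n)) (_~?_ : ∀ u v → Dec (Graph._~_ G u v)) (j : ℕ) where
  open Connectivity G _~?_
  open Peeling G _~?_
  open Blocks G _~?_
  open Configurations G _~?_
  open Frames G _~?_
  open Trees G _~?_
  open RootedModels G _~?_

  record ApexTree (h : ℕ) : Set₁ where
    field
      X S M : VSet n
      X-conn : Conn X
      {x} : Fin n
      x∈X : x ∈ X
      X∩S : Disjoint X S
      tree : Tree (λ L → Adj L X) h S M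

  rooted-apex : ∀ {h U r₀ r₁} → RootedTree h U r₀ r₁ → ApexTree h
  rooted-apex R = record { X = X ; S = S ; M = M ; X-conn = X-conn ; x∈X = r₁∈X ; X∩S = X∩S ; tree = tree }
    where open RootedTree R

  -- `RootedNabla m` is a model of ∇ with index m + 1, so all three indices are shifted by one.
  -- `tree₀` and `tree₁` differ in which root lies in the apex set. `apex` carries no roots: it is
  -- already a final minor and is passed upwards unchanged.
  data Outcome (m a a′ : ℕ) (U : VSet n) (r₀ r₁ : Fin n) : Set₁ where
    nabla : RootedNabla m U r₀ r₁ → Outcome m a a′ U r₀ r₁
    tree₀ : RootedTree (suc a) U r₀ r₁ → Outcome m a a′ U r₀ r₁
    tree₁ : RootedTree (suc a′) U r₁ r₀ → Outcome m a a′ U r₀ r₁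
    apex  : ApexTree (suc j) → Outcome m a a′ U r₀ r₁

  swap-outcome : ∀ {m a a′ U r₀ r₁} → Outcome m a′ a U r₁ r₀ → Outcome m a a′ U r₀ r₁
  swap-outcome (nabla R) = nabla (nabla-swap R)
  swap-outcome (tree₀ R) = tree₁ R
  swap-outcome (tree₁ R) = tree₀ R
  swap-outcome (apex A) = apex A

  swap-attached : ∀ {U B r₀ r₁ p q} → Attached U B r₀ r₁ p q → Attached U B r₁ r₀ q p
  swap-attached A = record { Z₀ = Z₁ ; Z₁ = Z₀ ; B⊆U = B⊆U ; Z₀⊆U = Z₁⊆U ; Z₁⊆U = Z₀⊆U ; Z₀-conn = Z₁-conn ; Z₁-conn = Z₀-conn
    ; r₀∈Z₀ = r₁∈Z₁ ; r₁∈Z₁ = r₀∈Z₀ ; Z₀∩Z₁ = λ x y → Z₀∩Z₁ y x ; Z₀-B = Z₁-B ; Z₁-B = Z₀-B }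
    where open Attached A

  record BlockTree (h : ℕ) (S : VSet n) : Set₁ where
    field
      B Y M    : VSet n
      two-conn : TwoConn B
      retract  : Retract S B
      tree     : PlainTree h Y M
      Y⊆B      : Y ⊆ B

  block-tree : ∀ {h U S M} → TwoConn U → PlainTree (suc j + h) S M → Pendant U S M → ApexTree (suc j) ⊎ BlockTree h S
  block-tree {U = U} {S} two t p with escape S (U ∖ S) j t
  ... | inj₁ (M′ , t′ , _) = inj₁ (record { X = U ∖ S ; S = S ; M = M′ ; X-conn = Pendant.rest-conn p ; x∈X = tgt∈ (Pendant.M~rest p)
          ; X∩S = λ x y → proj₂ x y ; tree = t′ })
  ... | inj₂ (child t′ (q , ¬a)) = inj₂ (record { B = set ; two-conn = two-conn ; retract = retract ; tree = t′ ; Y⊆B = Y⊆set })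
    where
    open Block (block (tree-conn t′) (root⊆ t′ (proj₂ (root-point t′))) (tree-conn t) (Pendant.D⊆B q)
      (inner-not-cut {U} (TwoConn.minus two) (Pendant.D⊆B p) (tgt∈ (Pendant.M~rest p)) q ¬a))

  record Ends (U D : VSet n) (r₀ r₁ : Fin n) : Set₁ where
    field
      A₀ A₁ : VSet n
      A₀⊆U : A₀ ⊆ U
      A₁⊆U : A₁ ⊆ U
      r₀∈A₀ : r₀ ∈ A₀
      r₁∈A₁ : r₁ ∈ A₁
      A₀-conn : Conn A₀
      A₁-conn : Conn A₁
      A₀∩D : Disjoint A₀ D
      A₁∩D : Disjoint A₁ D
      A₀∩A₁ : Disjoint A₀ A₁
      cover : U ⊆ (A₀ ∪ A₁ ∪ D)
      A₀~D : Adj A₀ D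
      A₁~D : Adj A₁ D
      A₀~A₁ : Adj A₀ A₁

  -- A bipolar order from r₀ to r₁ in which D counts as one vertex, cut at D. The two sides touch
  -- each other because `U ∖ D` is connected.
  ends : ∀ {U D} → TwoConn U → Conn D → D ⊆ U → Conn (U ∖ D) → ∀ {d} → d ∈ D →
         ∀ {r₀ r₁} → r₀ ∈ U → r₁ ∈ U → r₀ ∉ D → r₁ ∉ D → r₀ ≢ r₁ → Ends U D r₀ r₁
  ends {U} {D} two D-conn D⊆U U∖D {d} d∈ {r₀} {r₁} r₀∈ r₁∈ r₀∉ r₁∉ r₀≢r₁ = record
      { A₀ = L ; A₁ = R ; A₀⊆U = L⊆U ; A₁⊆U = R⊆U ; r₀∈A₀ = A⊆L refl ; r₁∈A₁ = T⊆R refl ; A₀-conn = L-conn ; A₁-conn = R-conn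
      ; A₀∩D = L∩Q ; A₁∩D = λ x y → D∩R y x ; A₀∩A₁ = L∩R ; cover = cov
      ; A₀~D = subst (Adj L) eq L~item ; A₁~D = adj-sym (subst (λ C → Adj C R) eq item~R)
      ; A₀~A₁ = split-adj U∖D cov′ L∩R (A⊆L refl) (r₀∈ , r₀∉) (T⊆R refl) (r₁∈ , r₁∉) }
    where
    open TwoConn two
    U∖∅ : Conn (U ∖ ∅)
    U∖∅ = conn-≐ (λ i → i , λ ()) proj₁ whole
    abstract
      D-blob : BlobClasses U ｛ r₁ ｝ D ∅
      D-blob = blob-classes D-conn conn-∅ (λ _ ()) (λ { x refl → r₁∉ x }) (λ ()) D⊆U (λ ()) minus U∖D U∖∅ (conn-｛｝ r₁) refl (minus r₁)
    open BlobClasses D-blob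
    split : U ⊆ (｛ r₀ ｝ ∪ (U ∖ ｛ r₀ ｝))
    split {w} i with w ≟ r₀
    ... | yes e = inj₁ e
    ... | no o = inj₂ (i , o)
    whole′ : ∀ {w} → w ∈ U ∖ ｛ r₀ ｝ → w ∉ ｛ r₁ ｝ → cls w ⊆ (U ∖ ｛ r₀ ｝)
    whole′ {w} i _ {x} y with w ∈? D
    ... | yes k = D⊆U (subst (x ∈_) (is-S₁ k) y) , λ { refl → r₀∉ (subst (x ∈_) (is-S₁ k) y) }
    ... | no k with subst (x ∈_) (is-single k (λ ())) y
    ...   | refl = i
    start : Bipartition classes ｛ r₀ ｝ (U ∖ ｛ r₀ ｝)
    start = record { A⊆U = λ { refl → r₀∈ } ; R⊆U = proj₁ ; cover = split ; apart = λ x y → proj₂ y x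
      ; A-conn = conn-｛｝ r₀ ; R-conn = minus r₀ ; T⊆R = λ { refl → r₁∈ , λ e → r₀≢r₁ (sym e) } ; whole = whole′ ; a∈A = refl }
    stop : Stop classes ｛ r₀ ｝ D
    stop = peel-until classes D closed₁ d∈ (λ { refl → r₁∉ d∈ }) _ ｛ r₀ ｝ (U ∖ ｛ r₀ ｝) start
             (λ { refl → r₀∉ }) (D⊆U d∈ , λ { refl → r₀∉ d∈ }) ≤-refl
    open Stop stop
    eq : cls item ≡ D
    eq = is-S₁ item∈Q
    D∩R : Disjoint D R
    D∩R = subst (λ C → Disjoint C R) eq item∩R
    cov₀ : U ⊆ (L ∪ D ∪ R)
    cov₀ = subst (λ C → U ⊆ (L ∪ C ∪ R)) eq (Stop.cover stop)
    cov : U ⊆ (L ∪ R ∪ D)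
    cov i = mirror-cover (cov₀ i)
    cov′ : (U ∖ D) ⊆ (L ∪ R)
    cov′ (i , o) with cov i
    ... | inj₁ x = inj₁ x
    ... | inj₂ (inj₁ x) = inj₂ x
    ... | inj₂ (inj₂ x) = ⊥-elim (o x)

  -- The height of a tree that survives f further rounds, minus one.
  height : ℕ → ℕ
  height zero = zero
  height (suc f) = suc (suc (suc j + suc (height f)))

  record Configured (f : ℕ) (U : VSet n) (r₀ r₁ : Fin n) : Set₁ where
    field
      {S₁ S₂} : VSet n
      T₁ : BlockTree (suc (height f)) S₁
      T₂ : BlockTree (suc (height f)) S₂
    open BlockTree T₁ public using () renaming (B to B₁)
    open BlockTree T₂ public using () renaming (B to B₂)
    field
      B₁⊆U : B₁ ⊆ U
      B₂⊆U : B₂ ⊆ U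
      B₁∩B₂ : Disjoint B₁ B₂
      config : Configuration U B₁ B₂ r₀ r₁

  -- The levels spent: two to get clear of r₀ and r₁, one from D to its children S₁ and S₂, and
  -- `suc j` for the subtrees tested in `block-tree`. Spanning U first makes the rest outside D
  -- connected.
  configure : ∀ f {U S M r₀ r₁} → TwoConn U → PlainTree (suc (height (suc f))) S M → S ⊆ U → r₀ ∈ U → r₁ ∈ U → r₀ ≢ r₁ →
              ApexTree (suc j) ⊎ Configured f U r₀ r₁
  configure f {U} {r₀ = r₀} {r₁} two t S⊆U r₀∈ r₁∈ r₀≢r₁ with span t S⊆U (TwoConn.whole two)
  ... | _ , tU with grandchild-avoiding tU r₀ r₁
  ...   | child tD (p , r₀∉ , r₁∉) = go tD p r₀∉ r₁∉
    where
    go : ∀ {D M} → PlainTree (suc (suc j + suc (height f))) D M → Pendant U D M → r₀ ∉ D → r₁ ∉ D → ApexTree (suc j) ⊎ Configured f U r₀ r₁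
    go {D} tD@(node {S₁ = S₁} {S₂ = S₂} c i t₁ t₂ a₁ a₂ d₁ d₂ d₃ s s′) p r₀∉ r₁∉ = finish (block-tree two t₁ p₁) (block-tree two t₂ p₂)
          (ends two (tree-conn tD) (Pendant.D⊆B p) (Pendant.rest-conn p) (s′ (inj₁ i)) r₀∈ r₁∈ r₀∉ r₁∉ r₀≢r₁)
      where
      p₁ = child-of-pendant c t₁ t₂ a₁ a₂ d₁ d₃ s s′ p
      p₂ = child-of-pendant c t₂ t₁ a₂ a₁ d₂ (λ x y → d₃ y x) (λ x → mirror-cover (s x)) (λ x → s′ (mirror-cover x)) p
      finish : ApexTree (suc j) ⊎ BlockTree (suc (height f)) S₁ → ApexTree (suc j) ⊎ BlockTree (suc (height f)) S₂ → Ends U D r₀ r₁ → ApexTree (suc j) ⊎ Configured f U r₀ r₁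
      finish (inj₁ a) _ _ = inj₁ a
      finish (inj₂ _) (inj₁ a) _ = inj₁ a
      finish (inj₂ T₁) (inj₂ T₂) E = inj₂ (record
        { T₁ = T₁ ; T₂ = T₂
        ; B₁⊆U = Pendant.D⊆B p₁ ∘ Retract.B⊆S T₁.retract ; B₂⊆U = Pendant.D⊆B p₂ ∘ Retract.B⊆S T₂.retract
        ; B₁∩B₂ = λ x y → d₃ (Retract.B⊆S T₁.retract x) (Retract.B⊆S T₂.retract y)
        ; config = configuration frame })
        where
        module T₁ = BlockTree T₁
        module T₂ = BlockTree T₂
        open Ends E
        other : ∀ {S} (T : BlockTree (suc (height f)) S) q → ∃[ b ] (b ∈ BlockTree.B T × b ≢ q)
        other T q with third-vertex (BlockTree.tree T) q q
        ... | b , b∈ , ne , _ = b , BlockTree.Y⊆B T b∈ , ne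
        without-end : ∀ {A A′} → Conn A′ → Adj A′ D → A′ ⊆ U → Disjoint A A′ → Disjoint A D → U ⊆ (A ∪ A′ ∪ D) → Conn (U ∖ A)
        without-end {A} {A′} c a sub dA dD cv = conn-≐ {A′ ∪ D}
            (λ { (inj₁ x) → sub x , (λ y → dA y x) ; (inj₂ x) → Pendant.D⊆B p x , (λ y → dD y x) }) back (conn-∪ c (tree-conn tD) a)
          where
          back : (U ∖ A) ⊆ (A′ ∪ D)
          back (x , o) with cv x
          ... | inj₁ y = ⊥-elim (o y)
          ... | inj₂ y = y
        cover′ : U ⊆ (A₁ ∪ A₀ ∪ D)
        cover′ x with cover x
        ... | inj₁ y = inj₂ (inj₁ y)
        ... | inj₂ (inj₁ y) = inj₁ y
        ... | inj₂ (inj₂ y) = inj₂ (inj₂ y)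
        frame : Frame U D A₀ A₁ S₁ S₂ T₁.B T₂.B r₀ r₁
        frame = record
          { cover = cover ; U∖x = TwoConn.minus two ; U∖S₁ = Pendant.rest-conn p₁ ; U∖S₂ = Pendant.rest-conn p₂
          ; U∖A₀ = without-end {A₀} {A₁} A₁-conn A₁~D A₁⊆U A₀∩A₁ A₀∩D cover
          ; U∖A₁ = without-end {A₁} {A₀} A₀-conn A₀~D A₀⊆U (λ x y → A₀∩A₁ y x) A₁∩D cover′
          ; D-conn = tree-conn tD ; A₀-conn = A₀-conn ; A₁-conn = A₁-conn ; S₁-conn = tree-conn t₁ ; S₂-conn = tree-conn t₂
          ; D⊆U = Pendant.D⊆B p ; A₀⊆U = A₀⊆U ; A₁⊆U = A₁⊆U ; S₁⊆D = λ x → s′ (inj₂ (inj₁ x)) ; S₂⊆D = λ x → s′ (inj₂ (inj₂ x))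
          ; A₀∩D = A₀∩D ; A₁∩D = A₁∩D ; A₀∩A₁ = A₀∩A₁ ; S₁∩S₂ = d₃ ; A₀~A₁ = A₀~A₁ ; r₀∈A₀ = r₀∈A₀ ; r₁∈A₁ = r₁∈A₁
          ; retract₁ = T₁.retract ; retract₂ = T₂.retract ; other₁ = other T₁ ; other₂ = other T₂ }

  module _ {U B₁ B₂ : VSet n} (B₁⊆U : B₁ ⊆ U) (B₂⊆U : B₂ ⊆ U) (B₁∩B₂ : Disjoint B₁ B₂) where

    -- Two ∇ models are glued. A tree from either block already has the required height and is only
    -- extended to the roots of U.
    series-outcome : ∀ {m a a′ r₀ r₁} → Conn B₁ → Conn B₂ → (σ : Series U B₁ B₂ r₀ r₁) →
      Outcome m a a′ B₁ (Series.u σ) (Series.v σ) → Outcome m a a′ B₂ (Series.s σ) (Series.t σ) → Outcome (suc m) a a′ U r₀ r₁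
    series-outcome {m} {a} {a′} {r₀} {r₁} c₁ c₂ σ x y = go x y
      where
      A₁ = series-attach₁ B₁⊆U B₂⊆U B₁∩B₂ c₁ c₂ σ
      A₂ = series-attach₂ B₁⊆U B₂⊆U B₁∩B₂ c₁ c₂ σ
      go : Outcome m a a′ B₁ (Series.u σ) (Series.v σ) → Outcome m a a′ B₂ (Series.s σ) (Series.t σ) → Outcome (suc m) a a′ U r₀ r₁
      go (nabla R) (nabla R′) = nabla (series-nabla B₁⊆U B₂⊆U B₁∩B₂ c₁ c₂ σ R R′)
      go (tree₀ R) _ = tree₀ (extend-tree A₁ R)
      go (tree₁ R) _ = tree₁ (extend-tree (swap-attached A₁) R)
      go (apex R) _ = apex R
      go _ (tree₀ R) = tree₀ (extend-tree A₂ R)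
      go _ (tree₁ R) = tree₁ (extend-tree (swap-attached A₂) R)
      go _ (apex R) = apex R

    parallel-outcome : ∀ {m a a′ r₀ r₁} (π : Parallel U B₁ B₂ r₀ r₁) →
      Outcome m a a′ B₁ (Parallel.p₁ π) (Parallel.q₁ π) → Outcome m a a′ B₂ (Parallel.p₂ π) (Parallel.q₂ π) → Outcome m (suc a) a′ U r₀ r₁
    parallel-outcome {m} {a} {a′} {r₀} {r₁} π x y = go x y
      where
      A₁ = parallel-attach₁ B₁⊆U B₂⊆U B₁∩B₂ π
      A₂ = parallel-attach₂ B₁⊆U B₂⊆U B₁∩B₂ π
      go : Outcome m a a′ B₁ (Parallel.p₁ π) (Parallel.q₁ π) → Outcome m a a′ B₂ (Parallel.p₂ π) (Parallel.q₂ π) → Outcome m (suc a) a′ U r₀ r₁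
      go (tree₀ R) (tree₀ R′) = tree₀ (parallel-tree B₁⊆U B₂⊆U B₁∩B₂ π R R′)
      go (nabla R) _ = nabla (extend-nabla A₁ R)
      go (tree₁ R) _ = tree₁ (extend-tree (swap-attached A₁) R)
      go (apex R) _ = apex R
      go _ (nabla R) = nabla (extend-nabla A₂ R)
      go _ (tree₁ R) = tree₁ (extend-tree (swap-attached A₂) R)
      go _ (apex R) = apex R

  through-block : ∀ {h U S M r₀ r₁} → TwoConn U → PlainTree (suc h) S M → S ⊆ U → r₀ ∈ U → r₁ ∈ U → r₀ ≢ r₁ → ∃[ v ] Through U r₀ r₁ v
  through-block {r₀ = r₀} {r₁} two t S⊆U r₀∈ r₁∈ ne with third-vertex t r₀ r₁
  ... | v , v∈ , v≢r₀ , v≢r₁ = v , through two r₀∈ r₁∈ (S⊆U v∈) ne v≢r₀ v≢r₁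

  apart : ∀ {A B : VSet n} → Disjoint A B → ∀ {u v} → u ∈ A → v ∈ B → u ≢ v
  apart {B = B} d i k e = d i (subst (_∈ B) (sym e) k)

  Claim : ℕ → ℕ → ℕ → ℕ → Set₁
  Claim f m a a′ = ∀ {U S M r₀ r₁} → TwoConn U → PlainTree (suc (height f)) S M → S ⊆ U → r₀ ∈ U → r₁ ∈ U → r₀ ≢ r₁ → Outcome m a a′ U r₀ r₁

  module _ {f : ℕ} {U : VSet n} {r₀ r₁ : Fin n} (c : Configured f U r₀ r₁) where
    open Configured c
    private
      module T₁ = BlockTree T₁
      module T₂ = BlockTree T₂

    series-step : ∀ {m a a′} → Claim f m a a′ → Series U B₁ B₂ r₀ r₁ ⊎ Series U B₂ B₁ r₀ r₁ → Outcome (suc m) a a′ U r₀ r₁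
    series-step ih (inj₁ σ) = series-outcome B₁⊆U B₂⊆U B₁∩B₂ (TwoConn.whole T₁.two-conn) (TwoConn.whole T₂.two-conn) σ
        (ih T₁.two-conn T₁.tree T₁.Y⊆B (Meets.∈B X₀-B₁) (Meets.∈B N-B₁) (apart {X₀} {N} X₀∩N (Meets.∈X X₀-B₁) (Meets.∈X N-B₁)))
        (ih T₂.two-conn T₂.tree T₂.Y⊆B (Meets.∈B N-B₂) (Meets.∈B X₁-B₂) (apart {N} {X₁} N∩X₁ (Meets.∈X N-B₂) (Meets.∈X X₁-B₂)))
      where open Series σ
    series-step ih (inj₂ σ) = series-outcome B₂⊆U B₁⊆U (λ x y → B₁∩B₂ y x) (TwoConn.whole T₂.two-conn) (TwoConn.whole T₁.two-conn) σ
        (ih T₂.two-conn T₂.tree T₂.Y⊆B (Meets.∈B X₀-B₁) (Meets.∈B N-B₁) (apart {X₀} {N} X₀∩N (Meets.∈X X₀-B₁) (Meets.∈X N-B₁)))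
        (ih T₁.two-conn T₁.tree T₁.Y⊆B (Meets.∈B N-B₂) (Meets.∈B X₁-B₂) (apart {N} {X₁} N∩X₁ (Meets.∈X N-B₂) (Meets.∈X X₁-B₂)))
      where open Series σ

    -- For a equal to zero, trees of height zero suffice in the blocks and `through-tree` gives them
    -- directly; hence the induction hypothesis is asked for only when a is a successor.
    parallel-step : ∀ {m} a a′ {s₀ s₁} → (∀ b → a ≡ suc b → Claim f m b a′) → Parallel U B₁ B₂ s₀ s₁ → Outcome m a a′ U s₀ s₁
    parallel-step zero a′ ih π = tree₀ (parallel-tree B₁⊆U B₂⊆U B₁∩B₂ π
        (through-tree (proj₂ (through-block T₁.two-conn T₁.tree T₁.Y⊆B (Meets.∈B N-B₁) (Meets.∈B X-B₁) (apart {N} {X} N∩X (Meets.∈X N-B₁) (Meets.∈X X-B₁)))))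
        (through-tree (proj₂ (through-block T₂.two-conn T₂.tree T₂.Y⊆B (Meets.∈B N-B₂) (Meets.∈B X-B₂) (apart {N} {X} N∩X (Meets.∈X N-B₂) (Meets.∈X X-B₂))))))
      where open Parallel π
    parallel-step (suc a) a′ ih π = parallel-outcome B₁⊆U B₂⊆U B₁∩B₂ π
        (ih a refl T₁.two-conn T₁.tree T₁.Y⊆B (Meets.∈B N-B₁) (Meets.∈B X-B₁) (apart {N} {X} N∩X (Meets.∈X N-B₁) (Meets.∈X X-B₁)))
        (ih a refl T₂.two-conn T₂.tree T₂.Y⊆B (Meets.∈B N-B₂) (Meets.∈B X-B₂) (apart {N} {X} N∩X (Meets.∈X N-B₂) (Meets.∈X X-B₂)))
      where open Parallel π

  -- A series lowers m, a parallel pair lowers a or a′ according to its orientation, and the claim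
  -- with the lowered index is applied to both blocks. So `m + (a + a′)` drops by one with each
  -- round.
  claim : ∀ f m a a′ → m + (a + a′) ≤ f → Claim f m a a′
  -- ∇ with index 1 is a triangle, found around any third vertex.
  claim f zero a a′ _ two t S⊆U r₀∈ r₁∈ ne = nabla (through-nabla (proj₂ (through-block two t S⊆U r₀∈ r₁∈ ne)))
  claim (suc f) (suc m) a a′ (s≤s le) two t S⊆U r₀∈ r₁∈ ne with configure f two t S⊆U r₀∈ r₁∈ ne
  ... | inj₁ A = apex A
  ... | inj₂ c with Configured.config c
  ...   | series₁₂ σ = series-step c (claim f m a a′ le) (inj₁ σ)
  ...   | series₂₁ σ = series-step c (claim f m a a′ le) (inj₂ σ)
  ...   | parallel₀ π = parallel-step c a a′ (λ { b refl → claim f (suc m) b a′ (≤-trans (≤-reflexive (sym (+-suc m (b + a′)))) le) }) π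
  ...   | parallel₁ π = swap-outcome (parallel-step c a′ a
            (λ { b refl → claim f (suc m) b a (≤-trans (≤-reflexive (trans (cong (λ x → suc (m + x)) (+-comm b a)) (trans (sym (+-suc m (a + b))) (cong (m +_) (sym (+-suc a b)))))) le) }) π)

-- From families of branch sets to minor models.

module Models {n : ℕ} (G : Graph (Fin n)) (_~?_ : ∀ u v → Dec (Graph._~_ G u v)) where
  open Connectivity G _~?_
  open Trees G _~?_
  open RootedModels G _~?_

  -- `locate` is what turns set-valued branch sets into the partial map β from vertices of G.
  record Family {W : Set} (H : Graph W) : Set₁ where
    field
      sets     : W → VSet n
      locate   : ∀ v → Dec (∃[ h ] v ∈ sets h)
      unique   : ∀ {v h h′} → v ∈ sets h → v ∈ sets h′ → h ≡ h′
      inhabited : ∀ h → ∃[ v ] v ∈ sets h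
      sets-conn : ∀ h → Conn (sets h)
      sets-adj  : ∀ {h h′} → Graph._~_ H h h′ → Adj (sets h) (sets h′)

  family-model : ∀ {W} {H : Graph W} → Family H → H ≼ G
  family-model {W} F = record
    { β = β ; nonempty = λ h → let (v , i) = inhabited h in v , to i
    ; connected = λ h u v p q → widen to (path (sets-conn h) (from p) (from q))
    ; edges = λ h h′ e → let a = sets-adj e in src a , tgt a , to (src∈ a) , to (tgt∈ a) , edge a }
    where
    open Family F
    β : Fin n → Maybe W
    β v with locate v
    ... | yes (h , _) = just h
    ... | no _ = nothing
    to : ∀ {v h} → v ∈ sets h → β v ≡ just h
    to {v} i with locate v
    ... | yes (_ , k) = cong just (unique k i)
    ... | no k = ⊥-elim (k (_ , i))
    from : ∀ {v h} → β v ≡ just h → v ∈ sets h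
    from {v} p with locate v
    from refl | yes (_ , k) = k

  inner : ∀ {m I X₀ X₁} → Nabla m I X₀ X₁ → NI m → VSet n
  inner (triangle {T = T} _ _ _ _ _) _ = T
  inner (glue {T = T} _ _ _ _ _ _ _ _ _ _ _ _) (inj₁ _) = T
  inner (glue _ _ _ _ _ _ _ _ _ _ x _) (inj₂ (inj₁ i)) = inner x i
  inner (glue _ _ _ _ _ _ _ _ _ _ _ y) (inj₂ (inj₂ i)) = inner y i

  inner⊆ : ∀ {m I X₀ X₁} (N : Nabla m I X₀ X₁) i → inner N i ⊆ I
  inner⊆ (triangle _ _ s _ _) _ = s
  inner⊆ (glue _ _ s _ _ _ _ _ _ _ _ _) (inj₁ _) = s
  inner⊆ (glue _ _ _ _ _ u₁ _ _ _ _ x _) (inj₂ (inj₁ i)) k = u₁ (inner⊆ x i k)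
  inner⊆ (glue _ _ _ _ _ _ u₂ _ _ _ _ y) (inj₂ (inj₂ i)) k = u₂ (inner⊆ y i k)

  inner-conn : ∀ {m I X₀ X₁} (N : Nabla m I X₀ X₁) i → Conn (inner N i)
  inner-conn (triangle c _ _ _ _) _ = c
  inner-conn (glue c _ _ _ _ _ _ _ _ _ _ _) (inj₁ _) = c
  inner-conn (glue _ _ _ _ _ _ _ _ _ _ x _) (inj₂ (inj₁ i)) = inner-conn x i
  inner-conn (glue _ _ _ _ _ _ _ _ _ _ _ y) (inj₂ (inj₂ i)) = inner-conn y i

  inner-point : ∀ {m I X₀ X₁} (N : Nabla m I X₀ X₁) i → ∃[ v ] v ∈ inner N i
  inner-point (triangle _ t∈ _ _ _) _ = _ , t∈
  inner-point (glue _ t∈ _ _ _ _ _ _ _ _ _ _) (inj₁ _) = _ , t∈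
  inner-point (glue _ _ _ _ _ _ _ _ _ _ x _) (inj₂ (inj₁ i)) = inner-point x i
  inner-point (glue _ _ _ _ _ _ _ _ _ _ _ y) (inj₂ (inj₂ i)) = inner-point y i

  inner-unique : ∀ {m I X₀ X₁} (N : Nabla m I X₀ X₁) i j {v} → v ∈ inner N i → v ∈ inner N j → i ≡ j
  inner-unique (triangle _ _ _ _ _) _ _ _ _ = refl
  inner-unique (glue _ _ _ _ _ _ _ _ _ _ _ _) (inj₁ _) (inj₁ _) _ _ = refl
  inner-unique (glue _ _ _ _ _ _ _ d₁ _ _ x _) (inj₁ _) (inj₂ (inj₁ j)) k l = ⊥-elim (d₁ k (inner⊆ x j l))
  inner-unique (glue _ _ _ _ _ _ _ _ d₂ _ _ y) (inj₁ _) (inj₂ (inj₂ j)) k l = ⊥-elim (d₂ k (inner⊆ y j l))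
  inner-unique (glue _ _ _ _ _ _ _ d₁ _ _ x _) (inj₂ (inj₁ i)) (inj₁ _) k l = ⊥-elim (d₁ l (inner⊆ x i k))
  inner-unique (glue _ _ _ _ _ _ _ _ d₂ _ _ y) (inj₂ (inj₂ i)) (inj₁ _) k l = ⊥-elim (d₂ l (inner⊆ y i k))
  inner-unique (glue _ _ _ _ _ _ _ _ _ _ x _) (inj₂ (inj₁ i)) (inj₂ (inj₁ j)) k l = cong (inj₂ ∘ inj₁) (inner-unique x i j k l)
  inner-unique (glue _ _ _ _ _ _ _ _ _ d₃ x y) (inj₂ (inj₁ i)) (inj₂ (inj₂ j)) k l = ⊥-elim (d₃ (inner⊆ x i k) (inner⊆ y j l))
  inner-unique (glue _ _ _ _ _ _ _ _ _ d₃ x y) (inj₂ (inj₂ i)) (inj₂ (inj₁ j)) k l = ⊥-elim (d₃ (inner⊆ x j l) (inner⊆ y i k))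
  inner-unique (glue _ _ _ _ _ _ _ _ _ _ _ y) (inj₂ (inj₂ i)) (inj₂ (inj₂ j)) k l = cong (inj₂ ∘ inj₂) (inner-unique y i j k l)

  inner-locate : ∀ {m I X₀ X₁} (N : Nabla m I X₀ X₁) v → Dec (∃[ i ] v ∈ inner N i)
  inner-locate (triangle {T = T} _ _ _ _ _) v with v ∈? T
  ... | yes k = yes (tt , k)
  ... | no o = no λ { (_ , k) → o k }
  inner-locate (glue {T = T} _ _ _ _ _ _ _ _ _ _ x y) v with v ∈? T | inner-locate x v | inner-locate y v
  ... | yes k | _ | _ = yes (inj₁ tt , k)
  ... | no _ | yes (i , k) | _ = yes (inj₂ (inj₁ i) , k)
  ... | no _ | no _ | yes (i , k) = yes (inj₂ (inj₂ i) , k)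
  ... | no o | no o₁ | no o₂ = no λ { (inj₁ _ , k) → o k ; (inj₂ (inj₁ i) , k) → o₁ (i , k) ; (inj₂ (inj₂ i) , k) → o₂ (i , k) }

  vertex : ∀ {m I X₀ X₁} → Nabla m I X₀ X₁ → NV m → VSet n
  vertex {X₀ = X₀} N (inj₁ false) = X₀
  vertex {X₁ = X₁} N (inj₁ true) = X₁
  vertex N (inj₂ i) = inner N i

  vertex-adj : ∀ {m I X₀ X₁} (N : Nabla m I X₀ X₁) → Adj X₀ X₁ → ∀ {x y} → NAdj m x y → Adj (vertex N x) (vertex N y)
  vertex-adj (triangle _ _ _ a b) r {inj₁ false} {inj₁ false} ne = ⊥-elim (ne refl)
  vertex-adj (triangle _ _ _ a b) r {inj₁ false} {inj₁ true} ne = r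
  vertex-adj (triangle _ _ _ a b) r {inj₁ false} {inj₂ _} ne = a
  vertex-adj (triangle _ _ _ a b) r {inj₁ true} {inj₁ false} ne = adj-sym r
  vertex-adj (triangle _ _ _ a b) r {inj₁ true} {inj₁ true} ne = ⊥-elim (ne refl)
  vertex-adj (triangle _ _ _ a b) r {inj₁ true} {inj₂ _} ne = b
  vertex-adj (triangle _ _ _ a b) r {inj₂ _} {inj₁ false} ne = adj-sym a
  vertex-adj (triangle _ _ _ a b) r {inj₂ _} {inj₁ true} ne = adj-sym b
  vertex-adj (triangle _ _ _ a b) r {inj₂ _} {inj₂ _} ne = ⊥-elim (ne refl)
  vertex-adj (glue _ _ _ _ _ _ _ _ _ _ _ _) r (inj₁ (refl , refl)) = r
  vertex-adj (glue _ _ _ _ _ _ _ _ _ _ _ _) r (inj₂ (inj₁ (refl , refl))) = adj-sym r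
  -- The first copy has root sets X₀ and T, so its root edge is the adjacency a stored with the
  -- triangle.
  vertex-adj N@(glue _ _ _ a _ _ _ _ _ _ x _) r (inj₂ (inj₂ (inj₁ (p , q , e , refl , refl)))) =
    subst₂ Adj (copy p) (copy q) (vertex-adj x a e)
    where
    copy : ∀ p → vertex x p ≡ vertex N (c₁ p)
    copy (inj₁ false) = refl
    copy (inj₁ true) = refl
    copy (inj₂ _) = refl
  vertex-adj N@(glue _ _ _ _ b _ _ _ _ _ _ y) r (inj₂ (inj₂ (inj₂ (p , q , e , refl , refl)))) =
    subst₂ Adj (copy p) (copy q) (vertex-adj y b e)
    where
    copy : ∀ p → vertex y p ≡ vertex N (c₂ p)
    copy (inj₁ false) = refl
    copy (inj₁ true) = refl
    copy (inj₂ _) = refl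

  nabla-model : ∀ {m U r₀ r₁} → RootedNabla m U r₀ r₁ → ∇′ m ≼ G
  nabla-model {m} R = family-model (record
    { sets = vertex nabla ; locate = loc ; unique = λ {v} {h} {h′} → uni h h′ ; inhabited = inh ; sets-conn = con ; sets-adj = vertex-adj nabla X₀~X₁ })
    where
    open RootedNabla R
    loc : ∀ v → Dec (∃[ h ] v ∈ vertex nabla h)
    loc v with v ∈? X₀ | v ∈? X₁ | inner-locate nabla v
    ... | yes k | _ | _ = yes (inj₁ false , k)
    ... | no _ | yes k | _ = yes (inj₁ true , k)
    ... | no _ | no _ | yes (i , k) = yes (inj₂ i , k)
    ... | no o | no o₁ | no o₂ = no λ { (inj₁ false , k) → o k ; (inj₁ true , k) → o₁ k ; (inj₂ i , k) → o₂ (i , k) }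
    uni : ∀ h h′ {v} → v ∈ vertex nabla h → v ∈ vertex nabla h′ → h ≡ h′
    uni (inj₁ false) (inj₁ false) _ _ = refl
    uni (inj₁ false) (inj₁ true) k l = ⊥-elim (X₀∩X₁ k l)
    uni (inj₁ false) (inj₂ i) k l = ⊥-elim (X₀∩I k (inner⊆ nabla i l))
    uni (inj₁ true) (inj₁ false) k l = ⊥-elim (X₀∩X₁ l k)
    uni (inj₁ true) (inj₁ true) _ _ = refl
    uni (inj₁ true) (inj₂ i) k l = ⊥-elim (X₁∩I k (inner⊆ nabla i l))
    uni (inj₂ i) (inj₁ false) k l = ⊥-elim (X₀∩I l (inner⊆ nabla i k))
    uni (inj₂ i) (inj₁ true) k l = ⊥-elim (X₁∩I l (inner⊆ nabla i k))
    uni (inj₂ i) (inj₂ i′) k l = cong inj₂ (inner-unique nabla i i′ k l)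
    inh : ∀ h → ∃[ v ] v ∈ vertex nabla h
    inh (inj₁ false) = _ , r₀∈X₀
    inh (inj₁ true) = _ , r₁∈X₁
    inh (inj₂ i) = inner-point nabla i
    con : ∀ h → Conn (vertex nabla h)
    con (inj₁ false) = X₀-conn
    con (inj₁ true) = X₁-conn
    con (inj₂ i) = inner-conn nabla i

  -- Addresses are read from the root, whereas the vertices of Γ are read towards it.
  branch-set : ∀ {P h S M} → Tree P h S M → List Bool → VSet n
  branch-set (leaf {S = S} _ _ _) [] = S
  branch-set (leaf _ _ _) (_ ∷ _) = ∅
  branch-set (node {M = M} _ _ _ _ _ _ _ _ _ _ _) [] = M
  branch-set (node _ _ t₁ _ _ _ _ _ _ _ _) (false ∷ p) = branch-set t₁ p
  branch-set (node _ _ _ t₂ _ _ _ _ _ _ _) (true ∷ p) = branch-set t₂ p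

  module _ {P : VSet n → Set} where

    at-root : ∀ {h S M} (t : Tree P h S M) → branch-set t [] ≡ M
    at-root (leaf _ _ _) = refl
    at-root (node _ _ _ _ _ _ _ _ _ _ _) = refl

    branch-set⊆ : ∀ {h S M} (t : Tree P h S M) p → branch-set t p ⊆ S
    branch-set⊆ (leaf _ _ _) [] k = k
    branch-set⊆ (node _ _ _ _ _ _ _ _ _ _ s′) [] k = s′ (inj₁ k)
    branch-set⊆ (node _ _ t₁ _ _ _ _ _ _ _ s′) (false ∷ p) k = s′ (inj₂ (inj₁ (branch-set⊆ t₁ p k)))
    branch-set⊆ (node _ _ _ t₂ _ _ _ _ _ _ s′) (true ∷ p) k = s′ (inj₂ (inj₂ (branch-set⊆ t₂ p k)))

    branch-set-conn : ∀ {h S M} (t : Tree P h S M) p → Conn (branch-set t p)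
    branch-set-conn (leaf c _ _) [] = c
    branch-set-conn (leaf _ _ _) (_ ∷ _) = conn-∅
    branch-set-conn (node c _ _ _ _ _ _ _ _ _ _) [] = c
    branch-set-conn (node _ _ t₁ _ _ _ _ _ _ _ _) (false ∷ p) = branch-set-conn t₁ p
    branch-set-conn (node _ _ _ t₂ _ _ _ _ _ _ _) (true ∷ p) = branch-set-conn t₂ p

    branch-set-point : ∀ {h S M} (t : Tree P h S M) p → length p ≤ h → ∃[ v ] v ∈ branch-set t p
    branch-set-point (leaf _ i _) [] _ = _ , i
    branch-set-point (node _ i _ _ _ _ _ _ _ _ _) [] _ = _ , i
    branch-set-point (node _ _ t₁ _ _ _ _ _ _ _ _) (false ∷ p) (s≤s le) = branch-set-point t₁ p le
    branch-set-point (node _ _ _ t₂ _ _ _ _ _ _ _) (true ∷ p) (s≤s le) = branch-set-point t₂ p le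

    branch-set-unique : ∀ {h S M} (t : Tree P h S M) p q {v} → v ∈ branch-set t p → v ∈ branch-set t q → p ≡ q
    branch-set-unique (leaf _ _ _) [] [] _ _ = refl
    branch-set-unique (node _ _ _ _ _ _ _ _ _ _ _) [] [] _ _ = refl
    branch-set-unique (node _ _ t₁ _ _ _ d₁ _ _ _ _) [] (false ∷ q) k l = ⊥-elim (d₁ k (branch-set⊆ t₁ q l))
    branch-set-unique (node _ _ _ t₂ _ _ _ d₂ _ _ _) [] (true ∷ q) k l = ⊥-elim (d₂ k (branch-set⊆ t₂ q l))
    branch-set-unique (node _ _ t₁ _ _ _ d₁ _ _ _ _) (false ∷ p) [] k l = ⊥-elim (d₁ l (branch-set⊆ t₁ p k))
    branch-set-unique (node _ _ _ t₂ _ _ _ d₂ _ _ _) (true ∷ p) [] k l = ⊥-elim (d₂ l (branch-set⊆ t₂ p k))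
    branch-set-unique (node _ _ t₁ _ _ _ _ _ _ _ _) (false ∷ p) (false ∷ q) k l = cong (false ∷_) (branch-set-unique t₁ p q k l)
    branch-set-unique (node _ _ t₁ t₂ _ _ _ _ d₃ _ _) (false ∷ p) (true ∷ q) k l = ⊥-elim (d₃ (branch-set⊆ t₁ p k) (branch-set⊆ t₂ q l))
    branch-set-unique (node _ _ t₁ t₂ _ _ _ _ d₃ _ _) (true ∷ p) (false ∷ q) k l = ⊥-elim (d₃ (branch-set⊆ t₁ q l) (branch-set⊆ t₂ p k))
    branch-set-unique (node _ _ _ t₂ _ _ _ _ _ _ _) (true ∷ p) (true ∷ q) k l = cong (true ∷_) (branch-set-unique t₂ p q k l)

    branch-set-locate : ∀ {h S M} (t : Tree P h S M) v → Dec (∃[ p ] (length p ≤ h × v ∈ branch-set t p))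
    branch-set-locate (leaf {S = S} _ _ _) v with v ∈? S
    ... | yes k = yes ([] , z≤n , k)
    ... | no o = no λ { ([] , _ , k) → o k ; (_ ∷ _ , () , _) }
    branch-set-locate (node {M = M} _ _ t₁ t₂ _ _ _ _ _ _ _) v with v ∈? M | branch-set-locate t₁ v | branch-set-locate t₂ v
    ... | yes k | _ | _ = yes ([] , z≤n , k)
    ... | no _ | yes (p , le , k) | _ = yes (false ∷ p , s≤s le , k)
    ... | no _ | no _ | yes (p , le , k) = yes (true ∷ p , s≤s le , k)
    ... | no o | no o₁ | no o₂ = no λ { ([] , _ , k) → o k ; (false ∷ p , s≤s le , k) → o₁ (p , le , k) ; (true ∷ p , s≤s le , k) → o₂ (p , le , k) }

    branch-set-adj : ∀ {h S M} (t : Tree P h S M) p b → length p < h → Adj (branch-set t p) (branch-set t (p ∷ʳ b))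
    branch-set-adj (node {M = M} _ _ t₁ _ a₁ _ _ _ _ _ _) [] false _ = subst (Adj M) (sym (at-root t₁)) a₁
    branch-set-adj (node {M = M} _ _ _ t₂ _ a₂ _ _ _ _ _) [] true _ = subst (Adj M) (sym (at-root t₂)) a₂
    branch-set-adj (node _ _ t₁ _ _ _ _ _ _ _ _) (false ∷ p) b (s≤s lt) = branch-set-adj t₁ p b lt
    branch-set-adj (node _ _ _ t₂ _ _ _ _ _ _ _) (true ∷ p) b (s≤s lt) = branch-set-adj t₂ p b lt

    leaf-property : ∀ {h S M} (t : Tree P h S M) p → length p ≡ h → P (branch-set t p)
    leaf-property (leaf _ _ q) [] _ = q
    leaf-property (node _ _ t₁ _ _ _ _ _ _ _ _) (false ∷ p) e = leaf-property t₁ p (suc-injective e)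
    leaf-property (node _ _ _ t₂ _ _ _ _ _ _ _) (true ∷ p) e = leaf-property t₂ p (suc-injective e)

  apex-model : ∀ {h X S M x} → Conn X → x ∈ X → Disjoint X S → Tree (λ L → Adj L X) h S M → Γ⁺ h ≼ G
  apex-model {h} {X} {S} {x = x} X-conn x∈ dis t = family-model (record
    { sets = sets ; locate = loc ; unique = λ {v} {w} {w′} → uni w w′ ; inhabited = inh ; sets-conn = con ; sets-adj = λ {w} {w′} → ed w w′ })
    where
    sets : Maybe (TV h) → VSet n
    sets nothing = X
    sets (just (w , _)) = branch-set t (reverse w)
    loc : ∀ v → Dec (∃[ w ] v ∈ sets w)
    loc v with v ∈? X | branch-set-locate t v
    ... | yes k | _ = yes (nothing , k)
    ... | no _ | yes (p , le , k) = yes (just (reverse p , subst (_≤ h) (sym (length-reverse p)) le) , subst (λ q → v ∈ branch-set t q) (sym (reverse-involutive p)) k)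
    ... | no o | no o′ = no λ { (nothing , k) → o k ; (just (w , le) , k) → o′ (reverse w , subst (_≤ h) (sym (length-reverse w)) le , k) }
    uni : ∀ w w′ {v} → v ∈ sets w → v ∈ sets w′ → w ≡ w′
    uni nothing nothing _ _ = refl
    uni nothing (just (w , _)) k l = ⊥-elim (dis k (branch-set⊆ t (reverse w) l))
    uni (just (w , _)) nothing k l = ⊥-elim (dis l (branch-set⊆ t (reverse w) k))
    uni (just (w , le)) (just (w′ , le′)) k l with reverse-injective {x = w} {y = w′} (branch-set-unique t (reverse w) (reverse w′) k l)
    ... | refl = cong (λ q → just (w , q)) (≤-irrelevant le le′)
    inh : ∀ w → ∃[ v ] v ∈ sets w
    inh nothing = x , x∈
    inh (just (w , le)) = branch-set-point t (reverse w) (subst (_≤ h) (sym (length-reverse w)) le)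
    con : ∀ w → Conn (sets w)
    con nothing = X-conn
    con (just (w , _)) = branch-set-conn t (reverse w)
    down : ∀ w b → length (b ∷ w) ≤ h → Adj (branch-set t (reverse w)) (branch-set t (reverse (b ∷ w)))
    down w b le = subst (λ q → Adj (branch-set t (reverse w)) (branch-set t q)) (sym (unfold-reverse b w))
      (branch-set-adj t (reverse w) b (subst (λ l → suc l ≤ h) (sym (length-reverse w)) le))
    ed : ∀ w w′ → Graph._~_ (Γ⁺ h) w w′ → Adj (sets w) (sets w′)
    ed nothing (just (w , _)) e = adj-sym (leaf-property t (reverse w) (trans (length-reverse w) e))
    ed (just (w , _)) nothing e = leaf-property t (reverse w) (trans (length-reverse w) e)
    ed (just (w , _)) (just (_ , le)) (inj₁ (b , refl)) = down w b le
    ed (just (_ , le)) (just (w , _)) (inj₂ (b , refl)) = adj-sym (down w b le)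

-- The adjacency of G need not be decidable, but the hypotheses use only finitely many of its edges.
module EdgeSelection {n : ℕ} (G : Graph (Fin n)) where

  record Edges : Set₁ where
    field
      rel   : Fin n → Fin n → Set
      rel?  : ∀ u v → Dec (rel u v)
      rsym  : ∀ {u v} → rel u v → rel v u
      sound : ∀ {u v} → rel u v → Graph._~_ G u v
  open Edges public

  none : Edges
  none = record { rel = λ _ _ → ⊥ ; rel? = λ _ _ → no λ () ; rsym = id ; sound = λ () }

  single : ∀ {a b} → Graph._~_ G a b → Edges
  single {a} {b} e = record
    { rel = λ u v → (u ≡ a × v ≡ b) ⊎ (u ≡ b × v ≡ a)
    ; rel? = λ u v → (u ≟ a ×-dec v ≟ b) ⊎-dec (u ≟ b ×-dec v ≟ a)
    ; rsym = λ { (inj₁ (p , q)) → inj₂ (q , p) ; (inj₂ (p , q)) → inj₁ (q , p) }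
    ; sound = λ { (inj₁ (refl , refl)) → e ; (inj₂ (refl , refl)) → Graph.sym~ G e } }

  infixr 5 _⊔_
  _⊔_ : Edges → Edges → Edges
  E ⊔ F = record
    { rel = λ u v → rel E u v ⊎ rel F u v ; rel? = λ u v → rel? E u v ⊎-dec rel? F u v
    ; rsym = λ { (inj₁ p) → inj₁ (rsym E p) ; (inj₂ p) → inj₂ (rsym F p) }
    ; sound = λ { (inj₁ p) → sound E p ; (inj₂ p) → sound F p } }

  ⨆ : (Fin n → Edges) → Edges
  ⨆ E = record { rel = λ u v → ∃[ i ] rel (E i) u v ; rel? = λ u v → any? (λ i → rel? (E i) u v)
    ; rsym = λ { (i , p) → i , rsym (E i) p } ; sound = λ { (i , p) → sound (E i) p } }

  infix 4 _≼ᴱ_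
  _≼ᴱ_ : Edges → Edges → Set
  E ≼ᴱ F = ∀ {u v} → rel E u v → rel F u v

  subgraph : Edges → Graph (Fin n)
  subgraph E = record { _~_ = rel E ; sym~ = rsym E ; irrefl~ = λ p → Graph.irrefl~ G (sound E p) }

  along : ∀ {P u v} → Walk G P u v → Edges
  along (here _) = none
  along (step _ e w) = single e ⊔ along w

  restrict : ∀ {P u v} E (w : Walk G P u v) → along w ≼ᴱ E → Walk (subgraph E) P u v
  restrict E (here p) _ = here p
  restrict E (step p e w) i = step p (i (inj₁ (inj₁ (refl , refl)))) (restrict E w (i ∘ inj₂))

  relax : ∀ {P u v} E → Walk (subgraph E) P u v → Walk G P u v
  relax E (here p) = here p
  relax E (step p e w) = step p (sound E e) (relax E w)

  relax-model : ∀ {W} {H : Graph W} E → H ≼ subgraph E → H ≼ G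
  relax-model E m = record { β = β ; nonempty = nonempty ; connected = λ h u v p q → relax E (connected h u v p q)
    ; edges = λ h h′ e → let (u , v , p , q , r) = edges h h′ e in u , v , p , q , sound E r }
    where open MinorModel m

  module _ (two : TwoConnected G) where
    private
      walk : Connected G
      walk = proj₁ (proj₂ two)
      detour : ∀ x u v → u ≢ x → v ≢ x → Walk G (_≢ x) u v
      detour = proj₂ (proj₂ two)

      -- The chosen walk may depend on the proofs of `u ≢ x` and `v ≢ x`. In a union over all
      -- triples these come from the decisions; triples without them contribute nothing.
      detour-edges : ∀ x u v → Dec (u ≡ x) → Dec (v ≡ x) → Edges
      detour-edges x u v (no p) (no q) = along (detour x u v p q)
      detour-edges _ _ _ _ _ = none

    connectivity-edges : Edges
    connectivity-edges = ⨆ (λ u → ⨆ (λ v → along (walk u v))) ⊔ ⨆ (λ x → ⨆ (λ u → ⨆ (λ v → detour-edges x u v (u ≟ x) (v ≟ x))))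

    module _ (E : Edges) (incl : connectivity-edges ≼ᴱ E) where
      open Connectivity (subgraph E) (rel? E)
      open Blocks (subgraph E) (rel? E)

      two-conn-full : TwoConn full
      two-conn-full = record
        { whole = conn λ {u} {v} _ _ → restrict′ (walk u v) (λ r → incl (inj₁ (u , v , r)))
        ; minus = λ x → conn λ { {u} {v} (_ , p) (_ , q) → avoid x u v p q (u ≟ x) (v ≟ x) (λ r → incl (inj₂ (x , u , v , r))) } }
        where
        restrict′ : ∀ {u v} (w : Walk G (λ _ → ⊤) u v) → along w ≼ᴱ E → Walk (subgraph E) (_∈ full) u v
        restrict′ w i = restrict E w i
        avoid : ∀ x u v → u ≢ x → v ≢ x → (d : Dec (u ≡ x)) (d′ : Dec (v ≡ x)) → detour-edges x u v d d′ ≼ᴱ E → Walk (subgraph E) (_∈ (full ∖ ｛ x ｝)) u v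
        avoid x u v p q (yes e) _ _ = ⊥-elim (p e)
        avoid x u v p q (no _) (yes e) _ = ⊥-elim (q e)
        avoid x u v p q (no a) (no b) i = widen (λ ne → tt , ne) (restrict E (detour x u v a b) i)

  module _ {k : ℕ} (model : Γ k ≼ G) where
    open MinorModel model

    private
      _≟ᵂ_ : ∀ (w w′ : List Bool) → Dec (w ≡ w′)
      _≟ᵂ_ = ≡-dec Bool._≟_

      _≟ᵀ_ : ∀ (h h′ : TV k) → Dec (h ≡ h′)
      (w , p) ≟ᵀ (w′ , q) with w ≟ᵂ w′
      ... | yes refl = yes (cong (w ,_) (≤-irrelevant p q))
      ... | no o = no λ { refl → o refl }

      child? : ∀ (w w′ : List Bool) → Dec (∃[ b ] w′ ≡ b ∷ w)
      child? w w′ with w′ ≟ᵂ (false ∷ w) | w′ ≟ᵂ (true ∷ w)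
      ... | yes p | _ = yes (false , p)
      ... | no _ | yes p = yes (true , p)
      ... | no o | no o′ = no λ { (false , p) → o p ; (true , p) → o′ p }

      -- The values of β are generalised to x and y, so that cases can be distinguished on them
      -- while the equations still feed `connected`.
      walk-edges : ∀ {u v} x y → β u ≡ x → β v ≡ y → Edges
      walk-edges {u} {v} (just h) (just h′) p q with h ≟ᵀ h′
      ... | yes e = along (connected h u v p (trans q (cong just (sym e))))
      ... | no _ = none
      walk-edges _ _ _ _ = none

      tree-edges : Maybe (TV k) → Maybe (TV k) → Edges
      tree-edges (just h) (just h′) with child? (proj₁ h) (proj₁ h′)
      ... | yes e = single (proj₂ (proj₂ (proj₂ (proj₂ (edges h h′ (inj₁ e))))))
      ... | no _ = none
      tree-edges _ _ = none

    model-edges : Edges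
    model-edges = ⨆ (λ u → ⨆ (λ v → walk-edges {u} {v} (β u) (β v) refl refl)) ⊔ ⨆ (λ u → ⨆ (λ v → tree-edges (β u) (β v)))

    module _ (E : Edges) (incl : model-edges ≼ᴱ E) where
      open Connectivity (subgraph E) (rel? E)
      open Trees (subgraph E) (rel? E)

      private
        word : Fin n → Maybe (List Bool)
        word v = Maybe.map proj₁ (β v)

        bag : List Bool → VSet n
        bag w = vset (λ v → word v ≡ just w) (λ v → Maybe.≡-dec _≟ᵂ_ (word v) (just w))

        β-of : ∀ {v w} → word v ≡ just w → Σ (length w ≤ k) λ p → β v ≡ just (w , p)
        β-of {v} e with β v
        β-of refl | just (w , p) = p , refl

        restrict-walk : ∀ {u v h} x y (p : β u ≡ x) (q : β v ≡ y) → x ≡ just h → y ≡ just h → walk-edges {u} {v} x y p q ≼ᴱ E →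
                        Walk (subgraph E) (λ z → β z ≡ just h) u v
        restrict-walk {u} {v} (just h) (just .h) p q refl refl i with h ≟ᵀ h
        ... | yes e = restrict E (connected h u v p (trans q (cong just (sym e)))) i
        ... | no o = ⊥-elim (o refl)

        bag-conn : ∀ w → Conn (bag w)
        bag-conn w = conn go
          where
          go : ∀ {u v} → word u ≡ just w → word v ≡ just w → Walk (subgraph E) (_∈ bag w) u v
          go {u} {v} i j with β-of {u} i | β-of {v} j
          ... | p , e | q , e′ = widen (λ r → cong (Maybe.map proj₁) r)
                (restrict-walk {h = w , p} (β u) (β v) refl refl e (trans e′ (cong (λ l → just (w , l)) (≤-irrelevant q p))) (λ r → incl (inj₁ (u , v , r))))

        bag-point : ∀ w → length w ≤ k → ∃[ v ] v ∈ bag w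
        bag-point w p with nonempty (w , p)
        ... | v , e = v , cong (Maybe.map proj₁) e

        tree-adj : ∀ h h′ → (∃[ b ] proj₁ h′ ≡ b ∷ proj₁ h) → tree-edges (just h) (just h′) ≼ᴱ E → Adj (bag (proj₁ h)) (bag (proj₁ h′))
        tree-adj h h′ c i with child? (proj₁ h) (proj₁ h′)
        ... | no o = ⊥-elim (o c)
        ... | yes e with edges h h′ (inj₁ e)
        ...   | u , v , p , q , r = adj (cong (Maybe.map proj₁) p) (cong (Maybe.map proj₁) q) (i (inj₁ (refl , refl)))

        bag-adj : ∀ w b → length (b ∷ w) ≤ k → Adj (bag w) (bag (b ∷ w))
        bag-adj w b p with nonempty (w , ≤-trans (n≤1+n _) p) | nonempty (b ∷ w , p)
        ... | u , e | v , e′ = tree-adj (w , _) (b ∷ w , p) (b , refl)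
              (λ r → incl (inj₂ (u , v , subst₂ (λ x y → rel (tree-edges x y) _ _) (sym e) (sym e′) r)))

        longer : ∀ u b (w : List Bool) → u ++ (b ∷ w) ≢ w
        longer u b w e = 1+n≰n (≤-trans (m≤n+m (length (b ∷ w)) (length u)) (≤-reflexive (trans (sym (length-++ u)) (cong length e))))

        branch : ∀ u u′ (w : List Bool) → u ++ (false ∷ w) ≢ u′ ++ (true ∷ w)
        branch u u′ w e with ∷ʳ-injective u u′ (++-cancelʳ w (u ∷ʳ false) (u′ ∷ʳ true)
                               (trans (++-assoc u (false ∷ []) w) (trans e (sym (++-assoc u′ (true ∷ []) w)))))
        ... | _ , ()

      -- The last component says that S contains only vertices labelled by descendants of w.
      -- Disjointness of a bag from the subtrees below it, and of sibling subtrees, then reduces to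
      -- comparing words by `longer` and `branch`.
      model-tree : ∀ h w → length w + h ≤ k → Σ (VSet n) λ S → PlainTree h S (bag w) × (∀ {v} → v ∈ S → ∃[ u ] word v ≡ just (u ++ w))
      model-tree zero w le with bag-point w (≤-trans (m≤m+n (length w) 0) le)
      ... | _ , i = bag w , leaf (bag-conn w) i tt , λ e → [] , e
      model-tree (suc h) w le with model-tree h (false ∷ w) le′ | model-tree h (true ∷ w) le′ | bag-point w (≤-trans (m≤m+n (length w) (suc h)) le)
        where le′ = subst (_≤ k) (+-suc (length w) h) le
      ... | S₁ , t₁ , a₁ | S₂ , t₂ , a₂ | _ , i =
        (bag w ∪ S₁ ∪ S₂) , node (bag-conn w) i t₁ t₂ (bag-adj w false le″) (bag-adj w true le″)
          (λ x y → let (u , e) = a₁ y in longer u false w (Maybe.just-injective (trans (sym e) x)))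
          (λ x y → let (u , e) = a₂ y in longer u true w (Maybe.just-injective (trans (sym e) x)))
          (λ x y → let (u , e) = a₁ x ; (u′ , e′) = a₂ y in branch u u′ w (Maybe.just-injective (trans (sym e) e′)))
          id id , above
        where
        le″ : suc (length w) ≤ k
        le″ = ≤-trans (m≤m+n (suc (length w)) h) (subst (_≤ k) (+-suc (length w) h) le)
        above : ∀ {v} → v ∈ (bag w ∪ S₁ ∪ S₂) → ∃[ u ] word v ≡ just (u ++ w)
        above (inj₁ e) = [] , e
        above (inj₂ (inj₁ x)) with a₁ x
        ... | u , e = u ∷ʳ false , trans e (cong just (sym (++-assoc u (false ∷ []) w)))
        above (inj₂ (inj₂ x)) with a₂ x
        ... | u , e = u ∷ʳ true , trans e (cong just (sym (++-assoc u (true ∷ []) w)))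

-- The numerical bound and the conclusion.

module _ (j : ℕ) where
  open +-*-Solver

  private
    rounds : ℕ
    rounds = j + (j + j)

    slack : ℕ
    slack = 6 * j * j + 3 * j + 6

  -- With ℓ = j + 1, `rounds` is 3(ℓ - 1) and `4 + j` is ℓ + 3; `slack` is 9ℓ² - 3ℓ minus their
  -- product. The final 1 pays for the tree that must be left after the last round to supply a third
  -- vertex.
  height-enough : rounds * (4 + j) + 1 ≤ (9 * suc j * suc j ∸ 3 * suc j) + 1
  height-enough = +-monoˡ-≤ 1 (≤-trans (m≤m+n (rounds * (4 + j)) slack) (≤-reflexive (sym exact)))
    where
    exact : 9 * suc j * suc j ∸ 3 * suc j ≡ rounds * (4 + j) + slack
    exact = trans (cong (_∸ 3 * suc j)
      (solve 1 (λ x → con 9 :* (con 1 :+ x) :* (con 1 :+ x) :=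
         ((x :+ (x :+ x)) :* (con 4 :+ x) :+ (con 6 :* x :* x :+ con 3 :* x :+ con 6)) :+ con 3 :* (con 1 :+ x)) refl j))
      (m+n∸n≡m (rounds * (4 + j) + slack) (3 * suc j))

theorem6p1 : (ℓ k : ℕ) → {{_ : NonZero ℓ}} → (9 * ℓ * ℓ ∸ 3 * ℓ) + 1 ≤ k →
    (n : ℕ) (G : Graph (Fin n)) → TwoConnected G → Γ k ≼ G →
    (Γ⁺ ℓ ≼ G) ⊎ (∇ ℓ ≼ G)
theorem6p1 (suc j) k bound zero G (() , _) model
theorem6p1 (suc j) k bound (suc zero) G (s≤s () , _) model
theorem6p1 (suc j) k bound (suc (suc n)) G two model =
  -- Any two distinct vertices can be the roots; here they are `zero` and `suc zero`. With all three
  -- targets equal to j, every outcome is one of the two required minors of `subgraph E`, and hence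
  -- of G.
  conclude (claim (j + (j + j)) j j j ≤-refl (two-conn-full G two E inj₁) Γ-tree (λ _ → tt) tt tt (λ ()))
  where
  open EdgeSelection G using (Edges; rel?; subgraph; _⊔_; relax-model)
  E : Edges
  E = EdgeSelection.connectivity-edges G two ⊔ EdgeSelection.model-edges G model
  open Recursion (subgraph E) (rel? E) j
  open Models (subgraph E) (rel? E)
  open Trees (subgraph E) (rel? E)
  open EdgeSelection using (two-conn-full; model-tree)

  height-formula : ∀ f → suc (height f) ≡ f * (4 + j) + 1
  height-formula zero = refl
  height-formula (suc f) = trans (cong (λ h → suc (suc (suc (suc (j + h))))) (height-formula f)) (cong (4 +_) (sym (+-assoc j (f * (4 + j)) 1)))

  Γ-tree = proj₁ (proj₂ (model-tree G model E inj₂ (suc (height (j + (j + j)))) []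
    (≤-trans (≤-reflexive (height-formula (j + (j + j)))) (≤-trans (height-enough j) bound))))

  conclude : Outcome j j j full zero (suc zero) → (Γ⁺ (suc j) ≼ G) ⊎ (∇ (suc j) ≼ G)
  conclude (nabla R) = inj₂ (relax-model E (nabla-model R))
  conclude (tree₀ R) = conclude (apex (rooted-apex R))
  conclude (tree₁ R) = conclude (apex (rooted-apex R))
  conclude (apex A) = inj₁ (relax-model E (apex-model X-conn x∈X X∩S tree))
    where open ApexTree A
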